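{- Let $n\ge 1$, $s\ge 0$ be integers and let $k$ be an integer with $2\le k\le n/2$. For $0\le j\le n$ put $a_j=\binom{n+s-j}{n-j}$, let $b_0,\dots,b_n$ be integers with $|b_0|=|b_n|=1$, and let $$G(x)=\sum_{j=0}^{n} b_ja_j\frac{x^j}{j!}.$$ Assume that $G(x)$ has a factor of degree $k$ over $\mathbb{Q}$. Then: (a) $s>1.9k$ unless $(n,k,s)=(10,5,4)$; (b) $s>1.99k$ if $n\ge 48732$; and for every $\phi$ with $0<\phi<\frac19$ there exists a number $N$ depending only on $\phi$ such that $s>2(1-2\phi)k$ whenever $n\ge N$.
   Context: "Factor" means a factor of positive degree in $\mathbb{Q}[x]$ (irreducibility is always over $\mathbb{Q}$). Note that $g(x)=\sum_{j=0}^n a_j x^j/j!$ equals $(-1)^nL_n^{(-n-s-1)}(x)$, where $L_n^{(\alpha)}(x)=\sum_{j=0}^n\frac{(\alpha+n)\cdots(\alpha+j+1)}{(n-j)!}\frac{(-x)^j}{j!}$ is the generalised Laguerre polynomial. -}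

module Defs where

open import Data.Nat as ℕ using (ℕ; zero; suc; _!; _∸_)
open import Data.Nat.Properties using (_!≢0)
open import Data.Nat.Combinatorics using (_C_)
open import Data.Integer as ℤ using (ℤ; +_)
open import Data.Rational as ℚ using (ℚ; 0ℚ; _+_; _*_; _/_)
open import Data.Fin as Fin using (Fin; toℕ)
open import Data.List as List using (List; []; _∷_; tabulate)
open import Data.Product using (Σ; ∃; _×_)
open import Relation.Binary.PropositionalEquality using (_≡_; _≢_)

-- Polynomials in ℚ[x] as coefficient lists, lowest degree first.
Poly : Set
Poly = List ℚ

coeff : Poly → ℕ → ℚ
coeff []       _       = 0ℚ
coeff (a ∷ p)  zero    = a
coeff (a ∷ p)  (suc m) = coeff p m

infixl 6 _+ₚ_
infixl 7 _*ₚ_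

_+ₚ_ : Poly → Poly → Poly
[]      +ₚ q       = q
(a ∷ p) +ₚ []      = a ∷ p
(a ∷ p) +ₚ (b ∷ q) = (a + b) ∷ (p +ₚ q)

_*ₚ_ : Poly → Poly → Poly
[]      *ₚ q = []
(a ∷ p) *ₚ q = List.map (a *_) q +ₚ (0ℚ ∷ (p *ₚ q))

-- equality of polynomials (coefficientwise, so trailing zeros are irrelevant)
_≈ₚ_ : Poly → Poly → Set
p ≈ₚ q = ∀ m → coeff p m ≡ coeff q m

HasDegree : Poly → ℕ → Set
HasDegree p d = (coeff p d ≢ 0ℚ) × (∀ m → d ℕ.< m → coeff p m ≡ 0ℚ)

HasFactorOfDegree : Poly → ℕ → Set
HasFactorOfDegree G d = Σ Poly λ P → Σ Poly λ Q → HasDegree P d × ((P *ₚ Q) ≈ₚ G)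

aCoef : ℕ → ℕ → ℕ → ℕ
aCoef n s j = (n ℕ.+ s ∸ j) C (n ∸ j)

Gpoly : (n s : ℕ) → (Fin (suc n) → ℤ) → Poly
Gpoly n s b = tabulate λ j →
  ((b j ℤ.* + aCoef n s (toℕ j)) / (toℕ j !)) {{toℕ j !≢0}}

Hyp : (n s k : ℕ) → (Fin (suc n) → ℤ) → Set
Hyp n s k b =
  (1 ℕ.≤ n) × (2 ℕ.≤ k) × (2 ℕ.* k ℕ.≤ n)
  × (ℤ.∣ b Fin.zero ∣ ≡ 1) × (ℤ.∣ b (Fin.fromℕ n) ∣ ≡ 1)
  × HasFactorOfDegree (Gpoly n s b) k

{-# OPTIONS --safe #-}
-- The polynomial n! G has integral coefficients b_j c_j with c_n = 1 and c_0 = n! C(n+s,s).  Let p > k be a prime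
-- dividing one of n−k+1, …, n but not C(n+s,s).  Then p divides c_j for all j ≤ n − k, and (p−1) v_p(j!) < j puts all
-- slopes of the Newton polygon of n! G at p below 1/k, so that no factor of degree k exists.  A factor of degree k
-- therefore forces every such p to divide C(n+s,s); when s < 2k this makes p small compared with k, which contradicts
-- the size of C(n,k) by Chebyshev-type bounds if n ≥ 9k, and the existence of a prime in (8n/9, n] or (8s/9, s] if
-- n < 9k.  Small parameters are settled by computation and leave eleven triples (n,k,s) with s < 2k.  The Newton
-- polygons at other primes exclude all of them but (10,5,4), so s ≥ 2k otherwise.
module Submission where

open import Data.Nat as ℕ hiding (_/_)
open import Data.Nat.Properties
open import Data.Nat.DivMod hiding (_/_)
open import Data.Nat.Divisibility
open import Data.Nat.Primality
open import Data.Nat.Induction using (<-rec)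
open import Data.Nat.Combinatorics using (_C_; nCk≡n!/k![n-k]!; k![n∸k]!∣n!; nCk≡nC[n∸k]; nCk+nC[k+1]≡[n+1]C[k+1])
open import Data.Bool using (Bool; true; false; T; if_then_else_; _∧_; _∨_; not)
open import Data.Bool.Properties using (T-∧; T-∨)
open import Data.Unit using (tt)
open import Data.Empty using (⊥; ⊥-elim)
open import Data.Product using (Σ; ∃; _×_; _,_; proj₁; proj₂)
open import Data.Sum using (_⊎_; inj₁; inj₂; [_,_]′)
open import Data.List using (List; []; _∷_; map; length; _++_; filterᵇ)
open import Data.Nat.ListAction using (product)
open import Data.Nat.ListAction.Properties using (∈⇒∣product)
open import Data.List.Relation.Unary.All as All using (All; []; _∷_)
import Data.List.Relation.Unary.All.Properties as All
open import Data.List.Relation.Unary.Any using (Any; here; there)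
open import Data.List.Membership.Propositional using (_∈_)
open import Data.List.Membership.Propositional.Properties using (∈-filter⁺)
open import Relation.Binary.PropositionalEquality
open import Relation.Binary.Definitions using (Tri; tri<; tri≈; tri>)
open import Relation.Nullary using (¬_; Dec; yes; no; does; ¬?)
open import Relation.Nullary.Decidable using (True; T?; toWitness; _×-dec_)
open import Function using (_∘_; case_of_; Equivalence)
open import Data.Nat.Tactic.RingSolver using (solve-∀)

-- All estimates take place in ℕ: ψ is replaced by Ψ = e^ψ, logarithms by certified comparisons with
-- powers of 2, Stirling's formula by comparing N! with products of blocks. Two factorial ratios
-- supply the prime number theory: one bounds Ψ from above, the other forces a prime into (8n/9, n].
-- The fraction 8/9 is dictated by n ≤ 9k, where (8n/9, n] lies inside the window (n-k, n]; beyond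
-- that, C(n,k) is played off against C(s+k,k) or against the number of primes up to 3k. What
-- resists is small k: for k < 10 there are at least k primes below 3k, so the size of C(n,k) does
-- not bound n. There each of the k consecutive numbers owns a prime of which no other one contains
-- a high power, and two numbers at distance d with no further prime at their disposal lead to an
-- equation q^a u + d = q′^b u′ with bounded u and u′, which a congruence refutes. The exceptional
-- triples survive because only primes that divide a member of the window and exceed k have been
-- used; primes above n or up to k then exclude ten of the eleven.

infixl 7 _÷_

-- Integer division, indicators and finite products

_÷_ : ℕ → ℕ → ℕ
n ÷ zero  = 0
n ÷ suc d = n ℕ./ suc d

÷-≤ : ∀ {q n d} → 1 ≤ d → q ≤ n ÷ d → q * d ≤ n
÷-≤ {q} {n} {suc d} _ h = ≤-trans (*-monoˡ-≤ (suc d) h) (m/n*n≤m n (suc d))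

≤-÷ : ∀ {q n d} → 1 ≤ d → q * d ≤ n → q ≤ n ÷ d
≤-÷ {q} {n} {suc d} _ h =
  ≤-trans (≤-reflexive (sym (m*n/n≡m q (suc d)))) (/-monoˡ-≤ (suc d) h)

÷*≤ : ∀ n d → (n ÷ d) * d ≤ n
÷*≤ n zero    = z≤n
÷*≤ n (suc d) = m/n*n≤m n (suc d)

<suc÷* : ∀ n {d} → 1 ≤ d → n < suc (n ÷ d) * d
<suc÷* n {d} 1≤d = ≰⇒> λ h → <-irrefl refl (≤-÷ {suc (n ÷ d)} 1≤d h)

÷-unique : ∀ {q n d} → q * d ≤ n → n < suc q * d → n ÷ d ≡ q
÷-unique {q} {n} {zero} _ h = ⊥-elim (n≮0 (subst (n <_) (*-zeroʳ (suc q)) h))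
÷-unique {q} {n} {suc d} l h = ≤-antisym
  (≮⇒≥ λ q< → <-irrefl refl (<-≤-trans h (÷-≤ {suc q} {n} {suc d} (s≤s z≤n) q<)))
  (≤-÷ {q} (s≤s z≤n) l)

÷-≤-self : ∀ n d → n ÷ d ≤ n
÷-≤-self n zero    = z≤n
÷-≤-self n (suc d) = m/n≤m n (suc d)

<⇒÷≡0 : ∀ {n d} → n < d → n ÷ d ≡ 0
<⇒÷≡0 {n} {d} h = ÷-unique z≤n (subst (n <_) (sym (*-identityˡ d)) h)

÷-÷ : ∀ n a b → 1 ≤ a → 1 ≤ b → n ÷ a ÷ b ≡ n ÷ (a * b)
÷-÷ n a b 1≤a 1≤b = ≤-antisym
  (≤-÷ (*-mono-≤ 1≤a 1≤b) (subst (_≤ n) (e (n ÷ a ÷ b)) (÷-≤ {n ÷ a ÷ b * b} 1≤a (÷-≤ {n ÷ a ÷ b} 1≤b ≤-refl))))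
  (≤-÷ {n ÷ (a * b)} 1≤b (≤-÷ {n ÷ (a * b) * b} 1≤a
    (subst (_≤ n) (sym (e (n ÷ (a * b)))) (÷*≤ n (a * b)))))
  where
  e : ∀ q → q * b * a ≡ q * (a * b)
  e q = trans (*-assoc q b a) (cong (q *_) (*-comm b a))

÷-÷-comm : ∀ n a b → n ÷ a ÷ b ≡ n ÷ b ÷ a
÷-÷-comm n zero    b       = trans (z÷ b) refl where
  z÷ : ∀ b → 0 ÷ b ≡ 0
  z÷ zero = refl
  z÷ (suc b) = 0/n≡0 (suc b)
÷-÷-comm n (suc a) zero    = sym (0/n≡0 (suc a))
÷-÷-comm n (suc a) (suc b) = trans (÷-÷ n (suc a) (suc b) (s≤s z≤n) (s≤s z≤n))
  (trans (cong (n ÷_) (*-comm (suc a) (suc b))) (sym (÷-÷ n (suc b) (suc a) (s≤s z≤n) (s≤s z≤n))))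

χ : {P : Set} → Dec P → ℕ
χ d = if does d then 1 else 0

χ-yes : {P : Set} (d : Dec P) → P → χ d ≡ 1
χ-yes (yes _) _ = refl
χ-yes (no ¬p) p = ⊥-elim (¬p p)

χ-no : {P : Set} (d : Dec P) → ¬ P → χ d ≡ 0
χ-no (yes p) ¬p = ⊥-elim (¬p p)
χ-no (no _) _ = refl

÷-suc : ∀ n d → 1 ≤ d → suc n ÷ d ≡ n ÷ d + χ (d ∣? suc n)
÷-suc n d 1≤d with d ∣? suc n
... | yes (divides q eq) = ÷-unique
        (≤-reflexive (trans (cong (_* d) e) (sym eq)))
        (subst (_< suc (n ÷ d + 1) * d) (sym eq)
          (subst (λ z → q * d < suc z * d) (sym e) (m<n+m (q * d) 1≤d)))
  where
  q≤ : q ≤ suc (n ÷ d)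
  q≤ = *-cancelʳ-≤ q (suc (n ÷ d)) d {{>-nonZero 1≤d}} (subst (_≤ suc (n ÷ d) * d) eq (<suc÷* n 1≤d))
  <q : n ÷ d < q
  <q = *-cancelʳ-< d (n ÷ d) q (≤-<-trans (÷*≤ n d) (subst (n <_) eq (n<1+n n)))
  e : n ÷ d + 1 ≡ q
  e = trans (+-comm (n ÷ d) 1) (≤-antisym <q q≤)
... | no ∤ = ÷-unique
        (subst (λ z → z * d ≤ suc n) (sym (+-identityʳ (n ÷ d))) (m≤n⇒m≤1+n (÷*≤ n d)))
        (subst (λ z → suc n < suc z * d) (sym (+-identityʳ (n ÷ d)))
          (≤∧≢⇒< (<suc÷* n 1≤d) λ e → ∤ (divides (suc (n ÷ d)) e)))

*-swap₄ : ∀ a b c d → a * b * (c * d) ≡ a * c * (b * d)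
*-swap₄ = solve-∀

*-^ : ∀ a b n → (a * b) ^ n ≡ a ^ n * b ^ n
*-^ a b zero    = refl
*-^ a b (suc n) = trans (cong (a * b *_) (*-^ a b n)) (*-swap₄ a b (a ^ n) (b ^ n))

∏ : ℕ → (ℕ → ℕ) → ℕ
∏ zero    f = 1
∏ (suc n) f = ∏ n f * f (suc n)

∏-cong : ∀ n {f g} → (∀ d → 1 ≤ d → d ≤ n → f d ≡ g d) → ∏ n f ≡ ∏ n g
∏-cong zero    h = refl
∏-cong (suc n) h = cong₂ _*_ (∏-cong n λ d a b → h d a (m≤n⇒m≤1+n b)) (h (suc n) (s≤s z≤n) ≤-refl)

∏-mono : ∀ n {f g} → (∀ d → 1 ≤ d → d ≤ n → f d ≤ g d) → ∏ n f ≤ ∏ n g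
∏-mono zero    h = ≤-refl
∏-mono (suc n) h = *-mono-≤ (∏-mono n λ d a b → h d a (m≤n⇒m≤1+n b)) (h (suc n) (s≤s z≤n) ≤-refl)

∏-* : ∀ n f g → ∏ n (λ d → f d * g d) ≡ ∏ n f * ∏ n g
∏-* zero    f g = refl
∏-* (suc n) f g = trans (cong (_* (f (suc n) * g (suc n))) (∏-* n f g))
                        (*-swap₄ (∏ n f) (∏ n g) (f (suc n)) (g (suc n)))

∏-1 : ∀ n → ∏ n (λ _ → 1) ≡ 1
∏-1 zero    = refl
∏-1 (suc n) = trans (*-identityʳ _) (∏-1 n)

∏-≥1 : ∀ n f → (∀ d → 1 ≤ d → d ≤ n → 1 ≤ f d) → 1 ≤ ∏ n f
∏-≥1 n f h = subst (_≤ ∏ n f) (∏-1 n) (∏-mono n h)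

^-∏ : ∀ n f c → ∏ n f ^ c ≡ ∏ n (λ d → f d ^ c)
^-∏ zero    f c = ^-zeroˡ c
^-∏ (suc n) f c = trans (*-^ (∏ n f) (f (suc n)) c) (cong (_* f (suc n) ^ c) (^-∏ n f c))

∏-extend : ∀ {m n} f → m ≤ n → (∀ d → m < d → d ≤ n → f d ≡ 1) → ∏ n f ≡ ∏ m f
∏-extend {m} f m≤n h with m≤n⇒m<n∨m≡n m≤n
... | inj₂ refl = refl
∏-extend {m} {suc n} f m≤n h | inj₁ (s≤s m≤n') =
  trans (cong₂ _*_ (∏-extend f m≤n' λ d a b → h d a (m≤n⇒m≤1+n b)) (h (suc n) (s≤s m≤n') ≤-refl)) (*-identityʳ _)

∏-δ : ∀ n d₀ x → 1 ≤ d₀ → d₀ ≤ n → ∏ n (λ d → x ^ χ (d ≟ d₀)) ≡ x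
∏-δ n d₀ x 1≤d₀ d₀≤n = trans (∏-extend _ d₀≤n λ d a _ → cong (x ^_) (χ-no (d ≟ d₀) (>⇒≢ a))) (lem d₀ 1≤d₀)
  where
  lem : ∀ d₀ → 1 ≤ d₀ → ∏ d₀ (λ d → x ^ χ (d ≟ d₀)) ≡ x
  lem (suc m) _ = trans (cong₂ _*_
      (trans (∏-cong m λ d _ b → cong (x ^_) (χ-no (d ≟ suc m) (<⇒≢ (s≤s b)))) (∏-1 m))
      (cong (x ^_) (χ-yes (suc m ≟ suc m) refl)))
    (trans (*-identityˡ (x * 1)) (*-identityʳ x))

∏-fact : ∀ n → ∏ n (λ d → d) ≡ n !
∏-fact zero    = refl
∏-fact (suc n) = trans (cong (_* suc n) (∏-fact n)) (*-comm (n !) (suc n))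

-- Von Mangoldt's function, in exponential form

2≤⇒nonTrivial : ∀ {n} → 2 ≤ n → NonTrivial n
2≤⇒nonTrivial h = n>1⇒nonTrivial h

prime≥2 : ∀ {p} → Prime p → 2 ≤ p
prime≥2 pp = nonTrivial⇒n>1 _ {{prime⇒nonTrivial pp}}

prime≥1 : ∀ {p} → Prime p → 1 ≤ p
prime≥1 pp = ≤-trans (s≤s z≤n) (prime≥2 pp)

leastFrom : ℕ → ℕ → ℕ → ℕ
leastFrom zero    d n = n
leastFrom (suc f) d n = if does (d ∣? n) then d else leastFrom f (suc d) n

-- When the fuel f is exhausted, d has reached n, so roughness up to d already makes the default
-- value n prime.
leastFrom-prime : ∀ f d n → 2 ≤ d → 2 ≤ n → n ≤ d + f → d Rough n →
                  Prime (leastFrom f d n) × leastFrom f d n ∣ n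
leastFrom-prime zero d n _ 2≤n n≤ r =
  rough∧∣⇒prime {{2≤⇒nonTrivial 2≤n}}
    (λ where (hasNonTrivialDivisor l dv) → r (hasNonTrivialDivisor (<-≤-trans l (subst (n ≤_) (+-identityʳ d) n≤)) dv))
    ∣-refl , ∣-refl
leastFrom-prime (suc f) d n 2≤d 2≤n n≤ r with d ∣? n
... | yes d∣n = rough∧∣⇒prime {{2≤⇒nonTrivial 2≤d}} r d∣n , d∣n
... | no  d∤n = leastFrom-prime f (suc d) n (m≤n⇒m≤1+n 2≤d) 2≤n (subst (n ≤_) (+-suc d f) n≤) (∤⇒rough-suc d∤n r)

pfac : ℕ → ℕ
pfac n = leastFrom n 2 n

pfac-prime : ∀ {n} → 2 ≤ n → Prime (pfac n) × pfac n ∣ n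
pfac-prime {n} h = leastFrom-prime n 2 n ≤-refl h (m≤n+m n 2) 2-rough

∣prime⇒≡ : ∀ {q p} → Prime q → Prime p → q ∣ p → q ≡ p
∣prime⇒≡ {q} pq pp d with prime⇒irreducible pp d
... | inj₁ refl = ⊥-elim (<-irrefl refl (prime≥2 pq))
... | inj₂ e = e

∣^⇒≡ : ∀ {q p} n → Prime q → Prime p → q ∣ p ^ n → q ≡ p
∣^⇒≡ zero pq pp d = ⊥-elim (<⇒≢ (prime≥2 pq) (sym (∣1⇒≡1 d)))
∣^⇒≡ {p = p} (suc n) pq pp d with euclidsLemma p (p ^ n) pq d
... | inj₁ x = ∣prime⇒≡ pq pp x
... | inj₂ y = ∣^⇒≡ n pq pp y

powTest : ℕ → ℕ → ℕ → Bool
powTest zero    p m = false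
powTest (suc f) p m = if m ≡ᵇ 1 then true else (if does (p ∣? m) then powTest f p (m ÷ p) else false)

*÷ : ∀ q p → 1 ≤ p → q * p ÷ p ≡ q
*÷ q (suc p) _ = m*n/n≡m q (suc p)

powTest-sound : ∀ f p m → powTest f p m ≡ true → ∃ λ a → m ≡ p ^ a
powTest-sound (suc f) p m h with m ≡ᵇ 1 in e
... | true = 0 , ≡ᵇ⇒≡ m 1 (subst T (sym e) tt)
... | false with p ∣? m
...   | no _ = case h of λ ()
powTest-sound (suc f) zero m h | false | yes p∣m with powTest-sound f zero 0 h
...     | (zero , ())
...     | (suc a , _) = 1 , 0∣⇒≡0 p∣m
powTest-sound (suc f) (suc p') m h | false | yes (divides q eq) with powTest-sound f (suc p') (m ÷ suc p') h
...     | (a , e') = suc a , trans eq (trans (*-comm q (suc p'))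
            (cong (suc p' *_) (trans (sym (trans (cong (_÷ suc p') eq) (*÷ q (suc p') (s≤s z≤n)))) e')))

powTest-complete : ∀ f {p} a → Prime p → a < f → powTest f p (p ^ a) ≡ true
powTest-complete (suc f) zero _ _ = refl
powTest-complete (suc f) {p} (suc a) pp (s≤s a<f) with p * p ^ a ≡ᵇ 1
... | true = refl
... | false with p ∣? (p * p ^ a)
...   | no ¬d = ⊥-elim (¬d (m∣m*n (p ^ a)))
...   | yes _ = trans (cong (powTest f p) (trans (cong (_÷ p) (*-comm p (p ^ a))) (*÷ (p ^ a) p (prime≥1 pp))))
                      (powTest-complete f a pp a<f)

Λ : ℕ → ℕ
Λ zero          = 1
Λ (suc zero)    = 1
Λ n@(suc (suc _)) = if powTest n (pfac n) n then pfac n else 1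

data ΛView (d : ℕ) : Set where
  unit  : Λ d ≡ 1 → ΛView d
  power : ∀ p a → Prime p → d ≡ p ^ suc a → Λ d ≡ p → ΛView d

Λ-view : ∀ d → ΛView d
Λ-view zero       = unit refl
Λ-view (suc zero) = unit refl
Λ-view n@(suc (suc _)) with powTest n (pfac n) n in e
... | false = unit (cong (λ b → if b then pfac n else 1) e)
... | true with powTest-sound n (pfac n) n e
...   | (zero , ())
...   | (suc a , eq) = power (pfac n) a (proj₁ (pfac-prime {n} (s≤s (s≤s z≤n)))) eq (cong (λ b → if b then pfac n else 1) e)

2≤⇒n<^ : ∀ {p} n → 2 ≤ p → n < p ^ n
2≤⇒n<^ zero h = s≤s z≤n
2≤⇒n<^ {p} (suc n) h = ≤-trans (s≤s (2≤⇒n<^ n h)) (≤-trans (+-monoˡ-≤ (p ^ n) 1≤)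
   (≤-trans (≤-reflexive (cong (p ^ n +_) (sym (+-identityʳ _)))) (*-monoˡ-≤ (p ^ n) h)))
  where
  1≤ : 1 ≤ p ^ n
  1≤ = m^n>0 p {{>-nonZero (≤-trans (s≤s z≤n) h)}} n

Λ-power : ∀ {p} a → Prime p → Λ (p ^ suc a) ≡ p
Λ-power {p} a pp = go (p ^ suc a) refl (≤-trans (s≤s (s≤s z≤n)) (2≤⇒n<^ (suc a) (prime≥2 pp)))
  where
  go : ∀ n → n ≡ p ^ suc a → 2 ≤ n → Λ n ≡ p
  go (suc zero) e (s≤s ())
  go n@(suc (suc _)) e h = trans (cong (λ b → if b then pfac n else 1) t) pf
    where
    pf : pfac n ≡ p
    pf = ∣^⇒≡ (suc a) (proj₁ (pfac-prime h)) pp (subst (pfac n ∣_) e (proj₂ (pfac-prime h)))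
    t : powTest n (pfac n) n ≡ true
    t = trans (cong₂ (powTest n) pf e) (powTest-complete n (suc a) pp
          (subst (suc a <_) (sym e) (2≤⇒n<^ (suc a) (prime≥2 pp))))

Λ≥1 : ∀ d → 1 ≤ Λ d
Λ≥1 d with Λ-view d
... | unit e = ≤-reflexive (sym e)
... | power p a pp _ e = subst (1 ≤_) (sym e) (prime≥1 pp)

1≤^ : ∀ {x} n → 1 ≤ x → 1 ≤ x ^ n
1≤^ {x} n h = m^n>0 x {{>-nonZero h}} n

val-split : ∀ {p} → Prime p → ∀ m → 1 ≤ m → ∃ λ v → ∃ λ w → m ≡ p ^ v * w × ¬ p ∣ w
val-split {p} pp = <-rec _ go
  where
  go : ∀ m → (∀ {y} → y < m → 1 ≤ y → ∃ λ v → ∃ λ w → y ≡ p ^ v * w × ¬ p ∣ w) →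
       1 ≤ m → ∃ λ v → ∃ λ w → m ≡ p ^ v * w × ¬ p ∣ w
  go m rec 1≤m with p ∣? m
  ... | no ∤ = 0 , m , sym (*-identityˡ m) , ∤
  ... | yes (divides zero eq) = ⊥-elim (n≮0 (subst (1 ≤_) eq 1≤m))
  ... | yes (divides q@(suc _) eq) with rec {q} (subst (q <_) (sym eq) (m<m*n q p (prime≥2 pp))) (s≤s z≤n)
  ...   | v , w , e , n = suc v , w ,
            trans eq (trans (*-comm q p) (trans (cong (p *_) e) (sym (*-assoc p (p ^ v) w)))) , n

^∣^*⇒≤ : ∀ {p} → Prime p → ∀ c v w → ¬ p ∣ w → p ^ c ∣ p ^ v * w → c ≤ v
^∣^*⇒≤ pp zero v w n d = z≤n
^∣^*⇒≤ {p} pp (suc c) zero w n d = ⊥-elim (n (∣-trans (m∣m*n (p ^ c)) (subst (p ^ suc c ∣_) (*-identityˡ w) d)))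
^∣^*⇒≤ {p} pp (suc c) (suc v) w n d = s≤s (^∣^*⇒≤ pp c v w n
  (*-cancelˡ-∣ p {{prime⇒nonZero pp}} (subst (p * p ^ c ∣_) (*-assoc p (p ^ v) w) d)))

≤⇒^∣^* : ∀ p {c v} w → c ≤ v → p ^ c ∣ p ^ v * w
≤⇒^∣^* p {c} {v} w h = ∣-trans (divides (p ^ (v ∸ c)) (trans (cong (p ^_) (sym (m∸n+n≡m h))) (^-distribˡ-+-* p (v ∸ c) c))) (m∣m*n w)

prime-pow-cancel : ∀ {q p} → Prime q → ¬ q ∣ p → ∀ b m → q ^ b ∣ p * m → q ^ b ∣ m
prime-pow-cancel pq n zero m d = 1∣ m
prime-pow-cancel {q} {p} pq n (suc b) m d with euclidsLemma p m pq (∣-trans (m∣m*n (q ^ b)) d)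
... | inj₁ x = ⊥-elim (n x)
... | inj₂ (divides m' e) = subst (q ^ suc b ∣_) (sym (trans e (*-comm m' q)))
      (*-monoʳ-∣ q (prime-pow-cancel pq n b m' (*-cancelˡ-∣ q {{prime⇒nonZero pq}}
        (subst (q * q ^ b ∣_) (trans (cong (p *_) (trans e (*-comm m' q))) (sw p q m')) d))))
  where
  sw : ∀ p q m → p * (q * m) ≡ q * (p * m)
  sw = solve-∀

^-inj : ∀ {p} → 2 ≤ p → ∀ a b → p ^ a ≡ p ^ b → a ≡ b
^-inj {p} h a b e with <-cmp a b
... | tri< l _ _ = ⊥-elim (<-irrefl e (^-monoʳ-< p h l))
... | tri≈ _ x _ = x
... | tri> _ _ l = ⊥-elim (<-irrefl (sym e) (^-monoʳ-< p h l))

-- With m₁ = p^v w and p ∤ w, the step from m₁ to p m₁ gains exactly one prime power among the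
-- divisors, namely p^(v+1), which contributes p. Powers of other primes divide both numbers or
-- neither.
∏Λ-divisors-step : ∀ N {p} m₁ → Prime p → 1 ≤ m₁ → p * m₁ ≤ N →
  ∏ N (λ d → Λ d ^ χ (d ∣? p * m₁)) ≡ ∏ N (λ d → Λ d ^ χ (d ∣? m₁)) * p
∏Λ-divisors-step N {p} m₁ pp 1≤m₁ m≤N with val-split pp m₁ 1≤m₁
... | v , w , m₁≡ , p∤w = trans (∏-cong N (λ d _ _ → pt d (Λ-view d)))
    (trans (∏-* N _ _) (cong (∏ N (λ d → Λ d ^ χ (d ∣? m₁)) *_) (∏-δ N (p ^ suc v) p (1≤^ (suc v) (prime≥1 pp)) d₀≤N)))
  where
  m = p * m₁
  m≡ : m ≡ p ^ suc v * w
  m≡ = trans (cong (p *_) m₁≡) (sym (*-assoc p (p ^ v) w))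
  d₀≤N : p ^ suc v ≤ N
  d₀≤N = ≤-trans (∣⇒≤ {{>-nonZero (*-mono-≤ (prime≥1 pp) 1≤m₁)}} (subst (p ^ suc v ∣_) (sym m≡) (m∣m*n w))) m≤N
  pt : ∀ d → ΛView d → Λ d ^ χ (d ∣? m) ≡ Λ d ^ χ (d ∣? m₁) * p ^ χ (d ≟ p ^ suc v)
  pt d (unit e) = trans (trans (cong (_^ χ (d ∣? m)) e) (^-zeroˡ (χ (d ∣? m))))
    (sym (cong₂ _*_ (trans (cong (_^ χ (d ∣? m₁)) e) (^-zeroˡ (χ (d ∣? m₁)))) (cong (p ^_) (χ-no (d ≟ p ^ suc v) ne))))
    where
    ne : ¬ d ≡ p ^ suc v
    ne e' = <⇒≢ (prime≥2 pp) (trans (sym e) (trans (cong Λ e') (Λ-power v pp)))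
  pt d (power q b pq e eΛ) with q ≟ p
  ... | no q≢p = trans (cong (Λ d ^_) (same (d ∣? m) (d ∣? m₁)))
          (sym (trans (cong (λ z → Λ d ^ χ (d ∣? m₁) * p ^ z) (χ-no (d ≟ p ^ suc v) ne)) (*-identityʳ (Λ d ^ χ (d ∣? m₁)))))
    where
    ne : ¬ d ≡ p ^ suc v
    ne e' = q≢p (∣^⇒≡ (suc v) pq pp (subst (q ∣_) (trans (sym e) e') (m∣m*n (q ^ b))))
    to : d ∣ m → d ∣ m₁
    to dm = subst (_∣ m₁) (sym e) (prime-pow-cancel pq (λ qp → q≢p (∣prime⇒≡ pq pp qp)) (suc b) m₁
              (subst (_∣ m) e dm))
    same : (x : Dec (d ∣ m)) (y : Dec (d ∣ m₁)) → χ x ≡ χ y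
    same (yes _) (yes _) = refl
    same (no _) (no _) = refl
    same (yes x) (no y) = ⊥-elim (y (to x))
    same (no x) (yes y) = ⊥-elim (x (∣-trans y (n∣m*n p)))
  ... | yes refl with suc b ≤? v
  ...   | yes le = trans (cong (Λ d ^_) (trans (χ-yes (d ∣? m) (∣-trans dm₁ (n∣m*n p))) (sym (χ-yes (d ∣? m₁) dm₁))))
            (trans (sym (*-identityʳ (Λ d ^ χ (d ∣? m₁)))) (cong (λ z → Λ d ^ χ (d ∣? m₁) * p ^ z) (sym (χ-no (d ≟ p ^ suc v) ne))))
    where
    dm₁ : d ∣ m₁
    dm₁ = subst₂ _∣_ (sym e) (sym m₁≡) (≤⇒^∣^* p w le)
    ne : ¬ d ≡ p ^ suc v
    ne e' = <-irrefl (suc-injective (^-inj (prime≥2 pp) (suc b) (suc v) (trans (sym e) e'))) le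
  ...   | no nle with b ≟ v
  ...     | yes refl = trans (cong (Λ d ^_) (χ-yes (d ∣? m) dm)) (trans (*-identityʳ (Λ d)) (trans eΛ
              (sym (trans (cong₂ _*_ (cong (Λ d ^_) (χ-no (d ∣? m₁) ndm₁)) (cong (p ^_) (χ-yes (d ≟ p ^ suc v) e)))
                 (trans (*-identityˡ (p * 1)) (*-identityʳ p))))))
    where
    dm : d ∣ m
    dm = subst₂ _∣_ (sym e) (sym m≡) (m∣m*n w)
    ndm₁ : ¬ d ∣ m₁
    ndm₁ x = <-irrefl refl (^∣^*⇒≤ pp (suc v) v w p∤w (subst₂ _∣_ e m₁≡ x))
  ...     | no b≢v = trans (cong (Λ d ^_) (χ-no (d ∣? m) ndm))
              (sym (cong₂ _*_ (cong (Λ d ^_) (χ-no (d ∣? m₁) λ x → ndm (∣-trans x (n∣m*n p))))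
                 (cong (p ^_) (χ-no (d ≟ p ^ suc v) λ e' → b≢v (suc-injective (^-inj (prime≥2 pp) (suc b) (suc v) (trans (sym e) e')))))))
    where
    ndm : ¬ d ∣ m
    ndm x with ^∣^*⇒≤ pp (suc b) (suc v) w p∤w (subst₂ _∣_ e m≡ x)
    ... | s≤s b≤v = nle (≤∧≢⇒< b≤v b≢v)

-- The exponential form of Σ_{d ∣ m} Λ(d) = log m, by splitting off one prime factor at a time.
∏Λ-divisors : ∀ N m → 1 ≤ m → m ≤ N → ∏ N (λ d → Λ d ^ χ (d ∣? m)) ≡ m
∏Λ-divisors N = <-rec _ go
  where
  one : ∀ d → Λ d ^ χ (d ∣? 1) ≡ 1
  one d with d ∣? 1
  ... | no _ = refl
  ... | yes h rewrite ∣1⇒≡1 h = refl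
  go : ∀ m → (∀ {y} → y < m → 1 ≤ y → y ≤ N → ∏ N (λ d → Λ d ^ χ (d ∣? y)) ≡ y) →
       1 ≤ m → m ≤ N → ∏ N (λ d → Λ d ^ χ (d ∣? m)) ≡ m
  go m rec 1≤m m≤N with m ≟ 1
  ... | yes refl = trans (∏-cong N λ d _ _ → one d) (∏-1 N)
  ... | no m≢1 with pfac-prime (≤∧≢⇒< 1≤m (m≢1 ∘ sym))
  ...   | pp , divides q eq with pfac m
  ...     | p = subst (λ z → ∏ N (λ d → Λ d ^ χ (d ∣? z)) ≡ z) (trans (*-comm p q) (sym eq))
              (trans (∏Λ-divisors-step N q pp 1≤q pq≤N)
                (trans (cong (_* p) (rec q<m 1≤q (≤-trans (<⇒≤ q<m) m≤N))) (*-comm q p)))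
    where
    1≤q : 1 ≤ q
    1≤q = n≢0⇒n>0 λ { refl → <-irrefl refl (subst (1 ≤_) eq 1≤m) }
    pq≤N : p * q ≤ N
    pq≤N = subst (_≤ N) (trans eq (*-comm q p)) m≤N
    q<m : q < m
    q<m = subst (q <_) (sym eq) (m<m*n q p {{>-nonZero 1≤q}} (prime≥2 pp))

-- Legendre's formula for all primes at once: the step to n + 1 raises ⌊n/d⌋ exactly at the divisors
-- d of n + 1.
∏Λ-factorial : ∀ n N → n ≤ N → ∏ N (λ d → Λ d ^ (n ÷ d)) ≡ n !
∏Λ-factorial zero N _ = trans (∏-cong N λ d _ _ → cong (Λ d ^_) (z÷ d)) (∏-1 N)
  where
  z÷ : ∀ b → 0 ÷ b ≡ 0
  z÷ zero = refl
  z÷ (suc b) = 0/n≡0 (suc b)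
∏Λ-factorial (suc n) N h = trans
  (∏-cong N λ d 1≤d _ → trans (cong (Λ d ^_) (÷-suc n d 1≤d)) (^-distribˡ-+-* (Λ d) (n ÷ d) (χ (d ∣? suc n))))
  (trans (∏-* N _ _)
    (trans (cong₂ _*_ (∏Λ-factorial n N (<⇒≤ h)) (∏Λ-divisors N (suc n) (s≤s z≤n) h)) (*-comm (n !) (suc n))))

-- Factorial ratios and the Chebyshev function

-- A spec stands for the product of (⌊N/a⌋!)^c over its entries (a , c); a factorial ratio is a pair
-- of specs. If every a divides L, then `weight L ν` is L Σ c/a, so equal weights at L say that the
-- ratio is balanced: its main term of order N log N cancels.
Spec : Set
Spec = List (ℕ × ℕ)

-- `yprod` completes each ⌊N/a⌋! by a^⌊N/a⌋ to the product of the multiples of a up to N. The a-th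
-- power of that product is N! up to a factor N^a in either direction, which does the work of
-- Stirling's formula.
facs pows yprod : ℕ → Spec → ℕ
facs N []            = 1
facs N ((a , c) ∷ ν) = ((N ÷ a) !) ^ c * facs N ν
pows N []            = 1
pows N ((a , c) ∷ ν) = (a ^ (N ÷ a)) ^ c * pows N ν
yprod N []            = 1
yprod N ((a , c) ∷ ν) = ((N ÷ a) ! * a ^ (N ÷ a)) ^ c * yprod N ν

weight : ℕ → Spec → ℕ
weight u []            = 0
weight u ((a , c) ∷ ν) = (u ÷ a) * c + weight u ν

count : Spec → ℕ
count []            = 0
count ((a , c) ∷ ν) = c + count ν

facs*pows : ∀ N ν → facs N ν * pows N ν ≡ yprod N ν
facs*pows N []            = refl
facs*pows N ((a , c) ∷ ν) = trans (*-swap₄ (((N ÷ a) !) ^ c) (facs N ν) ((a ^ (N ÷ a)) ^ c) (pows N ν))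
  (cong₂ _*_ (sym (*-^ ((N ÷ a) !) (a ^ (N ÷ a)) c)) (facs*pows N ν))

facs-Λ : ∀ N ν → facs N ν ≡ ∏ N (λ d → Λ d ^ weight (N ÷ d) ν)
facs-Λ N []            = sym (∏-1 N)
facs-Λ N ((a , c) ∷ ν) = trans (cong₂ _*_ e (facs-Λ N ν)) (trans (sym (∏-* N _ _))
    (∏-cong N λ d _ _ → sym (^-distribˡ-+-* (Λ d) ((N ÷ d ÷ a) * c) (weight (N ÷ d) ν))))
  where
  e : ((N ÷ a) !) ^ c ≡ ∏ N (λ d → Λ d ^ ((N ÷ d ÷ a) * c))
  e = trans (cong (_^ c) (sym (∏Λ-factorial (N ÷ a) N (÷-≤-self N a))))
      (trans (^-∏ N _ c) (∏-cong N λ d _ _ → trans (^-*-assoc (Λ d) (N ÷ a ÷ d) c)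
        (cong (λ z → Λ d ^ (z * c)) (÷-÷-comm N a d))))

n!≥1 : ∀ n → 1 ≤ n !
n!≥1 n = >-nonZero⁻¹ (n !) {{n !≢0}}

!-+-≤ : ∀ m a → (m + a) ! ≤ m ! * (m + a) ^ a
!-+-≤ m zero    rewrite +-identityʳ m | *-identityʳ (m !) = ≤-refl
!-+-≤ m (suc a) rewrite +-suc m a = ≤-trans
  (*-monoʳ-≤ (suc (m + a)) (≤-trans (!-+-≤ m a) (*-monoʳ-≤ (m !) (^-monoˡ-≤ a (n≤1+n (m + a))))))
  (≤-reflexive (sw (suc (m + a)) (m !) (suc (m + a) ^ a)))
  where
  sw : ∀ x y z → x * (y * z) ≡ y * (x * z)
  sw = solve-∀

!-+-≥ : ∀ m a → m ! * m ^ a ≤ (m + a) !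
!-+-≥ m zero    rewrite +-identityʳ m | *-identityʳ (m !) = ≤-refl
!-+-≥ m (suc a) rewrite +-suc m a = ≤-trans (≤-reflexive (sw (m !) m (m ^ a)))
  (*-mono-≤ (m≤n⇒m≤1+n (m≤m+n m a)) (!-+-≥ m a))
  where
  sw : ∀ x y z → x * (y * z) ≡ y * (x * z)
  sw = solve-∀

!-mono : ∀ {m n} → m ≤ n → m ! ≤ n !
!-mono {m} {n} h = subst (λ z → m ! ≤ z !) (m+[n∸m]≡n h)
  (≤-trans (≤-trans (≤-reflexive (sym (*-identityʳ (m !)))) (x m (n ∸ m))) (≤-refl))
  where
  x : ∀ m a → m ! * 1 ≤ (m + a) !
  x zero a    = n!≥1 a
  x m@(suc _) a = ≤-trans (*-monoʳ-≤ (m !) (1≤^ a (s≤s z≤n))) (!-+-≥ m a)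

-- (q!)^a a^(aq) is Π_{j ≤ q} (ja)^a, which interleaves with the factors of (aq)!
block-upper : ∀ a q → (a * q) ! ≤ (q ! * a ^ q) ^ a
block-upper a zero rewrite *-zeroʳ a | ^-zeroˡ a = ≤-refl
block-upper a (suc q) = begin
  (a * suc q) !                     ≡⟨ cong _! e ⟩
  (a * q + a) !                     ≤⟨ !-+-≤ (a * q) a ⟩
  (a * q) ! * (a * q + a) ^ a       ≤⟨ *-monoˡ-≤ ((a * q + a) ^ a) (block-upper a q) ⟩
  (q ! * a ^ q) ^ a * (a * q + a) ^ a ≡⟨ sym (*-^ (q ! * a ^ q) (a * q + a) a) ⟩
  (q ! * a ^ q * (a * q + a)) ^ a   ≡⟨ cong (_^ a) (sw (q !) (a ^ q) a q) ⟩
  (suc q ! * a ^ suc q) ^ a         ∎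
  where
  open ≤-Reasoning
  e : a * suc q ≡ a * q + a
  e = trans (*-suc a q) (+-comm a (a * q))
  sw : ∀ f p a q → f * p * (a * q + a) ≡ (f + q * f) * (a * p)
  sw = solve-∀

-- The interleaving of `block-upper` shifted by one block: the a copies of ja lie below the a
-- factors that follow ja.
block-lower : ∀ a q → (q ! * a ^ q) ^ a ≤ (a * suc q) !
block-lower a zero = ≤-trans (≤-reflexive (^-zeroˡ a)) (n!≥1 (a * 1))
block-lower a (suc q) = begin
  (suc q ! * a ^ suc q) ^ a              ≡⟨ cong (_^ a) (sw (q !) (a ^ q) a q) ⟩
  (q ! * a ^ q * (a * suc q)) ^ a        ≡⟨ *-^ (q ! * a ^ q) (a * suc q) a ⟩
  (q ! * a ^ q) ^ a * (a * suc q) ^ a    ≤⟨ *-monoˡ-≤ ((a * suc q) ^ a) (block-lower a q) ⟩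
  (a * suc q) ! * (a * suc q) ^ a        ≤⟨ !-+-≥ (a * suc q) a ⟩
  (a * suc q + a) !                      ≡⟨ cong _! (trans (+-comm (a * suc q) a) (sym (*-suc a (suc q)))) ⟩
  (a * suc (suc q)) !                    ∎
  where
  open ≤-Reasoning
  sw : ∀ f p a q → (f + q * f) * (a * p) ≡ f * p * (a * suc q)
  sw = solve-∀

y-upper : ∀ N a → 1 ≤ N → 1 ≤ a → ((N ÷ a) ! * a ^ (N ÷ a)) ^ a ≤ N ! * N ^ a
y-upper N a 1≤N 1≤a with N ÷ a in e
... | zero  = ≤-trans (≤-reflexive (^-zeroˡ a)) (*-mono-≤ (n!≥1 N) (1≤^ a 1≤N))
... | suc q = begin
  (suc q ! * a ^ suc q) ^ a              ≡⟨ cong (_^ a) (sw (q !) (a ^ q) a q) ⟩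
  (q ! * a ^ q * (a * suc q)) ^ a        ≡⟨ *-^ (q ! * a ^ q) (a * suc q) a ⟩
  (q ! * a ^ q) ^ a * (a * suc q) ^ a    ≤⟨ *-mono-≤ (≤-trans (block-lower a q) (!-mono aq≤N)) (^-monoˡ-≤ a aq≤N) ⟩
  N ! * N ^ a                            ∎
  where
  open ≤-Reasoning
  aq≤N : a * suc q ≤ N
  aq≤N = subst (_≤ N) (trans (cong (_* a) e) (*-comm (suc q) a)) (÷*≤ N a)
  sw : ∀ f p a q → (f + q * f) * (a * p) ≡ f * p * (a * suc q)
  sw = solve-∀

y-lower : ∀ N a → 1 ≤ N → 1 ≤ a → N ! ≤ ((N ÷ a) ! * a ^ (N ÷ a)) ^ a * N ^ a
y-lower N a 1≤N 1≤a = begin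
  N !                                    ≡⟨ cong _! (sym (m+[n∸m]≡n aq≤N)) ⟩
  (a * q + (N ∸ a * q)) !                ≤⟨ !-+-≤ (a * q) (N ∸ a * q) ⟩
  (a * q) ! * (a * q + (N ∸ a * q)) ^ (N ∸ a * q) ≡⟨ cong (λ z → (a * q) ! * z ^ (N ∸ a * q)) (m+[n∸m]≡n aq≤N) ⟩
  (a * q) ! * N ^ (N ∸ a * q)            ≤⟨ *-mono-≤ (block-upper a q) (^-monoʳ-≤ N {{>-nonZero 1≤N}} r≤) ⟩
  (q ! * a ^ q) ^ a * N ^ a              ∎
  where
  open ≤-Reasoning
  q = N ÷ a
  aq≤N : a * q ≤ N
  aq≤N = subst (_≤ N) (*-comm q a) (÷*≤ N a)
  r≤ : N ∸ a * q ≤ a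
  r≤ = m≤n+o⇒m∸n≤o N (a * q) (<⇒≤ (subst (N <_) (trans (+-comm a (q * a)) (cong (_+ a) (*-comm q a))) (<suc÷* N 1≤a)))

Divides : ℕ → Spec → Set
Divides L = All (λ t → 1 ≤ proj₁ t × proj₁ t ∣ L)

∣⇒*÷ : ∀ {a L} → 1 ≤ a → a ∣ L → a * (L ÷ a) ≡ L
∣⇒*÷ {a} 1≤a (divides q refl) = trans (cong (a *_) (*÷ q a 1≤a)) (*-comm a q)

exps : ∀ {a L} c → 1 ≤ a → a ∣ L → c * L ≡ a * ((L ÷ a) * c)
exps {a} {L} c 1≤a d = trans (cong (c *_) (sym (∣⇒*÷ 1≤a d))) (sw c a (L ÷ a)) where
  sw : ∀ c a x → c * (a * x) ≡ a * (x * c)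
  sw = solve-∀

pow-pow : ∀ {a L} y c → 1 ≤ a → a ∣ L → (y ^ c) ^ L ≡ (y ^ a) ^ ((L ÷ a) * c)
pow-pow {a} {L} y c 1≤a d = trans (^-*-assoc y c L) (trans (cong (y ^_) (exps c 1≤a d)) (sym (^-*-assoc y a _)))

N^-pow : ∀ {a L} N c → 1 ≤ a → a ∣ L → (N ^ a) ^ ((L ÷ a) * c) ≡ (N ^ c) ^ L
N^-pow {a} {L} N c 1≤a d = sym (pow-pow N c 1≤a d)

yprod-upper : ∀ N L ν → 1 ≤ N → Divides L ν → yprod N ν ^ L ≤ (N !) ^ weight L ν * (N ^ count ν) ^ L
yprod-upper N L [] _ _ = ≤-reflexive (sym (*-identityˡ (1 ^ L)))
yprod-upper N L ((a , c) ∷ ν) 1≤N ((1≤a , a∣L) ∷ dv) = begin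
  (y ^ c * yprod N ν) ^ L                       ≡⟨ *-^ (y ^ c) (yprod N ν) L ⟩
  (y ^ c) ^ L * yprod N ν ^ L                   ≡⟨ cong (_* yprod N ν ^ L) (pow-pow y c 1≤a a∣L) ⟩
  (y ^ a) ^ e * yprod N ν ^ L                   ≤⟨ *-mono-≤ (^-monoˡ-≤ e (y-upper N a 1≤N 1≤a)) (yprod-upper N L ν 1≤N dv) ⟩
  (N ! * N ^ a) ^ e * ((N !) ^ w * (N ^ count ν) ^ L) ≡⟨ cong (_* ((N !) ^ w * (N ^ count ν) ^ L)) (trans (*-^ (N !) (N ^ a) e) (cong ((N !) ^ e *_) (N^-pow N c 1≤a a∣L))) ⟩
  ((N !) ^ e * (N ^ c) ^ L) * ((N !) ^ w * (N ^ count ν) ^ L) ≡⟨ *-swap₄ ((N !) ^ e) ((N ^ c) ^ L) ((N !) ^ w) ((N ^ count ν) ^ L) ⟩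
  ((N !) ^ e * (N !) ^ w) * ((N ^ c) ^ L * (N ^ count ν) ^ L) ≡⟨ cong₂ _*_ (sym (^-distribˡ-+-* (N !) e w))
        (trans (sym (*-^ (N ^ c) (N ^ count ν) L)) (cong (_^ L) (sym (^-distribˡ-+-* N c (count ν))))) ⟩
  (N !) ^ (e + w) * (N ^ (c + count ν)) ^ L       ∎
  where
  open ≤-Reasoning
  y = (N ÷ a) ! * a ^ (N ÷ a)
  e = (L ÷ a) * c
  w = weight L ν

yprod-lower : ∀ N L ν → 1 ≤ N → Divides L ν → (N !) ^ weight L ν ≤ yprod N ν ^ L * (N ^ count ν) ^ L
yprod-lower N L [] _ _ rewrite ^-zeroˡ L = ≤-refl
yprod-lower N L ((a , c) ∷ ν) 1≤N ((1≤a , a∣L) ∷ dv) = begin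
  (N !) ^ (e + w)                                 ≡⟨ ^-distribˡ-+-* (N !) e w ⟩
  (N !) ^ e * (N !) ^ w                             ≤⟨ *-mono-≤ (^-monoˡ-≤ e (y-lower N a 1≤N 1≤a)) (yprod-lower N L ν 1≤N dv) ⟩
  (y ^ a * N ^ a) ^ e * (yprod N ν ^ L * (N ^ count ν) ^ L) ≡⟨ cong (_* (yprod N ν ^ L * (N ^ count ν) ^ L)) (trans (*-^ (y ^ a) (N ^ a) e) (cong₂ _*_ (sym (pow-pow y c 1≤a a∣L)) (N^-pow N c 1≤a a∣L))) ⟩
  ((y ^ c) ^ L * (N ^ c) ^ L) * (yprod N ν ^ L * (N ^ count ν) ^ L) ≡⟨ *-swap₄ ((y ^ c) ^ L) ((N ^ c) ^ L) (yprod N ν ^ L) ((N ^ count ν) ^ L) ⟩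
  ((y ^ c) ^ L * yprod N ν ^ L) * ((N ^ c) ^ L * (N ^ count ν) ^ L) ≡⟨ cong₂ _*_ (sym (*-^ (y ^ c) (yprod N ν) L))
        (trans (sym (*-^ (N ^ c) (N ^ count ν) L)) (cong (_^ L) (sym (^-distribˡ-+-* N c (count ν))))) ⟩
  (y ^ c * yprod N ν) ^ L * (N ^ (c + count ν)) ^ L ∎
  where
  open ≤-Reasoning
  y = (N ÷ a) ! * a ^ (N ÷ a)
  e = (L ÷ a) * c
  w = weight L ν

^-cancelˡ-≤ : ∀ {x y} n → 1 ≤ n → x ^ n ≤ y ^ n → x ≤ y
^-cancelˡ-≤ n 1≤n h = ≮⇒≥ λ y<x → <-irrefl refl (<-≤-trans (^-monoˡ-< n {{>-nonZero 1≤n}} y<x) h)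

-- Up to powers of N both products are N! raised to Σ c/a, and balance makes these exponents agree.
-- The L-th power clears the denominators.
factorial-estimate : ∀ N L ν μ → 1 ≤ N → 1 ≤ L → Divides L ν → Divides L μ → weight L ν ≡ weight L μ →
  yprod N μ ≤ yprod N ν * N ^ (count ν + count μ)
factorial-estimate N L ν μ 1≤N 1≤L dν dμ e = ^-cancelˡ-≤ L 1≤L (begin
  yprod N μ ^ L                                        ≤⟨ yprod-upper N L μ 1≤N dμ ⟩
  (N !) ^ weight L μ * (N ^ count μ) ^ L                 ≡⟨ cong (λ z → (N !) ^ z * (N ^ count μ) ^ L) (sym e) ⟩
  (N !) ^ weight L ν * (N ^ count μ) ^ L                 ≤⟨ *-monoˡ-≤ ((N ^ count μ) ^ L) (yprod-lower N L ν 1≤N dν) ⟩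
  yprod N ν ^ L * (N ^ count ν) ^ L * (N ^ count μ) ^ L ≡⟨ *-assoc (yprod N ν ^ L) _ _ ⟩
  yprod N ν ^ L * ((N ^ count ν) ^ L * (N ^ count μ) ^ L) ≡⟨ cong (yprod N ν ^ L *_) (trans (sym (*-^ (N ^ count ν) (N ^ count μ) L)) (cong (_^ L) (sym (^-distribˡ-+-* N (count ν) (count μ))))) ⟩
  yprod N ν ^ L * (N ^ (count ν + count μ)) ^ L        ≡⟨ sym (*-^ (yprod N ν) _ L) ⟩
  (yprod N ν * N ^ (count ν + count μ)) ^ L            ∎)
  where open ≤-Reasoning

facs≥1 : ∀ N ν → 1 ≤ facs N ν
facs≥1 N []            = ≤-refl
facs≥1 N ((a , c) ∷ ν) = *-mono-≤ (1≤^ c (n!≥1 (N ÷ a))) (facs≥1 N ν)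

*-cancelˡ-≤′ : ∀ {c} a b → 1 ≤ c → c * a ≤ c * b → a ≤ b
*-cancelˡ-≤′ {c} a b h = *-cancelˡ-≤ c {{>-nonZero h}}

Λ^-mono : ∀ d {a b} → a ≤ b → Λ d ^ a ≤ Λ d ^ b
Λ^-mono d = ^-monoʳ-≤ (Λ d) {{>-nonZero (Λ≥1 d)}}

1≤÷ : ∀ {N d} → 1 ≤ d → d ≤ N → 1 ≤ N ÷ d
1≤÷ {N} {d} 1≤d d≤N = ≤-÷ 1≤d (subst (_≤ N) (sym (*-identityˡ d)) d≤N)

-- By `facs-Λ` the ratio of the factorials is a product of Λ(d) whose exponents are differences of
-- weights at ⌊N/d⌋, so the pointwise bound c bounds it by W. Its size is known through `pows`; the
-- outcome is a lower bound for W, as `≤pows` is an upper one.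
pows≤ : ∀ N L ν μ (c : ℕ → ℕ) → 1 ≤ N → 1 ≤ L → Divides L ν → Divides L μ → weight L ν ≡ weight L μ →
  (∀ u → 1 ≤ u → weight u ν ≤ weight u μ + c u) →
  pows N μ ≤ ∏ N (λ d → Λ d ^ c (N ÷ d)) * pows N ν * N ^ (count ν + count μ)
pows≤ N L ν μ c 1≤N 1≤L dν dμ e h = *-cancelˡ-≤′ _ _ (facs≥1 N μ) (begin
  facs N μ * pows N μ                   ≡⟨ facs*pows N μ ⟩
  yprod N μ                             ≤⟨ factorial-estimate N L ν μ 1≤N 1≤L dν dμ e ⟩
  yprod N ν * X                         ≡⟨ cong (_* X) (sym (facs*pows N ν)) ⟩
  facs N ν * pows N ν * X               ≤⟨ *-monoˡ-≤ X (*-monoˡ-≤ (pows N ν) facs≤) ⟩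
  facs N μ * W * pows N ν * X           ≡⟨ sw (facs N μ) W (pows N ν) X ⟩
  facs N μ * (W * pows N ν * X)         ∎)
  where
  open ≤-Reasoning
  X = N ^ (count ν + count μ)
  W = ∏ N (λ d → Λ d ^ c (N ÷ d))
  sw : ∀ a b c d → a * b * c * d ≡ a * (b * c * d)
  sw = solve-∀
  facs≤ : facs N ν ≤ facs N μ * W
  facs≤ = subst₂ _≤_ (sym (facs-Λ N ν)) (trans (∏-* N _ _) (cong (_* W) (sym (facs-Λ N μ))))
    (∏-mono N λ d 1≤d d≤N → ≤-trans (Λ^-mono d (h (N ÷ d) (1≤÷ 1≤d d≤N)))
      (≤-reflexive (^-distribˡ-+-* (Λ d) (weight (N ÷ d) μ) (c (N ÷ d)))))

≤pows : ∀ N L ν μ (c : ℕ → ℕ) → 1 ≤ N → 1 ≤ L → Divides L ν → Divides L μ → weight L ν ≡ weight L μ →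
  (∀ u → 1 ≤ u → weight u μ + c u ≤ weight u ν) →
  ∏ N (λ d → Λ d ^ c (N ÷ d)) * pows N ν ≤ pows N μ * N ^ (count μ + count ν)
≤pows N L ν μ c 1≤N 1≤L dν dμ e h = *-cancelˡ-≤′ _ _ (facs≥1 N μ) (begin
  facs N μ * (W * pows N ν)             ≡⟨ sym (*-assoc (facs N μ) W (pows N ν)) ⟩
  facs N μ * W * pows N ν               ≤⟨ *-monoˡ-≤ (pows N ν) ≤facs ⟩
  facs N ν * pows N ν                   ≡⟨ facs*pows N ν ⟩
  yprod N ν                             ≤⟨ factorial-estimate N L μ ν 1≤N 1≤L dμ dν (sym e) ⟩
  yprod N μ * X                         ≡⟨ cong (_* X) (sym (facs*pows N μ)) ⟩
  facs N μ * pows N μ * X               ≡⟨ *-assoc (facs N μ) (pows N μ) X ⟩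
  facs N μ * (pows N μ * X)             ∎)
  where
  open ≤-Reasoning
  X = N ^ (count μ + count ν)
  W = ∏ N (λ d → Λ d ^ c (N ÷ d))
  ≤facs : facs N μ * W ≤ facs N ν
  ≤facs = subst₂ _≤_ (trans (∏-* N _ _) (cong (_* W) (sym (facs-Λ N μ)))) (sym (facs-Λ N ν))
    (∏-mono N λ d 1≤d d≤N → ≤-trans (≤-reflexive (sym (^-distribˡ-+-* (Λ d) (weight (N ÷ d) μ) (c (N ÷ d)))))
      (Λ^-mono d (h (N ÷ d) (1≤÷ 1≤d d≤N))))

Ψ : ℕ → ℕ
Ψ n = ∏ n Λ

Ψ≥1 : ∀ n → 1 ≤ Ψ n
Ψ≥1 n = ∏-≥1 n Λ λ d _ _ → Λ≥1 d

-- ⌊N/d⌋ ≥ U means d ≤ ⌊N/U⌋, so an exponent that is 1 from U on produces a value of Ψ.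
∏Λ-threshold : ∀ N U → 1 ≤ U → ∏ N (λ d → Λ d ^ χ (U ≤? N ÷ d)) ≡ Ψ (N ÷ U)
∏Λ-threshold N U 1≤U = trans (∏-extend _ (÷-≤-self N U) above) (∏-cong (N ÷ U) below)
  where
  above : ∀ d → N ÷ U < d → d ≤ N → Λ d ^ χ (U ≤? N ÷ d) ≡ 1
  above d l _ = cong (Λ d ^_) (χ-no (U ≤? N ÷ d) λ h → <⇒≱ l (≤-÷ 1≤U (subst (_≤ N) (*-comm U d) (÷-≤ {U} (≤-trans (s≤s z≤n) l) h))))
  below : ∀ d → 1 ≤ d → d ≤ N ÷ U → Λ d ^ χ (U ≤? N ÷ d) ≡ Λ d
  below d 1≤d h = trans (cong (Λ d ^_) (χ-yes (U ≤? N ÷ d) (≤-÷ 1≤d (subst (_≤ N) (*-comm d U) (÷-≤ {d} 1≤U h))))) (*-identityʳ (Λ d))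

-- Finite checks, growth of powers and logarithms to base 2

all< : ℕ → (ℕ → Bool) → Bool
all< zero    f = true
all< (suc n) f = f n ∧ all< n f

all<-sound : ∀ n f → T (all< n f) → ∀ {u} → u < n → T (f u)
all<-sound (suc n) f h {u} (s≤s u≤n) with Equivalence.to (T-∧ {f n}) h | m≤n⇒m<n∨m≡n u≤n
... | a , b | inj₁ l    = all<-sound n f b l
... | a , b | inj₂ refl = a

-- Bernoulli's inequality (1 - 1/(n+1))^c ≥ 1 - c/(n+1) without fractions, r being n + 1 - c.
bernoulli : ∀ n c r → c + r ≡ suc n → suc n ^ c * r ≤ n ^ c * suc n
bernoulli n zero    r e = ≤-reflexive (cong (_+ 0) e)
bernoulli n (suc c) r e = begin
  suc n * suc n ^ c * r       ≡⟨ s₁ (suc n) (suc n ^ c) r ⟩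
  suc n ^ c * (suc n * r)     ≤⟨ *-monoʳ-≤ (suc n ^ c) (≤-trans (+-monoˡ-≤ (n * r) r≤n) (≤-reflexive (sym (*-suc n r)))) ⟩
  suc n ^ c * (n * suc r)     ≡⟨ s₂ (suc n ^ c) n (suc r) ⟩
  n * (suc n ^ c * suc r)     ≤⟨ *-monoʳ-≤ n (bernoulli n c (suc r) (trans (+-suc c r) e)) ⟩
  n * (n ^ c * suc n)         ≡⟨ sym (*-assoc n (n ^ c) (suc n)) ⟩
  n * n ^ c * suc n           ∎
  where
  open ≤-Reasoning
  r≤n : r ≤ n
  r≤n = subst (r ≤_) (suc-injective e) (m≤n+m r c)
  s₁ : ∀ x y z → x * y * z ≡ y * (x * z)
  s₁ = solve-∀
  s₂ : ∀ x y z → x * (y * z) ≡ y * (x * z)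
  s₂ = solve-∀

suc^≤2* : ∀ n c → 2 * c ≤ suc n → suc n ^ c ≤ 2 * n ^ c
suc^≤2* n c h = *-cancelˡ-≤′ (suc n ^ c) (2 * n ^ c) (s≤s (z≤n {n})) (begin
  suc n * suc n ^ c           ≤⟨ *-monoˡ-≤ (suc n ^ c) le ⟩
  2 * r * suc n ^ c           ≡⟨ s₁ r (suc n ^ c) ⟩
  2 * (suc n ^ c * r)         ≤⟨ *-monoʳ-≤ 2 (bernoulli n c r c+r) ⟩
  2 * (n ^ c * suc n)         ≡⟨ s₂ (n ^ c) (suc n) ⟩
  suc n * (2 * n ^ c)         ∎)
  where
  open ≤-Reasoning
  r = suc n ∸ c
  c+r : c + r ≡ suc n
  c+r = m+[n∸m]≡n (≤-trans (m≤n*m c 2) h)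
  le : suc n ≤ 2 * r
  le = +-cancelˡ-≤ (2 * c) (suc n) (2 * r) (≤-trans (+-monoˡ-≤ (suc n) h)
        (≤-reflexive (trans (cong (λ z → z + z) (sym c+r)) (s₃ c r))))
    where
    s₃ : ∀ c r → (c + r) + (c + r) ≡ 2 * c + 2 * r
    s₃ = solve-∀
  s₁ : ∀ r x → 2 * r * x ≡ 2 * (x * r)
  s₁ = solve-∀
  s₂ : ∀ x y → 2 * (x * y) ≡ y * (2 * x)
  s₂ = solve-∀

-- Once 2c ≤ n + 1, Bernoulli's inequality lets n^c at most double from n to n + 1, so a single
-- comparison at x₀ suffices.
poly≤exp : ∀ c x₀ → 2 * c ≤ x₀ → x₀ ^ c ≤ 2 ^ x₀ → ∀ {n} → x₀ ≤ n → n ^ c ≤ 2 ^ n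
poly≤exp c x₀ h₁ h₂ {n} x₀≤n with m≤n⇒m<n∨m≡n x₀≤n
... | inj₂ refl = h₂
poly≤exp c x₀ h₁ h₂ {suc n} _ | inj₁ (s≤s l) =
  ≤-trans (suc^≤2* n c (≤-trans h₁ (m≤n⇒m≤1+n l))) (*-monoʳ-≤ 2 (poly≤exp c x₀ h₁ h₂ l))

pow≤2^ : ∀ {x e} k → x ≤ 2 ^ e → x ^ k ≤ 2 ^ (e * k)
pow≤2^ {x} {e} k h = ≤-trans (^-monoˡ-≤ k h) (≤-reflexive (^-*-assoc 2 e k))

*≤2^ : ∀ {x y a b} → x ≤ 2 ^ a → y ≤ 2 ^ b → x * y ≤ 2 ^ (a + b)
*≤2^ {a = a} {b} p q = ≤-trans (*-mono-≤ p q) (≤-reflexive (sym (^-distribˡ-+-* 2 a b)))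

≡true⇒T : ∀ {b} → b ≡ true → T b
≡true⇒T refl = tt

T⇒≡true : ∀ {b} → T b → b ≡ true
T⇒≡true {true} _ = refl

≤! : ∀ m n → (m ≤ᵇ n) ≡ true → m ≤ n
≤! m n e = ≤ᵇ⇒≤ m n (≡true⇒T e)

-- The third entry of (a , c , h) is S log₂ a rounded to an integer, upwards under `UpperLogs` and
-- downwards under `LowerLogs`. Then `expo` approximates S log₂ of `pows` by a sum of floors, which
-- `weight-≤` and `≤-weight` compare with a multiple of N.
LSpec : Set
LSpec = List (ℕ × ℕ × ℕ)

erase : LSpec → Spec
erase []                = []
erase ((a , c , h) ∷ ν) = (a , c) ∷ erase ν

scale : LSpec → Spec
scale []                = []
scale ((a , c , h) ∷ ν) = (a , c * h) ∷ scale ν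

expo : ℕ → LSpec → ℕ
expo N ν = weight N (scale ν)

UpperLogs LowerLogs : ℕ → LSpec → Set
UpperLogs S = All (λ t → proj₁ t ^ S ≤ 2 ^ proj₂ (proj₂ t))
LowerLogs S = All (λ t → 2 ^ proj₂ (proj₂ t) ≤ proj₁ t ^ S)

pow-swap : ∀ x q c S → ((x ^ q) ^ c) ^ S ≡ (x ^ S) ^ (q * c)
pow-swap x q c S = trans (cong (_^ S) (^-*-assoc x q c)) (trans (^-*-assoc x (q * c) S)
  (trans (cong (x ^_) (*-comm (q * c) S)) (sym (^-*-assoc x S (q * c)))))
pow2-swap : ∀ h q c → (2 ^ h) ^ (q * c) ≡ 2 ^ (q * (c * h))
pow2-swap h q c = trans (^-*-assoc 2 h (q * c)) (cong (2 ^_) (sw h q c)) where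
  sw : ∀ h q c → h * (q * c) ≡ q * (c * h)
  sw = solve-∀

pows-upper : ∀ S N ν → UpperLogs S ν → pows N (erase ν) ^ S ≤ 2 ^ expo N ν
pows-upper S N [] _ = ≤-reflexive (^-zeroˡ S)
pows-upper S N ((a , c , h) ∷ ν) (l ∷ ls) = begin
  ((a ^ (N ÷ a)) ^ c * pows N (erase ν)) ^ S       ≡⟨ *-^ ((a ^ (N ÷ a)) ^ c) (pows N (erase ν)) S ⟩
  ((a ^ (N ÷ a)) ^ c) ^ S * pows N (erase ν) ^ S   ≡⟨ cong (_* pows N (erase ν) ^ S) (pow-swap a (N ÷ a) c S) ⟩
  (a ^ S) ^ (N ÷ a * c) * pows N (erase ν) ^ S     ≤⟨ *-mono-≤ (^-monoˡ-≤ (N ÷ a * c) l) (pows-upper S N ν ls) ⟩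
  (2 ^ h) ^ (N ÷ a * c) * 2 ^ expo N ν             ≡⟨ cong (_* 2 ^ expo N ν) (pow2-swap h (N ÷ a) c) ⟩
  2 ^ (N ÷ a * (c * h)) * 2 ^ expo N ν             ≡⟨ sym (^-distribˡ-+-* 2 (N ÷ a * (c * h)) (expo N ν)) ⟩
  2 ^ (N ÷ a * (c * h) + expo N ν)                 ∎
  where open ≤-Reasoning

pows-lower : ∀ S N ν → LowerLogs S ν → 2 ^ expo N ν ≤ pows N (erase ν) ^ S
pows-lower S N [] _ = ≤-reflexive (sym (^-zeroˡ S))
pows-lower S N ((a , c , h) ∷ ν) (l ∷ ls) = begin
  2 ^ (N ÷ a * (c * h) + expo N ν)                 ≡⟨ ^-distribˡ-+-* 2 (N ÷ a * (c * h)) (expo N ν) ⟩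
  2 ^ (N ÷ a * (c * h)) * 2 ^ expo N ν             ≡⟨ cong (_* 2 ^ expo N ν) (sym (pow2-swap h (N ÷ a) c)) ⟩
  (2 ^ h) ^ (N ÷ a * c) * 2 ^ expo N ν             ≤⟨ *-mono-≤ (^-monoˡ-≤ (N ÷ a * c) l) (pows-lower S N ν ls) ⟩
  (a ^ S) ^ (N ÷ a * c) * pows N (erase ν) ^ S     ≡⟨ cong (_* pows N (erase ν) ^ S) (sym (pow-swap a (N ÷ a) c S)) ⟩
  ((a ^ (N ÷ a)) ^ c) ^ S * pows N (erase ν) ^ S   ≡⟨ sym (*-^ ((a ^ (N ÷ a)) ^ c) (pows N (erase ν)) S) ⟩
  ((a ^ (N ÷ a)) ^ c * pows N (erase ν)) ^ S       ∎
  where open ≤-Reasoning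

Divides-scale : ∀ {L} ν → Divides L (erase ν) → Divides L (scale ν)
Divides-scale []      []       = []
Divides-scale (_ ∷ ν) (d ∷ ds) = d ∷ Divides-scale ν ds

weight-≤ : ∀ N L ν → Divides L ν → weight N ν * L ≤ N * weight L ν
weight-≤ N L [] _ = z≤n
weight-≤ N L ((a , x) ∷ ν) ((1≤a , d) ∷ ds) = begin
  ((N ÷ a) * x + weight N ν) * L           ≡⟨ *-distribʳ-+ L ((N ÷ a) * x) (weight N ν) ⟩
  (N ÷ a) * x * L + weight N ν * L         ≤⟨ +-mono-≤ (≤-trans (≤-reflexive (trans (cong ((N ÷ a) * x *_) (sym (∣⇒*÷ 1≤a d))) (s₁ (N ÷ a) x a (L ÷ a))))
                                                (*-monoˡ-≤ ((L ÷ a) * x) (÷*≤ N a))) (weight-≤ N L ν ds) ⟩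
  N * ((L ÷ a) * x) + N * weight L ν       ≡⟨ sym (*-distribˡ-+ N ((L ÷ a) * x) (weight L ν)) ⟩
  N * ((L ÷ a) * x + weight L ν)           ∎
  where
  open ≤-Reasoning
  s₁ : ∀ q x a l → q * x * (a * l) ≡ q * a * (l * x)
  s₁ = solve-∀

≤-weight : ∀ N L ν → Divides L ν → N * weight L ν ≤ (weight N ν + count ν) * L
≤-weight N L [] _ rewrite *-zeroʳ N = z≤n
≤-weight N L ((a , x) ∷ ν) ((1≤a , d) ∷ ds) = begin
  N * ((L ÷ a) * x + weight L ν)           ≡⟨ *-distribˡ-+ N ((L ÷ a) * x) (weight L ν) ⟩
  N * ((L ÷ a) * x) + N * weight L ν       ≤⟨ +-mono-≤ (*-monoˡ-≤ ((L ÷ a) * x) (<⇒≤ (<suc÷* N 1≤a))) (≤-weight N L ν ds) ⟩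
  suc (N ÷ a) * a * ((L ÷ a) * x) + (weight N ν + count ν) * L ≡⟨ cong (_+ (weight N ν + count ν) * L) (trans (s₁ (suc (N ÷ a)) a (L ÷ a) x) (cong (suc (N ÷ a) * x *_) (∣⇒*÷ 1≤a d))) ⟩
  suc (N ÷ a) * x * L + (weight N ν + count ν) * L ≡⟨ s₂ (N ÷ a) x L (weight N ν) (count ν) ⟩
  ((N ÷ a) * x + weight N ν + (x + count ν)) * L ∎
  where
  open ≤-Reasoning
  s₁ : ∀ q a l x → q * a * (l * x) ≡ q * x * (a * l)
  s₁ = solve-∀
  s₂ : ∀ q x L e t → (1 + q) * x * L + (e + t) * L ≡ (q * x + e + (x + t)) * L
  s₂ = solve-∀

-- Only the floors of μ can be lost, each at most 1, so for a balanced ratio the number of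
-- factorials in μ bounds the difference at every u.
weight-gap : ∀ u L ν μ → 1 ≤ L → Divides L ν → Divides L μ → weight L ν ≡ weight L μ →
  weight u ν ≤ weight u μ + count μ
weight-gap u L ν μ 1≤L ψdν ψdμ e = *-cancelʳ-≤ _ _ L {{>-nonZero 1≤L}}
  (≤-trans (weight-≤ u L ν ψdν) (≤-trans (≤-reflexive (cong (u *_) e)) (≤-weight u L μ ψdμ)))

-- Chebyshev's upper bound for Ψ

ψν : Spec
ψν = (1 , 1) ∷ []
-- The ratio is balanced because 1/2 + 1/3 + 1/7 + 1/42 = 1. The logarithms are in units of 1/25,
-- the denominator of the target 41/25.
ψμ : LSpec
ψμ = (2 , 1 , 25) ∷ (3 , 1 , 40) ∷ (7 , 1 , 71) ∷ (42 , 1 , 135) ∷ []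
ψdν : Divides 42 ψν
ψdν = (s≤s z≤n , 1∣ 42) ∷ []
ψdμ : Divides 42 (erase ψμ)
ψdμ = (s≤s z≤n , divides 21 refl) ∷ (s≤s z≤n , divides 14 refl) ∷ (s≤s z≤n , divides 6 refl) ∷ (s≤s z≤n , divides 1 refl) ∷ []
ψlogs : UpperLogs 25 ψμ
ψlogs = ≤! (2 ^ 25) (2 ^ 25) refl ∷ ≤! (3 ^ 25) (2 ^ 40) refl ∷ ≤! (7 ^ 25) (2 ^ 71) refl ∷ ≤! (42 ^ 25) (2 ^ 135) refl ∷ []

T-∨-skip : ∀ {v b} → 1 ≤ v → T ((v ≡ᵇ 0) ∨ b) → T b
T-∨-skip (s≤s _) t = t

-- As 1/2 + 1/3 + 1/7 < 1, the difference of the weights is positive for 1 ≤ u < 42, where ⌊u/42⌋ =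
-- 0; from 42 on balance keeps it non-negative.
ψc : ∀ u → 1 ≤ u → weight u (erase ψμ) + χ (u <? 42) ≤ weight u ψν
ψc u 1≤u = go (u <? 42)
  where
  lhs = weight u (erase ψμ)
  go : Dec (u < 42) → lhs + χ (u <? 42) ≤ weight u ψν
  go (yes l) = subst (λ z → lhs + z ≤ weight u ψν) (sym (χ-yes (u <? 42) l))
    (≤ᵇ⇒≤ (lhs + 1) (weight u ψν) (T-∨-skip 1≤u (all<-sound 42 (λ v → (v ≡ᵇ 0) ∨ (weight v (erase ψμ) + 1 ≤ᵇ weight v ψν)) tt l)))
  go (no g) = subst (λ z → lhs + z ≤ weight u ψν) (sym (χ-no (u <? 42) g))
    (*-cancelˡ-≤ 42 (≤-trans (≤-reflexive (s (u ÷ 2) (u ÷ 3) (u ÷ 7) (u ÷ 42)))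
               (≤-trans (+-mono-≤ (*-monoʳ-≤ 21 (÷*≤ u 2)) (+-mono-≤ (*-monoʳ-≤ 14 (÷*≤ u 3)) (+-mono-≤ (*-monoʳ-≤ 6 (÷*≤ u 7)) (÷*≤ u 42))))
               (≤-reflexive (trans (s' u) (cong (λ z → 42 * (z * 1 + 0)) (sym (n/1≡n u))))))))
    where
    s : ∀ a b c d → 42 * (a * 1 + (b * 1 + (c * 1 + (d * 1 + 0))) + 0) ≡ 21 * (a * 2) + (14 * (b * 3) + (6 * (c * 7) + d * 42))
    s = solve-∀
    s' : ∀ u → 21 * u + (14 * u + (6 * u + u)) ≡ 42 * (u * 1 + 0)
    s' = solve-∀

-- The multinomial coefficient controls the d with n/42 < d ≤ n, and the smaller d form Ψ(n/42). The
-- factor n^5 is the error of `factorial-estimate` for five factorials.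
Ψ-step : ∀ n → 1 ≤ n → Ψ n ≤ pows n (erase ψμ) * n ^ 5 * Ψ (n ÷ 42)
Ψ-step n 1≤n = begin
  Ψ n                                   ≡⟨ ∏-cong n (λ d _ _ → pt (n ÷ d) (Λ d)) ⟩
  ∏ n (λ d → Λ d ^ χ (n ÷ d <? 42) * Λ d ^ χ (42 ≤? n ÷ d)) ≡⟨ ∏-* n _ _ ⟩
  W * ∏ n (λ d → Λ d ^ χ (42 ≤? n ÷ d)) ≡⟨ cong (W *_) (∏Λ-threshold n 42 (s≤s z≤n)) ⟩
  W * Ψ (n ÷ 42)                        ≡⟨ cong (_* Ψ (n ÷ 42)) (trans (sym (*-identityʳ W)) (cong (W *_) (sym pν))) ⟩
  W * pows n ψν * Ψ (n ÷ 42)            ≤⟨ *-monoˡ-≤ (Ψ (n ÷ 42)) (≤pows n 42 ψν (erase ψμ) (λ u → χ (u <? 42)) 1≤n (s≤s z≤n) ψdν ψdμ refl ψc) ⟩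
  pows n (erase ψμ) * n ^ 5 * Ψ (n ÷ 42) ∎
  where
  open ≤-Reasoning
  W = ∏ n (λ d → Λ d ^ χ (n ÷ d <? 42))
  pν : pows n ψν ≡ 1
  pν = trans (*-identityʳ _) (trans (*-identityʳ _) (^-zeroˡ (n ÷ 1)))
  pt : ∀ u x → x ≡ x ^ χ (u <? 42) * x ^ χ (42 ≤? u)
  pt u x = go (u <? 42)
    where
    go : Dec (u < 42) → x ≡ x ^ χ (u <? 42) * x ^ χ (42 ≤? u)
    go (yes a) = sym (trans (cong₂ (λ y z → x ^ y * x ^ z) (χ-yes (u <? 42) a) (χ-no (42 ≤? u) (<⇒≱ a))) (trans (*-identityʳ (x * 1)) (*-identityʳ x)))
    go (no a)  = sym (trans (cong₂ (λ y z → x ^ y * x ^ z) (χ-no (u <? 42) a) (χ-yes (42 ≤? u) (≮⇒≥ a))) (trans (*-identityˡ (x * 1)) (*-identityʳ x)))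

ψloop : ℕ → ℕ → ℕ → ℕ → Bool
ψloop zero    n P E = true
ψloop (suc f) n P E = (P ^ 25 ≤ᵇ E) ∧ ψloop f (suc n) (P * Λ (suc n)) (E * 2 ^ 41)

ψloop-sound : ∀ f n → T (ψloop f n (Ψ n) (2 ^ (41 * n))) → ∀ m → n ≤ m → m < n + f → Ψ m ^ 25 ≤ 2 ^ (41 * m)
ψloop-sound zero n _ m a b = ⊥-elim (<⇒≱ b (subst (_≤ m) (sym (+-identityʳ n)) a))
ψloop-sound (suc f) n t m a b with Equivalence.to (T-∧ {Ψ n ^ 25 ≤ᵇ 2 ^ (41 * n)}) t | m≤n⇒m<n∨m≡n a
... | x , y | inj₂ refl = ≤ᵇ⇒≤ _ _ x
... | x , y | inj₁ l    = ψloop-sound f (suc n)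
  (subst (λ z → T (ψloop f (suc n) (Ψ (suc n)) z)) (trans (sym (^-distribˡ-+-* 2 (41 * n) 41)) (cong (2 ^_) (trans (+-comm (41 * n) 41) (sym (*-suc 41 n))))) y) m l (subst (m <_) (+-suc n f) b)

ψloop-sound′ : ∀ f n → ψloop f n (Ψ n) (2 ^ (41 * n)) ≡ true → ∀ m → n ≤ m → m < n + f → Ψ m ^ 25 ≤ 2 ^ (41 * m)
ψloop-sound′ f n e = ψloop-sound f n (≡true⇒T e)

ψ-small : ψloop 1700 0 (Ψ 0) (2 ^ (41 * 0)) ≡ true
ψ-small = refl

ψ-base : ∀ m → m < 1700 → Ψ m ^ 25 ≤ 2 ^ (41 * m)
ψ-base m = ψloop-sound′ 1700 0 ψ-small m z≤n

ψ-1700 : 1700 ^ 150 ≤ 2 ^ 1700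
ψ-1700 = ≤! (1700 ^ 150) (2 ^ 1700) refl

ψ-poly : ∀ {n} → 1700 ≤ n → n ^ 150 ≤ 2 ^ n
ψ-poly = poly≤exp 150 1700 (≤! 300 1700 refl) ψ-1700

ψ-n≤ : ∀ n → n ^ 150 ≤ 2 ^ n → ((n ^ 5) ^ 25) ^ 252 ≤ 2 ^ (n * 210)
ψ-n≤ n h = subst (_≤ 2 ^ (n * 210)) (trans (^-*-assoc n 150 210) (sym (trans (cong (_^ 252) (^-*-assoc n 5 25)) (^-*-assoc n 125 252))))
         (pow≤2^ {n ^ 150} {n} 210 h)

-- Ψ(n) = e^{ψ(n)} for Chebyshev's ψ; the constant 41/25 exceeds the asymptotic value 1.5958… given by the multinomial n!/(⌊n/2⌋!⌊n/3⌋!⌊n/7⌋!⌊n/42⌋!).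
Ψ-bound : ∀ n → Ψ n ^ 25 ≤ 2 ^ (41 * n)
Ψ-bound = <-rec _ go
  where
  go : ∀ n → (∀ {y} → y < n → Ψ y ^ 25 ≤ 2 ^ (41 * y)) → Ψ n ^ 25 ≤ 2 ^ (41 * n)
  go n rec with n <? 1700
  ... | yes l = ψ-base n l
  -- 252 = 6 · 42 clears denominators, and the budget is 41 · 252 = 9876 + 210 + 246. The logarithms
  -- cost 1646/42 per unit of n, the recursive call 41/42, and the remaining 210 pay for n^5 because
  -- n^150 ≤ 2^n from 1700 on.
  ... | no  g = ^-cancelˡ-≤ 252 (s≤s z≤n) (begin
    (Ψ n ^ 25) ^ 252                         ≤⟨ ^-monoˡ-≤ 252 (^-monoˡ-≤ 25 (Ψ-step n 1≤n)) ⟩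
    ((P * n ^ 5 * Q) ^ 25) ^ 252             ≡⟨ cong (_^ 252) (trans (*-^ (P * n ^ 5) Q 25) (cong (_* Q ^ 25) (*-^ P (n ^ 5) 25))) ⟩
    (P ^ 25 * (n ^ 5) ^ 25 * Q ^ 25) ^ 252   ≤⟨ ^-monoˡ-≤ 252 (*-mono-≤ (*-monoˡ-≤ ((n ^ 5) ^ 25) (pows-upper 25 n ψμ ψlogs)) (rec q<n)) ⟩
    (2 ^ E * (n ^ 5) ^ 25 * 2 ^ (41 * q)) ^ 252 ≡⟨ trans (*-^ (2 ^ E * (n ^ 5) ^ 25) _ 252) (cong (_* (2 ^ (41 * q)) ^ 252) (*-^ (2 ^ E) _ 252)) ⟩
    (2 ^ E) ^ 252 * ((n ^ 5) ^ 25) ^ 252 * (2 ^ (41 * q)) ^ 252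
      ≤⟨ *≤2^ {a = n * 9876 + n * 210} (*≤2^ {a = n * 9876} (≤-trans (≤-reflexive (^-*-assoc 2 E 252)) (^-monoʳ-≤ 2 E≤)) n≤)
              (≤-trans (≤-reflexive (^-*-assoc 2 (41 * q) 252)) (^-monoʳ-≤ 2 q≤)) ⟩
    2 ^ (n * 9876 + n * 210 + n * 246)       ≡⟨ cong (2 ^_) (s₃ n) ⟩
    2 ^ (41 * n * 252)                       ≡⟨ sym (^-*-assoc 2 (41 * n) 252) ⟩
    (2 ^ (41 * n)) ^ 252                     ∎)
    where
    open ≤-Reasoning
    1700≤n = ≮⇒≥ g
    1≤n : 1 ≤ n
    1≤n = ≤-trans (s≤s z≤n) 1700≤n
    P = pows n (erase ψμ)
    q = n ÷ 42
    Q = Ψ q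
    E = expo n ψμ
    q<n : q < n
    q<n = m/n<m n 42 {{>-nonZero 1≤n}} (s≤s (s≤s z≤n))
    s₁ : ∀ x → x * 42 * 6 ≡ x * 252
    s₁ = solve-∀
    s₂ : ∀ n → n * 1646 * 6 ≡ n * 9876
    s₂ = solve-∀
    s₃ : ∀ n → n * 9876 + n * 210 + n * 246 ≡ 41 * n * 252
    s₃ = solve-∀
    s₄ : ∀ q → 41 * q * 252 ≡ q * 42 * 246
    s₄ = solve-∀
    E≤ : E * 252 ≤ n * 9876
    E≤ = subst₂ _≤_ (s₁ E) (s₂ n) (*-monoˡ-≤ 6 (weight-≤ n 42 (scale ψμ) (Divides-scale ψμ ψdμ)))
    q≤ : 41 * q * 252 ≤ n * 246
    q≤ = subst (_≤ n * 246) (sym (s₄ q)) (*-monoˡ-≤ 246 (÷*≤ n 42))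
    n≤ : ((n ^ 5) ^ 25) ^ 252 ≤ 2 ^ (n * 210)
    n≤ = ψ-n≤ n (ψ-poly 1700≤n)

-- Binomial coefficients and carries

half : ∀ m → ∃ λ j → m ≡ j + j ⊎ m ≡ suc (j + j)
half zero = 0 , inj₁ refl
half (suc m) with half m
... | j , inj₁ e = j , inj₂ (cong suc e)
... | j , inj₂ e = suc j , inj₁ (trans (cong suc e) (cong suc (sym (+-suc j j))))

∏-swap : ∀ n r (f : ℕ → ℕ → ℕ) → ∏ n (λ d → ∏ r (f d)) ≡ ∏ r (λ e → ∏ n (λ d → f d e))
∏-swap zero    r f = sym (∏-1 r)
∏-swap (suc n) r f = trans (cong (_* ∏ r (f (suc n))) (∏-swap n r f)) (sym (∏-* r _ _))

term≤∏ : ∀ r f {e} → (∀ d → 1 ≤ d → d ≤ r → 1 ≤ f d) → 1 ≤ e → e ≤ r → f e ≤ ∏ r f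
term≤∏ zero f h 1≤e e≤r = ⊥-elim (<⇒≱ 1≤e e≤r)
term≤∏ (suc r) f {e} h 1≤e e≤r with m≤n⇒m<n∨m≡n e≤r
... | inj₁ (s≤s l) = ≤-trans (term≤∏ r f (λ d a b → h d a (m≤n⇒m≤1+n b)) 1≤e l)
        (≤-trans (≤-reflexive (sym (*-identityʳ _))) (*-monoʳ-≤ (∏ r f) (h (suc r) (s≤s z≤n) ≤-refl)))
... | inj₂ refl = ≤-trans (≤-reflexive (sym (*-identityˡ _)))
        (*-monoˡ-≤ (f (suc r)) (∏-≥1 r f λ d a b → h d a (m≤n⇒m≤1+n b)))

∏-δ-≤ : ∀ n d₀ x → 1 ≤ x → 1 ≤ d₀ → ∏ n (λ d → x ^ χ (d ≟ d₀)) ≤ x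
∏-δ-≤ n d₀ x 1≤x 1≤d₀ with d₀ ≤? n
... | yes h = ≤-reflexive (∏-δ n d₀ x 1≤d₀ h)
... | no g = ≤-trans (≤-reflexive (trans (∏-cong n λ d _ b → cong (x ^_) (χ-no (d ≟ d₀) λ { refl → g b })) (∏-1 n))) 1≤x

nonprime : ℕ → ℕ
nonprime d = χ (¬? (prime? d))

-- the prime powers p^{2j} and p^{2j+1}, j ≥ 1, are charged to p^j
nonprime-Ψ : ∀ n r → n < suc r * suc r → ∏ n (λ d → Λ d ^ nonprime d) ≤ Ψ r * Ψ r
nonprime-Ψ n r h = ≤-trans (∏-mono n λ d 1≤d d≤n → pt d 1≤d d≤n (Λ-view d))
  (≤-trans (≤-reflexive (∏-swap n r F)) (≤-trans (∏-mono r λ e 1≤e _ →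
      ≤-trans (≤-reflexive (∏-* n _ _)) (*-mono-≤ (∏-δ-≤ n (e * e) (Λ e) (Λ≥1 e) (*-mono-≤ 1≤e 1≤e))
        (∏-δ-≤ n (e * e * Λ e) (Λ e) (Λ≥1 e) (*-mono-≤ (*-mono-≤ 1≤e 1≤e) (Λ≥1 e)))))
    (≤-reflexive (∏-* r Λ Λ))))
  where
  F : ℕ → ℕ → ℕ
  F d e = Λ e ^ χ (d ≟ e * e) * Λ e ^ χ (d ≟ e * e * Λ e)
  F≥1 : ∀ d e → 1 ≤ F d e
  F≥1 d e = *-mono-≤ (1≤^ (χ (d ≟ e * e)) (Λ≥1 e)) (1≤^ (χ (d ≟ e * e * Λ e)) (Λ≥1 e))
  pt : ∀ d → 1 ≤ d → d ≤ n → ΛView d → Λ d ^ nonprime d ≤ ∏ r (F d)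
  one : ∀ d → Λ d ^ nonprime d ≡ 1 → Λ d ^ nonprime d ≤ ∏ r (F d)
  one d e = ≤-trans (≤-reflexive e) (∏-≥1 r (F d) λ e' _ _ → F≥1 d e')
  pt d _ _ (unit e) = one d (trans (cong (_^ nonprime d) e) (^-zeroˡ (nonprime d)))
  pt d _ _ (power p zero pp e eΛ) = one d (cong (Λ d ^_) (χ-no (¬? (prime? d)) λ np → np (subst Prime (sym (trans e (*-identityʳ p))) pp)))
  pt d 1≤d d≤n (power p (suc a) pp e eΛ) with half (suc (suc a))
  ... | zero , inj₁ ()
  ... | zero , inj₂ ()
  ... | suc j , q = ≤-trans Λ≤ (≤-trans (val q) (term≤∏ r (F d) (λ e' _ _ → F≥1 d e') (1≤^ (suc j) (prime≥1 pp)) ≤r))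
    where
    e₀ = p ^ suc j
    Λe₀ : Λ e₀ ≡ p
    Λe₀ = Λ-power j pp
    Λ≤ : Λ d ^ nonprime d ≤ p
    Λ≤ = subst (λ z → z ^ nonprime d ≤ p) (sym eΛ)
      (≤-trans (^-monoʳ-≤ p {{prime⇒nonZero pp}} (χ≤1 (¬? (prime? d)))) (≤-reflexive (*-identityʳ p)))
      where
      χ≤1 : ∀ {P : Set} (x : Dec P) → χ x ≤ 1
      χ≤1 (yes _) = ≤-refl
      χ≤1 (no _) = z≤n
    sq : e₀ * e₀ ≡ p ^ (suc j + suc j)
    sq = sym (^-distribˡ-+-* p (suc j) (suc j))
    val : suc (suc a) ≡ suc j + suc j ⊎ suc (suc a) ≡ suc (suc j + suc j) → p ≤ F d e₀
    val (inj₁ x) = ≤-trans (≤-reflexive (sym (trans (cong₂ (λ y z → y ^ z) Λe₀ (χ-yes (d ≟ e₀ * e₀) (trans e (trans (cong (p ^_) x) (sym sq))))) (*-identityʳ p))))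
      (≤-trans (≤-reflexive (sym (*-identityʳ _))) (*-monoʳ-≤ (Λ e₀ ^ χ (d ≟ e₀ * e₀)) (1≤^ (χ (d ≟ e₀ * e₀ * Λ e₀)) (Λ≥1 e₀))))
    val (inj₂ x) = ≤-trans (≤-reflexive (sym (trans (cong₂ (λ y z → y ^ z) Λe₀ (χ-yes (d ≟ e₀ * e₀ * Λ e₀)
          (trans e (trans (cong (p ^_) x) (trans (*-comm p _) (cong₂ _*_ (sym sq) (sym Λe₀))))))) (*-identityʳ p))))
      (≤-trans (≤-reflexive (sym (*-identityˡ _))) (*-monoˡ-≤ (Λ e₀ ^ χ (d ≟ e₀ * e₀ * Λ e₀)) (1≤^ (χ (d ≟ e₀ * e₀)) (Λ≥1 e₀))))
    e₀²≤d : suc (suc a) ≡ suc j + suc j ⊎ suc (suc a) ≡ suc (suc j + suc j) → e₀ * e₀ ≤ d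
    e₀²≤d x = subst₂ _≤_ (sym sq) (sym e) (^-monoʳ-≤ p {{prime⇒nonZero pp}} (le x))
      where
      le : suc (suc a) ≡ suc j + suc j ⊎ suc (suc a) ≡ suc (suc j + suc j) → suc j + suc j ≤ suc (suc a)
      le (inj₁ x) = ≤-reflexive (sym x)
      le (inj₂ x) = ≤-trans (n≤1+n _) (≤-reflexive (sym x))
    ≤r : e₀ ≤ r
    ≤r = ≮⇒≥ λ r<e → <-irrefl refl (<-≤-trans h (≤-trans (*-mono-≤ r<e r<e) (≤-trans (e₀²≤d q) d≤n)))

bin : ℕ → ℕ → ℕ
bin a b = (a + b) C b

bin-! : ∀ a b → bin a b * (a ! * b !) ≡ (a + b) !
bin-! a b = trans (cong₂ _*_ (nCk≡n!/k![n-k]! {a + b} {b} (m≤n+m b a)) (trans (*-comm (a !) (b !)) (cong (λ z → b ! * z !) (sym (m+n∸n≡m a b)))))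
  (m/n*n≡m {{_}} (k![n∸k]!∣n! {a + b} {b} (m≤n+m b a)))

÷-+-≤ : ∀ a b d → a ÷ d + b ÷ d ≤ (a + b) ÷ d
÷-+-≤ a b zero    = z≤n
÷-+-≤ a b (suc d) = ≤-÷ {a ÷ suc d + b ÷ suc d} (s≤s z≤n)
  (≤-trans (≤-reflexive (*-distribʳ-+ (suc d) (a ÷ suc d) (b ÷ suc d))) (+-mono-≤ (÷*≤ a (suc d)) (÷*≤ b (suc d))))

-- For d = p^j this is 1 exactly when the addition of a and b in base p carries out of the lowest j
-- digits, so `bin-Λ` is Kummer's theorem for all primes at once.
carry : ℕ → ℕ → ℕ → ℕ
carry a b d = (a + b) ÷ d ∸ (a ÷ d + b ÷ d)

carry≤1 : ∀ a b d → 1 ≤ d → carry a b d ≤ 1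
carry≤1 a b d 1≤d = m≤n+o⇒m∸n≤o ((a + b) ÷ d) (a ÷ d + b ÷ d) (≮⇒≥ λ l → <⇒≱
  (+-mono-< (<suc÷* a 1≤d) (<suc÷* b 1≤d))
  (≤-trans (≤-reflexive (s (a ÷ d) (b ÷ d) d)) (÷-≤ {suc (a ÷ d + b ÷ d + 1)} 1≤d l)))
  where
  s : ∀ x y d → (1 + x) * d + (1 + y) * d ≡ (1 + (x + y + 1)) * d
  s = solve-∀

bin-Λ : ∀ a b N → a + b ≤ N → ∏ N (λ d → Λ d ^ carry a b d) ≡ bin a b
bin-Λ a b N h = *-cancelʳ-≡ _ (bin a b) (a ! * b !) {{>-nonZero (*-mono-≤ (n!≥1 a) (n!≥1 b))}} (begin
  ∏ N (λ d → Λ d ^ carry a b d) * (a ! * b !)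
    ≡⟨ cong (∏ N (λ d → Λ d ^ carry a b d) *_) (cong₂ _*_ (sym (∏Λ-factorial a N (≤-trans (m≤m+n a b) h))) (sym (∏Λ-factorial b N (≤-trans (m≤n+m b a) h)))) ⟩
  ∏ N (λ d → Λ d ^ carry a b d) * (∏ N (λ d → Λ d ^ (a ÷ d)) * ∏ N (λ d → Λ d ^ (b ÷ d)))
    ≡⟨ cong (∏ N (λ d → Λ d ^ carry a b d) *_) (sym (∏-* N _ _)) ⟩
  ∏ N (λ d → Λ d ^ carry a b d) * ∏ N (λ d → Λ d ^ (a ÷ d) * Λ d ^ (b ÷ d)) ≡⟨ sym (∏-* N _ _) ⟩
  ∏ N (λ d → Λ d ^ carry a b d * (Λ d ^ (a ÷ d) * Λ d ^ (b ÷ d)))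
    ≡⟨ ∏-cong N (λ d _ _ → trans (cong (Λ d ^ carry a b d *_) (sym (^-distribˡ-+-* (Λ d) (a ÷ d) (b ÷ d))))
         (trans (sym (^-distribˡ-+-* (Λ d) (carry a b d) (a ÷ d + b ÷ d))) (cong (Λ d ^_) (m∸n+n≡m (÷-+-≤ a b d))))) ⟩
  ∏ N (λ d → Λ d ^ ((a + b) ÷ d)) ≡⟨ ∏Λ-factorial (a + b) N h ⟩
  (a + b) !             ≡⟨ sym (bin-! a b) ⟩
  bin a b * (a ! * b !) ∎)
  where open ≡-Reasoning

bin-monoˡ : ∀ {a a'} b → a ≤ a' → bin a b ≤ bin a' b
bin-monoˡ {a} {a'} b h with m≤n⇒m<n∨m≡n h
... | inj₂ refl = ≤-refl
bin-monoˡ {a} {suc a'} b _ | inj₁ (s≤s l) = ≤-trans (bin-monoˡ b l) (step b)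
  where
  step : ∀ b → bin a' b ≤ bin (suc a') b
  step zero = ≤-refl
  step (suc b) = ≤-trans (m≤n+m _ ((a' + suc b) C b)) (≤-reflexive (nCk+nC[k+1]≡[n+1]C[k+1] (a' + suc b) b))

∏-rising : ∀ a b → a ! * ∏ b (λ i → a + i) ≡ (a + b) !
∏-rising a zero    rewrite +-identityʳ a = *-identityʳ (a !)
∏-rising a (suc b) rewrite +-suc a b = trans (sym (*-assoc (a !) _ _)) (trans (cong (_* suc (a + b)) (∏-rising a b)) (*-comm ((a + b) !) (suc (a + b))))

bin-rising : ∀ a b → bin a b * b ! ≡ ∏ b (λ i → a + i)
bin-rising a b = *-cancelˡ-≡ _ _ (a !) {{a !≢0}} (trans (s (a !) (bin a b) (b !)) (trans (bin-! a b) (sym (∏-rising a b))))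
  where
  s : ∀ x y z → x * (y * z) ≡ y * (x * z)
  s = solve-∀

∏-const : ∀ n c → ∏ n (λ _ → c) ≡ c ^ n
∏-const zero c = refl
∏-const (suc n) c = trans (cong (_* c) (∏-const n c)) (*-comm (c ^ n) c)

suc^≤bin : ∀ a b → suc a ^ b ≤ bin a b * b !
suc^≤bin a b = subst₂ _≤_ (∏-const b (suc a)) (sym (bin-rising a b))
  (∏-mono b λ i 1≤i _ → ≤-trans (≤-reflexive (+-comm 1 a)) (+-monoʳ-≤ a 1≤i))

-- Each factor (a + i)/i of the binomial coefficient, i ≤ b, is at least (a + b)/b.
^≤^*bin : ∀ a b → (a + b) ^ b ≤ b ^ b * bin a b
^≤^*bin a b = *-cancelˡ-≤′ _ _ (n!≥1 b) (begin
  b ! * (a + b) ^ b                                ≡⟨ cong₂ _*_ (sym (∏-fact b)) (sym (∏-const b (a + b))) ⟩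
  ∏ b (λ i → i) * ∏ b (λ _ → a + b)                ≡⟨ sym (∏-* b _ _) ⟩
  ∏ b (λ i → i * (a + b))                          ≤⟨ ∏-mono b (λ i _ i≤b → pt i i≤b) ⟩
  ∏ b (λ i → (a + i) * b)                          ≡⟨ ∏-* b _ _ ⟩
  ∏ b (λ i → a + i) * ∏ b (λ _ → b)                ≡⟨ cong₂ _*_ (sym (bin-rising a b)) (∏-const b b) ⟩
  bin a b * b ! * b ^ b                            ≡⟨ s (bin a b) (b !) (b ^ b) ⟩
  b ! * (b ^ b * bin a b)                          ∎)
  where
  open ≤-Reasoning
  s : ∀ x y z → x * y * z ≡ y * (z * x)
  s = solve-∀
  pt : ∀ i → i ≤ b → i * (a + b) ≤ (a + i) * b
  pt i i≤b = subst₂ _≤_ (s₁ i a b) (s₂ i a b) (+-monoˡ-≤ (i * b) (*-monoʳ-≤ a i≤b))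
    where
    s₁ : ∀ i a b → a * i + i * b ≡ i * (a + b)
    s₁ = solve-∀
    s₂ : ∀ i a b → a * b + i * b ≡ (a + i) * b
    s₂ = solve-∀

∣-∏ : ∀ {p} → Prime p → ∀ n f → p ∣ ∏ n f → ∃ λ d → (1 ≤ d × d ≤ n) × p ∣ f d
∣-∏ pp zero f h = ⊥-elim (<⇒≢ (prime≥2 pp) (sym (∣1⇒≡1 h)))
∣-∏ pp (suc n) f h with euclidsLemma (∏ n f) (f (suc n)) pp h
... | inj₂ x = suc n , (s≤s z≤n , ≤-refl) , x
... | inj₁ x with ∣-∏ pp n f x
...   | d , (a , b) , y = d , (a , m≤n⇒m≤1+n b) , y

no-carry⇒∤bin : ∀ {p} a b → Prime p → (∀ j → carry a b (p ^ suc j) ≡ 0) → ¬ p ∣ bin a b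
no-carry⇒∤bin {p} a b pp h p∣ with ∣-∏ pp (a + b) (λ d → Λ d ^ carry a b d) (subst (p ∣_) (sym (bin-Λ a b (a + b) ≤-refl)) p∣)
... | d , (1≤d , _) , y with Λ-view d
...   | unit e = <⇒≢ (prime≥2 pp) (sym (∣1⇒≡1 (subst (p ∣_) (trans (cong (_^ carry a b d) e) (^-zeroˡ (carry a b d))) y)))
...   | power q j pq e eΛ with ∣^⇒≡ (carry a b d) pp pq (subst (λ z → p ∣ z ^ carry a b d) eΛ y)
...     | refl = <⇒≢ (prime≥2 pp) (sym (∣1⇒≡1 (subst (λ z → p ∣ Λ d ^ z) (trans (cong (carry a b) e) (h j)) y)))

isqrt : ∀ n → ∃ λ r → r * r ≤ n × n < suc r * suc r
isqrt zero = 0 , z≤n , s≤s z≤n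
isqrt (suc n) with isqrt n
... | r , a , b with suc n <? suc r * suc r
...   | yes l = r , m≤n⇒m≤1+n a , l
...   | no g  = suc r , ≮⇒≥ g , ≤-trans (s≤s b) (*-mono-< (n<1+n (suc r)) (n<1+n (suc r)))

-- A factorial ratio for the primes between 8n/9 and n

dividesᵇ : ℕ → Spec → Bool
dividesᵇ L []            = true
dividesᵇ L ((a , _) ∷ ν) = ((1 ≤ᵇ a) ∧ (L ≡ᵇ (L ÷ a) * a)) ∧ dividesᵇ L ν

∧-T : ∀ {a b} → T (a ∧ b) → T a × T b
∧-T {a} h = Equivalence.to (T-∧ {a}) h

dividesᵇ-sound : ∀ L ν → T (dividesᵇ L ν) → Divides L ν
dividesᵇ-sound L []            _ = []
dividesᵇ-sound L ((a , _) ∷ ν) h with ∧-T {(1 ≤ᵇ a) ∧ (L ≡ᵇ (L ÷ a) * a)} h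
... | x , y with ∧-T {1 ≤ᵇ a} x
...   | x₁ , x₂ = (≤ᵇ⇒≤ 1 a x₁ , divides (L ÷ a) (≡ᵇ⇒≡ L ((L ÷ a) * a) x₂)) ∷ dividesᵇ-sound L ν y

upperᵇ lowerᵇ : ℕ → LSpec → Bool
upperᵇ S []                = true
upperᵇ S ((a , _ , h) ∷ ν) = (a ^ S ≤ᵇ 2 ^ h) ∧ upperᵇ S ν
lowerᵇ S []                = true
lowerᵇ S ((a , _ , h) ∷ ν) = (2 ^ h ≤ᵇ a ^ S) ∧ lowerᵇ S ν

upperᵇ-sound : ∀ S ν → T (upperᵇ S ν) → UpperLogs S ν
upperᵇ-sound S []                _ = []
upperᵇ-sound S ((a , _ , h) ∷ ν) t with ∧-T {a ^ S ≤ᵇ 2 ^ h} t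
... | x , y = ≤ᵇ⇒≤ _ _ x ∷ upperᵇ-sound S ν y

lowerᵇ-sound : ∀ S ν → T (lowerᵇ S ν) → LowerLogs S ν
lowerᵇ-sound S []                _ = []
lowerᵇ-sound S ((a , _ , h) ∷ ν) t with ∧-T {2 ^ h ≤ᵇ a ^ S} t
... | x , y = ≤ᵇ⇒≤ _ _ x ∷ lowerᵇ-sound S ν y

-- A correction to the comparison of weights that switches on at u = U; under `∏Λ-thresholds` it
-- turns into powers of Ψ(N/U).
thresholds : Spec → ℕ → ℕ
thresholds []            u = 0
thresholds ((U , m) ∷ t) u = χ (U ≤? u) * m + thresholds t u

psis : ℕ → Spec → ℕ
psis N []            = 1
psis N ((U , m) ∷ t) = Ψ (N ÷ U) ^ m * psis N t

∏Λ-thresholds : ∀ {L} N t → Divides L t → ∏ N (λ d → Λ d ^ thresholds t (N ÷ d)) ≡ psis N t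
∏Λ-thresholds N [] _ = ∏-1 N
∏Λ-thresholds N ((U , m) ∷ t) ((1≤U , _) ∷ ds) = trans
  (∏-cong N λ d _ _ → trans (^-distribˡ-+-* (Λ d) (χ (U ≤? N ÷ d) * m) _) (cong (_* Λ d ^ thresholds t (N ÷ d)) (sym (^-*-assoc (Λ d) (χ (U ≤? N ÷ d)) m))))
  (trans (∏-* N _ _) (cong₂ _*_ (trans (sym (^-∏ N _ m)) (cong (_^ m) (∏Λ-threshold N U 1≤U))) (∏Λ-thresholds N t ds)))

psis-upper : ∀ N t → psis N (erase t) ^ 1000 ≤ 2 ^ weight N (scale (map (λ x → proj₁ x , proj₁ (proj₂ x) , 1640) t))
psis-upper N [] = ≤-reflexive (^-zeroˡ 1000)
psis-upper N ((U , m , h) ∷ t) = begin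
  (Ψ q ^ m * psis N (erase t)) ^ 1000           ≡⟨ *-^ (Ψ q ^ m) (psis N (erase t)) 1000 ⟩
  (Ψ q ^ m) ^ 1000 * psis N (erase t) ^ 1000    ≤⟨ *-mono-≤ le (psis-upper N t) ⟩
  2 ^ (q * (m * 1640)) * 2 ^ w                  ≡⟨ sym (^-distribˡ-+-* 2 (q * (m * 1640)) w) ⟩
  2 ^ (q * (m * 1640) + w)                      ∎
  where
  open ≤-Reasoning
  q = N ÷ U
  w = weight N (scale (map (λ x → proj₁ x , proj₁ (proj₂ x) , 1640) t))
  s : ∀ q m → 41 * q * (40 * m) ≡ q * (m * 1640)
  s = solve-∀
  s′ : ∀ m → m * 1000 ≡ 25 * (40 * m)
  s′ = solve-∀
  le : (Ψ q ^ m) ^ 1000 ≤ 2 ^ (q * (m * 1640))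
  le = subst₂ _≤_ (trans (^-*-assoc (Ψ q) 25 (40 * m)) (trans (cong (Ψ q ^_) (sym (s′ m))) (sym (^-*-assoc (Ψ q) m 1000))))
    (cong (2 ^_) (s q m)) (pow≤2^ {e = 41 * q} (40 * m) (Ψ-bound q))

-- A linear substitute for the logarithm, log₂ n ≤ e + n/2^e, where e can be taken large to make the
-- slope small.
n≤2^ : ∀ n e → n ≤ 2 ^ (e + n ÷ 2 ^ e)
n≤2^ n e = ≤-trans (<⇒≤ (<suc÷* n {2 ^ e} (1≤^ e (s≤s z≤n))))
  (≤-trans (*-monoˡ-≤ (2 ^ e) (2≤⇒n<^ (n ÷ 2 ^ e) ≤-refl))
    (≤-reflexive (trans (sym (^-distribˡ-+-* 2 (n ÷ 2 ^ e) e)) (cong (2 ^_) (+-comm (n ÷ 2 ^ e) e)))))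

-- ⌊8n/d⌋ = 8 means 8n/9 < d ≤ n. If that interval contains no prime, only proper prime powers
-- contribute, and `nonprime-Ψ` makes their product small.
window : ∀ n r → n < suc r * suc r → (∀ p → Prime p → p ≤ n → ¬ 8 * n < 9 * p) →
  ∏ (8 * n) (λ d → Λ d ^ χ (8 * n ÷ d ≟ 8)) ≤ Ψ r * Ψ r
window n r h none = ≤-trans (≤-reflexive (∏-extend _ (m≤n*m n 8) above))
  (≤-trans (∏-mono n λ d 1≤d d≤n → Λ^-mono d (pt d 1≤d d≤n)) (nonprime-Ψ n r h))
  where
  above : ∀ d → n < d → d ≤ 8 * n → Λ d ^ χ (8 * n ÷ d ≟ 8) ≡ 1
  above d l _ = cong (Λ d ^_) (χ-no (8 * n ÷ d ≟ 8) λ e →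
    <⇒≱ (*-monoʳ-< 8 l) (÷-≤ {8} (≤-trans (s≤s z≤n) l) (≤-reflexive (sym e))))
  pt : ∀ d → 1 ≤ d → d ≤ n → χ (8 * n ÷ d ≟ 8) ≤ nonprime d
  pt d 1≤d d≤n = go (8 * n ÷ d ≟ 8)
    where
    go : Dec (8 * n ÷ d ≡ 8) → χ (8 * n ÷ d ≟ 8) ≤ nonprime d
    go (no x) = ≤-trans (≤-reflexive (χ-no (8 * n ÷ d ≟ 8) x)) z≤n
    go (yes e) = ≤-reflexive (trans (χ-yes (8 * n ÷ d ≟ 8) e)
      (sym (χ-yes (¬? (prime? d)) λ pd → none d pd d≤n (subst (λ z → 8 * n < suc z * d) e (<suc÷* (8 * n) 1≤d)))))

-- A balanced ratio, used at N = 8n, whose weight difference is 2 at the quotient 8 and otherwise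
-- bounded by the corrections `gt`. The rapidly growing last entries of `gμ` make the reciprocal
-- sums agree exactly. Logarithms are in units of 1/1000, so 1640 expresses the bound 41/25 for Ψ.
-- From 6000 on the corrections add up to 36, the number of factorials in `gμ`, as `weight-gap`
-- demands. `gx` stands for N^68, with 68 factorials in all and 1048576 = 2^20 in `n≤2^`.
gν gμ gt gx : LSpec
gν = (8 , 2 , 3000) ∷ (18 , 2 , 4170) ∷ (27 , 2 , 4755) ∷ (45 , 2 , 5492) ∷ (48 , 2 , 5585) ∷ (63 , 2 , 5978) ∷ (80 , 2 , 6322) ∷ (99 , 1 , 6630) ∷ (112 , 2 , 6808) ∷ (120 , 2 , 6907) ∷ (153 , 2 , 7258) ∷ (168 , 1 , 7393) ∷ (176 , 2 , 7460) ∷ (184 , 2 , 7524) ∷ (207 , 1 , 7694) ∷ (261 , 2 , 8028) ∷ (270 , 3 , 8077) ∷ []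
gμ = (9 , 2 , 3169) ∷ (16 , 2 , 4000) ∷ (24 , 2 , 4584) ∷ (40 , 2 , 5321) ∷ (54 , 2 , 5754) ∷ (56 , 2 , 5807) ∷ (88 , 2 , 6459) ∷ (90 , 2 , 6491) ∷ (104 , 1 , 6700) ∷ (135 , 1 , 7076) ∷ (136 , 2 , 7087) ∷ (152 , 2 , 7247) ∷ (180 , 2 , 7491) ∷ (189 , 2 , 7562) ∷ (216 , 1 , 7754) ∷ (240 , 2 , 7906) ∷ (252 , 2 , 7977) ∷ (558 , 1 , 9124) ∷ (543419 , 1 , 19051) ∷ (415775169610 , 1 , 38597) ∷ (399624671616271493333552 , 1 , 78402) ∷ (178334297420083658335549067306422699264328350704 , 1 , 156965) ∷ []
gt = (135 , 1 , 1640) ∷ (248 , 1 , 1640) ∷ (344 , 1 , 1640) ∷ (891 , 1 , 1640) ∷ (3736 , 1 , 1640) ∷ (4456 , 1 , 1640) ∷ (6000 , 30 , 1640) ∷ []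
gx = (1048576 , 68 , 1000) ∷ []
gL : ℕ
gL = 49021500991646118746631575397905516365266776777718309715968000

gdν : Divides gL (erase gν)
gdν = dividesᵇ-sound gL (erase gν) (≡true⇒T refl)
gdμ : Divides gL (erase gμ)
gdμ = dividesᵇ-sound gL (erase gμ) (≡true⇒T refl)
gdt : Divides gL (erase gt)
gdt = dividesᵇ-sound gL (erase gt) (≡true⇒T refl)
gdx : Divides gL (erase gx)
gdx = dividesᵇ-sound gL (erase gx) (≡true⇒T refl)
gbal : weight gL (erase gν) ≡ weight gL (erase gμ)
gbal = ≡ᵇ⇒≡ _ _ (≡true⇒T refl)
gup : UpperLogs 1000 gν
gup = upperᵇ-sound 1000 gν (≡true⇒T refl)
glo : LowerLogs 1000 gμ
glo = lowerᵇ-sound 1000 gμ (≡true⇒T refl)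

gc : ℕ → ℕ
gc u = χ (u ≟ 8) * 2 + thresholds (erase gt) u

gf : ℕ → Bool
gf u = weight u (erase gν) ≤ᵇ weight u (erase gμ) + gc u

gcheck : all< 6000 gf ≡ true
gcheck = refl

gsmall : ∀ {u} → u < 6000 → T (gf u)
gsmall = all<-sound 6000 gf (≡true⇒T gcheck)

thresholds-full : ∀ (t : Spec) u → All (λ x → proj₁ x ≤ u) t → thresholds t u ≡ count t
thresholds-full [] u _ = refl
thresholds-full ((U , m) ∷ t) u (l ∷ ls) = cong₂ _+_ (trans (cong (_* m) (χ-yes (U ≤? u) l)) (*-identityˡ m)) (thresholds-full t u ls)

gbig : ∀ {u} → 6000 ≤ u → All (λ x → proj₁ x ≤ u) (erase gt)
gbig h = ≤-trans (≤! 135 6000 refl) h ∷ ≤-trans (≤! 248 6000 refl) h ∷ ≤-trans (≤! 344 6000 refl) h ∷ ≤-trans (≤! 891 6000 refl) h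
  ∷ ≤-trans (≤! 3736 6000 refl) h ∷ ≤-trans (≤! 4456 6000 refl) h ∷ h ∷ []

gcond : ∀ u → 1 ≤ u → weight u (erase gν) ≤ weight u (erase gμ) + gc u
gcond u _ = go (u <? 6000)
  where
  go : Dec (u < 6000) → weight u (erase gν) ≤ weight u (erase gμ) + gc u
  go (yes l) = ≤ᵇ⇒≤ (weight u (erase gν)) (weight u (erase gμ) + gc u) (gsmall l)
  go (no g) = ≤-trans (weight-gap u gL (erase gν) (erase gμ) (≤! 1 gL refl) gdν gdμ gbal)
      (+-monoʳ-≤ (weight u (erase gμ)) (≤-trans (≤-reflexive (sym (thresholds-full (erase gt) u (gbig (≮⇒≥ g))))) (m≤n+m (thresholds (erase gt) u) (χ (u ≟ 8) * 2))))

-- Primes in short intervals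

<! : ∀ m n → (m <ᵇ n) ≡ true → m < n
<! m n e = <ᵇ⇒< m n (≡true⇒T e)

2^-cancel-≤ : ∀ {x y} → 2 ^ x ≤ 2 ^ y → x ≤ y
2^-cancel-≤ h = ≮⇒≥ λ l → <⇒≱ (^-monoʳ-< 2 (s≤s (s≤s z≤n)) l) h

am-gm : ∀ r R → 2 * (r * R) ≤ r * r + R * R
am-gm r R with ≤-total r R
... | inj₁ l = subst (λ z → 2 * (r * z) ≤ r * r + z * z) (m+[n∸m]≡n l) (s r (R ∸ r))
  where
  s : ∀ r d → 2 * (r * (r + d)) ≤ r * r + (r + d) * (r + d)
  s r d = ≤-trans (m≤m+n _ (d * d)) (≤-reflexive (e r d)) where
    e : ∀ r d → 2 * (r * (r + d)) + d * d ≡ r * r + (r + d) * (r + d)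
    e = solve-∀
... | inj₂ l = subst (λ z → 2 * (z * R) ≤ z * z + R * R) (m+[n∸m]≡n l) (s R (r ∸ R))
  where
  s : ∀ R d → 2 * ((R + d) * R) ≤ (R + d) * (R + d) + R * R
  s R d = ≤-trans (m≤m+n _ (d * d)) (≤-reflexive (e R d)) where
    e : ∀ R d → 2 * ((R + d) * R) + d * d ≡ (R + d) * (R + d) + R * R
    e = solve-∀

-- Floors are replaced by linear terms in N, and the term in r, of the order of √n, becomes linear
-- in n through 2rR ≤ r² + R²; R is a parameter to be tuned.
combine : ∀ n r R N L β wμ wν wt wx Eμ Eν Et Ex cμ K → r * r ≤ n →
  N * wμ ≤ (Eμ + cμ) * L → Eν * L ≤ N * wν → Et * L ≤ N * wt → Ex * L ≤ N * wx →
  Eμ ≤ r * (2 * β) + Et + Eν + (K + Ex) →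
  R * (N * wμ) ≤ R * (N * (wν + wt + wx)) + (β * (n + R * R) + R * (K + cμ)) * L
combine n r R N L β wμ wν wt wx Eμ Eν Et Ex cμ K r² hμ hν ht hx h = begin
  R * (N * wμ)                                                    ≤⟨ *-monoʳ-≤ R hμ ⟩
  R * ((Eμ + cμ) * L)                                             ≤⟨ *-monoʳ-≤ R (*-monoˡ-≤ L (+-monoˡ-≤ cμ h)) ⟩
  R * ((r * (2 * β) + Et + Eν + (K + Ex) + cμ) * L)                 ≡⟨ s₁ R β r Et Eν K Ex cμ L ⟩
  R * (Eν * L + Et * L + Ex * L) + (β * (2 * (r * R)) + R * (K + cμ)) * L
    ≤⟨ +-mono-≤ (*-monoʳ-≤ R (+-mono-≤ (+-mono-≤ hν ht) hx)) (*-monoˡ-≤ L (+-monoˡ-≤ (R * (K + cμ)) (*-monoʳ-≤ β (≤-trans (am-gm r R) (+-monoˡ-≤ (R * R) r²))))) ⟩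
  R * (N * wν + N * wt + N * wx) + (β * (n + R * R) + R * (K + cμ)) * L
    ≡⟨ cong (λ z → R * z + (β * (n + R * R) + R * (K + cμ)) * L) (s₂ N wν wt wx) ⟩
  R * (N * (wν + wt + wx)) + (β * (n + R * R) + R * (K + cμ)) * L ∎
  where
  open ≤-Reasoning
  s₁ : ∀ R β r Et Eν K Ex cμ L → R * ((r * (2 * β) + Et + Eν + (K + Ex) + cμ) * L) ≡ R * (Eν * L + Et * L + Ex * L) + (β * (2 * (r * R)) + R * (K + cμ)) * L
  s₁ = solve-∀
  s₂ : ∀ N a b c → N * a + N * b + N * c ≡ N * (a + b + c)
  s₂ = solve-∀

too-big : ∀ n n₀ m R L β wμ w D K → n₀ ≤ n →
  R * (m * n * wμ) ≤ R * (m * n * w) + (β * (n + R * R) + R * K) * L →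
  R * (m * w) + β * L + D ≤ R * (m * wμ) → (β * (R * R) + R * K) * L < D * n₀ → ⊥
too-big n n₀ m R L β wμ w D K n₀≤n h hD hC = <⇒≱ hC (≤-trans (*-monoʳ-≤ D n₀≤n)
  (+-cancelˡ-≤ ((R * (m * w) + β * L) * n) _ _ (begin
    (R * (m * w) + β * L) * n + D * n         ≡⟨ sym (*-distribʳ-+ n (R * (m * w) + β * L) D) ⟩
    (R * (m * w) + β * L + D) * n             ≤⟨ *-monoˡ-≤ n hD ⟩
    R * (m * wμ) * n                          ≡⟨ s₁ R m wμ n ⟩
    R * (m * n * wμ)                          ≤⟨ h ⟩
    R * (m * n * w) + (β * (n + R * R) + R * K) * L ≡⟨ s₂ R m n w β K L ⟩
    (R * (m * w) + β * L) * n + (β * (R * R) + R * K) * L ∎)))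
  where
  open ≤-Reasoning
  s₁ : ∀ R m w n → R * (m * w) * n ≡ R * (m * n * w)
  s₁ = solve-∀
  s₂ : ∀ R m n w β K L → R * (m * n * w) + (β * (n + R * R) + R * K) * L ≡ (R * (m * w) + β * L) * n + (β * (R * R) + R * K) * L
  s₂ = solve-∀

gwμ gwν gwt gwx gcμ : ℕ
gwμ = weight gL (scale gμ)
gwν = weight gL (scale gν)
gwt = weight gL (scale gt)
gwx = weight gL (scale gx)
gcμ = count (scale gμ)

-- The amount per unit of n, times 400 `gL`, by which `gμ` outweighs `gν`, the corrections, N^68 and
-- the proper prime powers. Here 400 is the R of `combine`, and 2 · 3280 = 4 · 1640 is the exponent
-- of Ψ(r)^4.
gD : ℕ
gD = 400 * (8 * gwμ) ∸ (400 * (8 * (gwν + gwt + gwx)) + 3280 * gL)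

gD≤ : 400 * (8 * (gwν + gwt + gwx)) + 3280 * gL + gD ≤ 400 * (8 * gwμ)
gD≤ = ≤! (400 * (8 * (gwν + gwt + gwx)) + 3280 * gL + gD) (400 * (8 * gwμ)) refl

gC< : (3280 * (400 * 400) + 400 * (1360000 + gcμ)) * gL < gD * 221395
gC< = <! ((3280 * (400 * 400) + 400 * (1360000 + gcμ)) * gL) (gD * 221395) refl

pow-4 : ∀ x → ((x * x) ^ 2) ^ 1000 ≡ (x ^ 25) ^ 160
pow-4 x = trans (cong (_^ 1000) (trans (cong (λ z → (x * z) ^ 2) (sym (*-identityʳ x))) (^-*-assoc x 2 2)))
            (trans (^-*-assoc x 4 1000) (sym (^-*-assoc x 25 160)))

^^≤2^ : ∀ N c S e K X → K ≡ e * (c * S) → (N ÷ 2 ^ e) * (c * S) + 0 ≡ X → (N ^ c) ^ S ≤ 2 ^ (K + X)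
^^≤2^ N c S e K X refl refl = ≤-trans (≤-reflexive (^-*-assoc N c S)) (≤-trans (pow≤2^ {N} {e + N ÷ 2 ^ e} (c * S) (n≤2^ N e))
  (≤-reflexive (cong (2 ^_) (trans (*-distribʳ-+ (c * S) e (N ÷ 2 ^ e)) (cong (e * (c * S) +_) (sym (+-identityʳ ((N ÷ 2 ^ e) * (c * S)))))))))

pow-bound : ∀ S {A W P X Y Q} → A ≤ W * P * X → W ≤ Y * Q → A ^ S ≤ Y ^ S * Q ^ S * P ^ S * X ^ S
pow-bound S {A} {W} {P} {X} {Y} {Q} h w = ≤-trans (^-monoˡ-≤ S (≤-trans h (*-monoˡ-≤ X (*-monoˡ-≤ P w))))
  (≤-reflexive (trans (*-^ (Y * Q * P) X S) (cong (_* X ^ S) (trans (*-^ (Y * Q) P S) (cong (_* P ^ S) (*-^ Y Q S))))))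

g-count : count (erase gν) + count (erase gμ) ≡ 68
g-count = refl

module Exponents (n r : ℕ) (1≤n : 1 ≤ n) (<r² : n < suc r * suc r) (none : ∀ p → Prime p → p ≤ n → ¬ 8 * n < 9 * p) where
  N : ℕ
  N = 8 * n

  1≤N : 1 ≤ N
  1≤N = ≤-trans 1≤n (m≤n*m n 8)

  W : ℕ
  W = ∏ N (λ d → Λ d ^ gc (N ÷ d))

  g-pows : pows N (erase gμ) ≤ W * pows N (erase gν) * N ^ 68
  g-pows = subst (λ z → pows N (erase gμ) ≤ W * pows N (erase gν) * N ^ z) {count (erase gν) + count (erase gμ)} {68} g-count
    (pows≤ N gL (erase gν) (erase gμ) gc 1≤N (≤! 1 gL refl) gdν gdμ gbal gcond)

  W≤ : W ≤ (Ψ r * Ψ r) ^ 2 * psis N (erase gt)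
  W≤ = ≤-trans (≤-reflexive (trans (∏-cong N λ d _ _ → trans (^-distribˡ-+-* (Λ d) (χ (N ÷ d ≟ 8) * 2) (thresholds (erase gt) (N ÷ d)))
          (cong (_* Λ d ^ thresholds (erase gt) (N ÷ d)) (sym (^-*-assoc (Λ d) (χ (N ÷ d ≟ 8)) 2))))
        (trans (∏-* N _ _) (cong₂ _*_ (sym (^-∏ N _ 2)) (∏Λ-thresholds N (erase gt) gdt)))))
      (*-monoˡ-≤ (psis N (erase gt)) (^-monoˡ-≤ 2 (window n r <r² none)))

  Ψ≤ : ((Ψ r * Ψ r) ^ 2) ^ 1000 ≤ 2 ^ (r * (2 * 3280))
  Ψ≤ = subst₂ _≤_ (sym (pow-4 (Ψ r))) (cong (2 ^_) (e r)) (pow≤2^ {e = 41 * r} 160 (Ψ-bound r))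
    where
    e : ∀ r → 41 * r * 160 ≡ r * (41 * 160)
    e r = trans (cong (_* 160) (*-comm 41 r)) (*-assoc r 41 160)

  N≤ : (N ^ 68) ^ 1000 ≤ 2 ^ (1360000 + expo N gx)
  N≤ = ^^≤2^ N 68 1000 20 1360000 (expo N gx) refl refl

  psis≤ : psis N (erase gt) ^ 1000 ≤ 2 ^ expo N gt
  psis≤ = psis-upper N gt

  exponents : expo N gμ ≤ r * (2 * 3280) + expo N gt + expo N gν + (1360000 + expo N gx)
  exponents = 2^-cancel-≤ (≤-trans (pows-lower 1000 N gμ glo) (≤-trans (pow-bound 1000 {pows N (erase gμ)} {W} {pows N (erase gν)} {N ^ 68} {(Ψ r * Ψ r) ^ 2} {psis N (erase gt)} g-pows W≤)
    (*≤2^ {a = r * (2 * 3280) + expo N gt + expo N gν} (*≤2^ {a = r * (2 * 3280) + expo N gt} (*≤2^ {a = r * (2 * 3280)} Ψ≤ psis≤) (pows-upper 1000 N gν gup))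
      N≤)))

gap-large : ∀ n → 221395 ≤ n → ∃ λ p → Prime p × p ≤ n × 8 * n < 9 * p
gap-large n h with anyUpTo? (λ p → prime? p ×-dec (8 * n <? 9 * p)) (suc n)
... | yes (p , s≤s p≤n , pp , l) = p , pp , p≤n , l
... | no none with isqrt n
...   | r , r²≤n , <r² = ⊥-elim (too-big n 221395 8 400 gL 3280 gwμ (gwν + gwt + gwx) gD (1360000 + gcμ) h
        (combine n r 400 (8 * n) gL 3280 gwμ gwν gwt gwx (expo (8 * n) gμ) (expo (8 * n) gν) (expo (8 * n) gt) (expo (8 * n) gx) gcμ 1360000 r²≤n
          (≤-weight (8 * n) gL (scale gμ) (Divides-scale gμ gdμ)) (weight-≤ (8 * n) gL (scale gν) (Divides-scale gν gdν))
          (weight-≤ (8 * n) gL (scale gt) (Divides-scale gt gdt)) (weight-≤ (8 * n) gL (scale gx) (Divides-scale gx gdx))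
          (Exponents.exponents n r (≤-trans (≤! 1 221395 refl) h) <r² (λ p pp p≤n l → none (p , s≤s p≤n , pp , l))))
        gD≤ gC<)

trial : ℕ → ℕ → ℕ → Bool
trial zero    d p = false
trial (suc f) d p = if p <ᵇ d * d then true else (if does (d ∣? p) then false else trial f (suc d) p)

trial-sound : ∀ f d p → 2 ≤ p → 1 ≤ d → d Rough p → trial f d p ≡ true → Prime p
trial-sound (suc f) d p 2≤p 1≤d r h with p <ᵇ d * d in e
... | true = rough∧square>⇒prime {{2≤⇒nonTrivial 2≤p}} r (<ᵇ⇒< p (d * d) (≡true⇒T e))
... | false with d ∣? p
...   | no n = trial-sound f (suc d) p 2≤p (m≤n⇒m≤1+n 1≤d) (∤⇒rough-suc n r) h

primeᵇ : ℕ → Bool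
primeᵇ p = (2 ≤ᵇ p) ∧ trial p 2 p

primeᵇ-sound : ∀ p → T (primeᵇ p) → Prime p
primeᵇ-sound p h with ∧-T {2 ≤ᵇ p} h
... | x , y = trial-sound p 2 p (≤ᵇ⇒≤ 2 p x) (s≤s z≤n) 2-rough (T⇒≡true y)

-- The inequality says B (q - 1) < A p, so the prime p serves every n from p to q - 1.
chainᵇ : ℕ → ℕ → ℕ → List ℕ → Bool
chainᵇ A B p []       = true
chainᵇ A B p (q ∷ qs) = primeᵇ p ∧ ((B * q <ᵇ A * p + B) ∧ chainᵇ A B q qs)

end : ℕ → List ℕ → ℕ
end p []       = p
end p (q ∷ qs) = end q qs

chain-sound : ∀ A B p qs → T (chainᵇ A B p qs) → ∀ n → p ≤ n → n < end p qs → ∃ λ q → Prime q × q ≤ n × B * n < A * q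
chain-sound A B p [] h n a b = ⊥-elim (<⇒≱ b a)
chain-sound A B p (q ∷ qs) h n a b with ∧-T {primeᵇ p} h
... | x , y with ∧-T {B * q <ᵇ A * p + B} y
...   | y₁ , y₂ with q ≤? n
...     | yes l = chain-sound A B q qs y₂ n l b
...     | no g  = p , primeᵇ-sound p x , a , +-cancelʳ-< B (B * n) (A * p)
            (≤-<-trans (≤-trans (≤-reflexive (trans (+-comm (B * n) B) (sym (*-suc B n)))) (*-monoʳ-≤ B (≰⇒> g))) (<ᵇ⇒< (B * q) (A * p + B) y₁))

chain₁ chain₂ : List ℕ
chain₁ = 37 ∷ 41 ∷ 47 ∷ 53 ∷ 59 ∷ 67 ∷ 73 ∷ 83 ∷ 89 ∷ 101 ∷ 113 ∷ 127 ∷ 139 ∷ 157 ∷ 173 ∷ 193 ∷ 211 ∷ []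
chain₂ = 211 ∷ 223 ∷ 233 ∷ 241 ∷ 251 ∷ 263 ∷ 277 ∷ 283 ∷ 293 ∷ 307 ∷ 317 ∷ 331 ∷ 349 ∷ 367 ∷ 383 ∷ 401 ∷ 421 ∷ 443 ∷ 467 ∷ 491 ∷ 509 ∷ 523 ∷ 547 ∷ 571 ∷ 601 ∷ 631 ∷ 661 ∷ 691 ∷ 727 ∷ 761 ∷ 797 ∷ 839 ∷ 883 ∷ 929 ∷ 977 ∷ 1021 ∷ 1069 ∷ 1123 ∷ 1181 ∷ 1237 ∷ 1303 ∷ 1367 ∷ 1439 ∷ 1511 ∷ 1583 ∷ 1667 ∷ 1753 ∷ 1831 ∷ 1913 ∷ 2011 ∷ 2113 ∷ 2221 ∷ 2333 ∷ 2447 ∷ 2557 ∷ 2689 ∷ 2819 ∷ 2963 ∷ 3119 ∷ 3271 ∷ 3433 ∷ 3613 ∷ 3803 ∷ 4003 ∷ 4211 ∷ 4423 ∷ 4651 ∷ 4889 ∷ 5147 ∷ 5417 ∷ 5701 ∷ 5987 ∷ 6301 ∷ 6619 ∷ 6967 ∷ 7333 ∷ 7717 ∷ 8123 ∷ 8543 ∷ 8971 ∷ 9439 ∷ 9931 ∷ 10453 ∷ 11003 ∷ 11579 ∷ 12163 ∷ 12799 ∷ 13469 ∷ 14177 ∷ 14923 ∷ 15683 ∷ 16493 ∷ 17359 ∷ 18269 ∷ 19231 ∷ 20233 ∷ 21283 ∷ 22397 ∷ 23567 ∷ 24799 ∷ 26099 ∷ 27457 ∷ 28901 ∷ 30403 ∷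 32003 ∷ 33679 ∷ 35449 ∷ 37313 ∷ 39251 ∷ 41299 ∷ 43457 ∷ 45737 ∷ 48131 ∷ 50651 ∷ 53309 ∷ 56113 ∷ 59063 ∷ 62171 ∷ 65437 ∷ 68881 ∷ 72503 ∷ 76303 ∷ 80317 ∷ 84533 ∷ 88969 ∷ 93637 ∷ 98563 ∷ 103723 ∷ 109171 ∷ 114913 ∷ 120947 ∷ 127301 ∷ 133999 ∷ 141041 ∷ 148457 ∷ 156269 ∷ 164477 ∷ 173099 ∷ 182209 ∷ 191791 ∷ 201881 ∷ 212507 ∷ 223681 ∷ 235447 ∷ 247829 ∷ 260873 ∷ 274591 ∷ 289039 ∷ 304223 ∷ 320219 ∷ 337069 ∷ 354799 ∷ 373463 ∷ 393109 ∷ 413783 ∷ []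

chain₁-ok : chainᵇ 9 8 37 chain₁ ≡ true
chain₁-ok = refl
chain₂-ok : chainᵇ 20 19 211 chain₂ ≡ true
chain₂-ok = refl

-- Besides covering small n in `gap₉`, the sharper fraction 19/20 is meant for n < 20k with k <
-- 20000, whence 400000 = 20 · 20000.
gap₂₀ : ∀ n → 211 ≤ n → n < 400000 → ∃ λ p → Prime p × p ≤ n × 19 * n < 20 * p
gap₂₀ n a b = chain-sound 20 19 211 chain₂ (≡true⇒T chain₂-ok) n a (<-≤-trans b (≤! 400000 (end 211 chain₂) refl))

gap₉ : ∀ n → 37 ≤ n → ∃ λ p → Prime p × p ≤ n × 8 * n < 9 * p
gap₉ n h with n <? 211
... | yes l = chain-sound 9 8 37 chain₁ (≡true⇒T chain₁-ok) n h (<-≤-trans l (≤! 211 (end 37 chain₁) refl))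
... | no g with n <? 400000
...   | no g′ = gap-large n (≤-trans (≤! 221395 400000 refl) (≮⇒≥ g′))
...   | yes l with gap₂₀ n (≮⇒≥ g) l
...     | p , pp , p≤n , lt = p , pp , p≤n , *-cancelˡ-< 20 (8 * n) (9 * p)
          (≤-<-trans (≤-trans (m≤m+n (20 * (8 * n)) (11 * n)) (≤-reflexive (s₁ n))) (subst (9 * (19 * n) <_) (s₂ p) (*-monoʳ-< 9 lt)))
  where
  s₁ : ∀ n → 20 * (8 * n) + 11 * n ≡ 9 * (19 * n)
  s₁ = solve-∀
  s₂ : ∀ p → 9 * (20 * p) ≡ 20 * (9 * p)
  s₂ = solve-∀

-- The consequences of having a factor of degree k

-- With n = m + k, this is all that the arithmetic of the window retains of the factor of degree k.
-- The condition p ∣ m + i amounts to n ≡ k - i modulo p.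
Stuck : ℕ → ℕ → ℕ → Set
Stuck m k s = ∀ p i → Prime p → k < p → 1 ≤ i → i ≤ k → p ∣ m + i → p ∣ bin (m + k) s

carry-0 : ∀ {a b d} q r q′ r′ → a ≡ q * d + r → b ≡ q′ * d + r′ → r + r′ < d → carry a b d ≡ 0
carry-0 {d = d} q r q′ r′ refl refl h = trans (cong₂ _∸_ e₁ (cong₂ _+_ e₂ e₃)) (n∸n≡0 (q + q′))
  where
  s₁ : ∀ q q′ d r r′ → q * d + r + (q′ * d + r′) ≡ (q + q′) * d + (r + r′)
  s₁ = solve-∀
  s₂ : ∀ q d r → q * d + r ≡ r + q * d
  s₂ = solve-∀
  below : ∀ q r → r < d → q * d + r < suc q * d
  below q r l = subst (_< suc q * d) (sym (s₂ q d r)) (+-monoˡ-< (q * d) l)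
  e₁ : (q * d + r + (q′ * d + r′)) ÷ d ≡ q + q′
  e₁ = trans (cong (_÷ d) (s₁ q q′ d r r′)) (÷-unique {q + q′} (m≤m+n _ _) (below (q + q′) (r + r′) h))
  e₂ : (q * d + r) ÷ d ≡ q
  e₂ = ÷-unique {q} (m≤m+n _ _) (below q r (≤-<-trans (m≤m+n r r′) h))
  e₃ : (q′ * d + r′) ÷ d ≡ q′
  e₃ = ÷-unique {q′} (m≤m+n _ _) (below q′ r′ (≤-<-trans (m≤n+m r′ r) h))

-- Modulo P D the number n leaves t P + l with t < D, and adding s < P - l does not reach P D. In
-- the applications P is p or p² and D a power of p.
carry-0-mult : ∀ {n s P} q l D → 1 ≤ D → n ≡ q * P + l → l + s < P → carry n s (P * D) ≡ 0
carry-0-mult {n} {s} {P} q l D 1≤D e h = carry-0 (q ÷ D) (t * P + l) 0 s e₁ refl lt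
  where
  t = q ∸ (q ÷ D) * D
  q≡ : q ≡ (q ÷ D) * D + t
  q≡ = sym (m+[n∸m]≡n (÷*≤ q D))
  t<D : t < D
  t<D = +-cancelˡ-< ((q ÷ D) * D) t D (subst₂ _<_ q≡ (+-comm D ((q ÷ D) * D)) (<suc÷* q 1≤D))
  s₁ : ∀ x D t P l → (x * D + t) * P + l ≡ x * (P * D) + (t * P + l)
  s₁ = solve-∀
  e₁ : n ≡ (q ÷ D) * (P * D) + (t * P + l)
  e₁ = trans e (trans (cong (λ z → z * P + l) q≡) (s₁ (q ÷ D) D t P l))
  lt : t * P + l + s < P * D
  lt = <-≤-trans (subst₂ _<_ (sym (+-assoc (t * P) l s)) (+-comm (t * P) P) (+-monoʳ-< (t * P) h))
         (≤-trans (*-monoˡ-≤ P t<D) (≤-reflexive (*-comm D P)))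

window-form : ∀ {m k i p} → i ≤ k → (d : p ∣ m + i) → m + k ≡ _∣_.quotient d * p + (k ∸ i)
window-form {m} {k} {i} i≤k (divides q e) = trans (cong (m +_) (sym (m+[n∸m]≡n i≤k))) (trans (sym (+-assoc m i (k ∸ i))) (cong (_+ (k ∸ i)) e))

-- Otherwise s and the residue k - i of n add up to less than p, so that no power of p produces a
-- carry and p does not divide the binomial coefficient.
stuck⇒≤ : ∀ {m k s p i} → Stuck m k s → Prime p → k < p → 1 ≤ i → i ≤ k → p ∣ m + i → p ≤ k ∸ i + s
stuck⇒≤ {m} {k} {s} {p} {i} st pp k<p 1≤i i≤k d = ≮⇒≥ λ l →
  no-carry⇒∤bin (m + k) s pp (λ j → carry-0-mult (_∣_.quotient d) (k ∸ i) (p ^ j) (1≤^ j (prime≥1 pp)) (window-form i≤k d) l)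
    (st p i pp k<p 1≤i i≤k d)

stuck⇒<3k : ∀ {m k s p i} → Stuck m k s → s < 2 * k → Prime p → 1 ≤ i → i ≤ k → p ∣ m + i → p < 3 * k
stuck⇒<3k {m} {k} {s} {p} {i} st s<2k pp 1≤i i≤k d with k <? p
... | yes k<p = ≤-<-trans (stuck⇒≤ st pp k<p 1≤i i≤k d) (+-mono-≤-< (m∸n≤m k i) s<2k)
... | no g = ≤-<-trans (≮⇒≥ g) (m<m+n k (≤-trans (≤-trans 1≤i i≤k) (m≤m+n k (k + 0))))

low-carry-0 : ∀ {m k s p i} → i ≤ k → p ∣ m + i → s + (k ∸ i) < suc (s ÷ p) * p → carry (m + k) s p ≡ 0
low-carry-0 {m} {k} {s} {p} {i} i≤k d l = carry-0 (_∣_.quotient d) (k ∸ i) (s ÷ p) s₀ (window-form i≤k d) s≡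
  (+-cancelˡ-< ((s ÷ p) * p) (k ∸ i + s₀) p (subst₂ _<_ (trans (cong (_+ (k ∸ i)) s≡) (sw ((s ÷ p) * p) s₀ (k ∸ i))) (+-comm p ((s ÷ p) * p)) l))
  where
  s₀ = s ∸ (s ÷ p) * p
  s≡ : s ≡ (s ÷ p) * p + s₀
  s≡ = sym (m+[n∸m]≡n (÷*≤ s p))
  sw : ∀ x y z → x + y + z ≡ x + (z + y)
  sw = solve-∀

-- l + (s mod p) ≥ p for l = k − i, written with p (s ÷ p) + p instead of a remainder
stuck⇒carry : ∀ {m k s p i} → Stuck m k s → Prime p → k < p → m + k + s < p * p → 1 ≤ i → i ≤ k → p ∣ m + i →
  suc (s ÷ p) * p ≤ s + (k ∸ i)
stuck⇒carry {m} {k} {s} {p} {i} st pp k<p n+s<p² 1≤i i≤k d = ≮⇒≥ λ l →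
  no-carry⇒∤bin (m + k) s pp (nc l) (st p i pp k<p 1≤i i≤k d)
  where
  nc : s + (k ∸ i) < suc (s ÷ p) * p → ∀ j → carry (m + k) s (p ^ suc j) ≡ 0
  nc l zero = subst (λ z → carry (m + k) s z ≡ 0) (sym (*-identityʳ p)) (low-carry-0 i≤k d l)
  nc l (suc j) = carry-0 0 (m + k) 0 s refl refl (<-≤-trans n+s<p²
    (≤-trans (≤-reflexive (cong (p *_) (sym (*-identityʳ p)))) (*-monoʳ-≤ p (*-monoʳ-≤ p (1≤^ j (prime≥1 pp))))))

carry⇒window : ∀ {m k d} → 1 ≤ d → k < d → 1 ≤ carry m k d → ∃ λ i → 1 ≤ i × i ≤ k × d ∣ m + i
carry⇒window {m} {k} {d} 1≤d k<d h = i , i≥1 , i≤k , divides q (m+[n∸m]≡n (<⇒≤ m<qd))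
  where
  q = (m + k) ÷ d
  q> : m ÷ d < q
  q> = ≤-<-trans (≤-reflexive (sym (trans (cong (m ÷ d +_) (<⇒÷≡0 k<d)) (+-identityʳ _)))) (≰⇒> λ l → <⇒≱ h (≤-reflexive (m≤n⇒m∸n≡0 l)))
  m<qd : m < q * d
  m<qd = <-≤-trans (<suc÷* m 1≤d) (*-monoˡ-≤ d q>)
  i = q * d ∸ m
  i≥1 : 1 ≤ i
  i≥1 = m<n⇒0<n∸m m<qd
  i≤k : i ≤ k
  i≤k = m≤n+o⇒m∸n≤o (q * d) m (÷*≤ (m + k) d)

-- Decompose C(n,k) by `bin-Λ`. The d ≤ k cost at most Ψ(k), the proper prime powers at most Ψ(r)².
-- A prime d > k that occurs divides some m + i, and since n + s < (k+1)² the carry it owes can only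
-- come from the lowest digit; then s and k - i carry at d, hence also s and k, and d occurs in
-- C(s+k,k).
stuck-bin≤ : ∀ m k s r → Stuck m k s → 1 ≤ k → m + k + s < suc r * suc r → m + k + s < suc k * suc k →
  bin m k ≤ bin s k * Ψ k * (Ψ r * Ψ r)
stuck-bin≤ m k s r st 1≤k <r² <k² = begin
  bin m k                                        ≡⟨ sym (bin-Λ m k N (m≤m+n (m + k) s)) ⟩
  ∏ N (λ d → Λ d ^ carry m k d)                  ≤⟨ ∏-mono N (λ d 1≤d d≤N → pt d 1≤d) ⟩
  ∏ N (λ d → Λ d ^ carry s k d * Λ d ^ χ (d ≤? k) * Λ d ^ nonprime d) ≡⟨ trans (∏-* N _ _) (cong (_* ∏ N (λ d → Λ d ^ nonprime d)) (∏-* N _ _)) ⟩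
  ∏ N (λ d → Λ d ^ carry s k d) * ∏ N (λ d → Λ d ^ χ (d ≤? k)) * ∏ N (λ d → Λ d ^ nonprime d)
    ≤⟨ *-mono-≤ (*-mono-≤ (≤-reflexive (bin-Λ s k N s+k≤N)) (≤-reflexive Ψk)) (nonprime-Ψ N r <r²) ⟩
  bin s k * Ψ k * (Ψ r * Ψ r)                    ∎
  where
  open ≤-Reasoning
  N = m + k + s
  s+k≤N : s + k ≤ N
  s+k≤N = ≤-trans (≤-reflexive (+-comm s k)) (+-monoˡ-≤ s (m≤n+m k m))
  Ψk : ∏ N (λ d → Λ d ^ χ (d ≤? k)) ≡ Ψ k
  Ψk = trans (∏-extend _ (≤-trans (m≤n+m k m) (m≤m+n (m + k) s)) (λ d l _ → cong (Λ d ^_) (χ-no (d ≤? k) (<⇒≱ l))))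
    (∏-cong k λ d _ l → trans (cong (Λ d ^_) (χ-yes (d ≤? k) l)) (*-identityʳ (Λ d)))
  pos : ∀ d x → 1 ≤ Λ d ^ x
  pos d x = 1≤^ x (Λ≥1 d)
  pt : ∀ d → 1 ≤ d → Λ d ^ carry m k d ≤ Λ d ^ carry s k d * Λ d ^ χ (d ≤? k) * Λ d ^ nonprime d
  pt d 1≤d = go (d ≤? k) (prime? d)
    where
    go : Dec (d ≤ k) → Dec (Prime d) → Λ d ^ carry m k d ≤ Λ d ^ carry s k d * Λ d ^ χ (d ≤? k) * Λ d ^ nonprime d
    go (yes l) _ = ≤-trans (Λ^-mono d (carry≤1 m k d 1≤d)) (≤-trans (≤-reflexive (sym (*-identityˡ (Λ d ^ 1))))
          (≤-trans (*-monoˡ-≤ (Λ d ^ 1) (pos d (carry s k d))) (≤-trans (≤-reflexive (sym (*-identityʳ _))) (*-mono-≤ (*-monoʳ-≤ (Λ d ^ carry s k d) (Λ^-mono d (≤-reflexive (sym (χ-yes (d ≤? k) l))))) (pos d (nonprime d))))))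
    go (no g) (no np) = ≤-trans (Λ^-mono d (carry≤1 m k d 1≤d)) (≤-trans (≤-reflexive (sym (*-identityˡ (Λ d ^ 1))))
          (*-mono-≤ (*-mono-≤ (pos d (carry s k d)) (pos d (χ (d ≤? k)))) (Λ^-mono d (≤-reflexive (sym (χ-yes (¬? (prime? d)) np))))))
    go (no g) (yes pp) = ≤-trans (Λ^-mono d le) (≤-trans (≤-reflexive (sym (trans (*-identityʳ _) (*-identityʳ _)))) (*-mono-≤ (*-monoʳ-≤ (Λ d ^ carry s k d) (pos d (χ (d ≤? k)))) (pos d (nonprime d))))
      where
      k<d = ≰⇒> g
      le : carry m k d ≤ carry s k d
      le with carry m k d ≟ 0
      ... | yes z = ≤-trans (≤-reflexive z) z≤n
      ... | no nz with carry⇒window {m} {k} {d} 1≤d k<d (n≢0⇒n>0 nz)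
      ...   | i , 1≤i , i≤k , dv = ≤-trans (carry≤1 m k d 1≤d) (m<n⇒0<n∸m
              (≤-trans (s≤s (≤-reflexive (trans (cong (s ÷ d +_) (<⇒÷≡0 k<d)) (+-identityʳ _))))
                (≤-÷ {suc (s ÷ d)} 1≤d (≤-trans (stuck⇒carry st pp k<d (<-≤-trans <k² (*-mono-≤ k<d k<d)) 1≤i i≤k dv) (+-monoʳ-≤ s (m∸n≤m k i))))))

-- At M = t (t + 1) k these specs give ((t+1)k)! and (tk)! k!, balanced by 1/t = 1/(t+1) +
-- 1/(t(t+1)). So `factorial-estimate` also yields C((t+1)k, k) = ((t+1)^(t+1) / t^t)^k up to a
-- factor M^3.
binν binμ : ℕ → Spec
binν t = (t , 1) ∷ []
binμ t = (suc t , 1) ∷ (suc t * t , 1) ∷ []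

*÷′ : ∀ q {n p} → 1 ≤ p → n ≡ q * p → n ÷ p ≡ q
*÷′ q {p = p} h refl = *÷ q p h

module Central (t k : ℕ) (1≤t : 1 ≤ t) (1≤k : 1 ≤ k) where
  M = suc t * t * k
  L = suc t * t
  1≤L : 1 ≤ L
  1≤L = *-mono-≤ {1} {suc t} (s≤s z≤n) 1≤t
  dν : Divides L (binν t)
  dν = (1≤t , n∣m*n (suc t)) ∷ []
  dμ : Divides L (binμ t)
  dμ = (s≤s z≤n , m∣m*n t) ∷ (1≤L , ∣-refl) ∷ []
  e₁ : L ÷ t ≡ suc t
  e₁ = *÷′ (suc t) 1≤t refl
  e₂ : L ÷ suc t ≡ t
  e₂ = *÷′ t (s≤s z≤n) (*-comm (suc t) t)
  e₃ : L ÷ L ≡ 1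
  e₃ = *÷′ 1 1≤L (sym (*-identityˡ L))
  bal : weight L (binν t) ≡ weight L (binμ t)
  bal = trans (cong (λ z → z * 1 + 0) e₁) (trans (s t) (sym (cong₂ (λ y z → y * 1 + (z * 1 + 0)) e₂ e₃)))
    where
    s : ∀ t → (1 + t) * 1 + 0 ≡ t * 1 + (1 * 1 + 0)
    s = solve-∀
  1≤M : 1 ≤ M
  1≤M = *-mono-≤ 1≤L 1≤k
  f₁ : M ÷ t ≡ t * k + k
  f₁ = *÷′ (t * k + k) 1≤t (s t k)
    where
    s : ∀ t k → (1 + t) * t * k ≡ (t * k + k) * t
    s = solve-∀
  f₂ : M ÷ suc t ≡ t * k
  f₂ = *÷′ (t * k) (s≤s z≤n) (s t k)
    where
    s : ∀ t k → (1 + t) * t * k ≡ t * k * (1 + t)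
    s = solve-∀
  f₃ : M ÷ L ≡ k
  f₃ = *÷′ k 1≤L (*-comm L k)
  yν : yprod M (binν t) ≡ (t * k + k) ! * t ^ (t * k + k)
  yν = trans (*-identityʳ _) (trans (*-identityʳ _) (cong (λ z → z ! * t ^ z) f₁))
  yμ : yprod M (binμ t) ≡ ((t * k) ! * suc t ^ (t * k)) * (k ! * (suc t * t) ^ k)
  yμ = trans (cong₂ (λ x y → (x ! * suc t ^ x) ^ 1 * ((y ! * (suc t * t) ^ y) ^ 1 * 1)) f₂ f₃)
         (cong₂ _*_ (*-identityʳ ((t * k) ! * suc t ^ (t * k))) (trans (*-identityʳ ((k ! * (suc t * t) ^ k) ^ 1)) (*-identityʳ (k ! * (suc t * t) ^ k))))
  F = (t * k) ! * k !
  pow : suc t ^ (t * k) * (suc t * t) ^ k ≡ (suc t ^ suc t) ^ k * t ^ k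
  pow = trans (cong (suc t ^ (t * k) *_) (*-^ (suc t) t k)) (trans (sym (*-assoc (suc t ^ (t * k)) (suc t ^ k) (t ^ k)))
    (cong (_* t ^ k) (trans (sym (^-distribˡ-+-* (suc t) (t * k) k)) (trans (cong (suc t ^_) (+-comm (t * k) k)) (sym (^-*-assoc (suc t) (suc t) k))))))
  tpow : t ^ (t * k + k) ≡ (t ^ t) ^ k * t ^ k
  tpow = trans (^-distribˡ-+-* t (t * k) k) (cong (_* t ^ k) (sym (^-*-assoc t t k)))
  yμ′ : yprod M (binμ t) ≡ F * t ^ k * (suc t ^ suc t) ^ k
  yμ′ = trans yμ (trans (*-swap₄ ((t * k) !) (suc t ^ (t * k)) (k !) ((suc t * t) ^ k)) (trans (cong (F *_) pow)
    (trans (cong (F *_) (*-comm ((suc t ^ suc t) ^ k) (t ^ k))) (sym (*-assoc F (t ^ k) _)))))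
  yν′ : yprod M (binν t) ≡ F * t ^ k * (bin (t * k) k * (t ^ t) ^ k)
  yν′ = trans yν (trans (cong₂ _*_ (sym (bin-! (t * k) k)) tpow) (s (bin (t * k) k) F ((t ^ t) ^ k) (t ^ k)))
    where
    s : ∀ b f x y → b * f * (x * y) ≡ f * y * (b * x)
    s = solve-∀
  1≤Ft : 1 ≤ F * t ^ k
  1≤Ft = *-mono-≤ (*-mono-≤ (n!≥1 (t * k)) (n!≥1 k)) (1≤^ k 1≤t)

  bin-lower : (suc t ^ suc t) ^ k ≤ bin (t * k) k * (t ^ t) ^ k * M ^ 3
  bin-lower = *-cancelˡ-≤′ _ _ 1≤Ft (≤-trans (≤-reflexive (sym yμ′))
    (≤-trans (factorial-estimate M L (binν t) (binμ t) 1≤M 1≤L dν dμ bal)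
      (≤-reflexive (trans (cong (_* M ^ 3) yν′) (*-assoc (F * t ^ k) _ (M ^ 3))))))

  bin-upper : bin (t * k) k * (t ^ t) ^ k ≤ (suc t ^ suc t) ^ k * M ^ 3
  bin-upper = *-cancelˡ-≤′ _ _ 1≤Ft (≤-trans (≤-reflexive (sym yν′))
    (≤-trans (factorial-estimate M L (binμ t) (binν t) 1≤M 1≤L dμ dν (sym bal))
      (≤-reflexive (trans (cong (_* M ^ 3) yμ′) (*-assoc (F * t ^ k) _ (M ^ 3))))))

-- n ≥ 9k

prime-in-window : ∀ {m k s p} → Stuck m k s → s < 2 * k → Prime p → m < p → p ≤ m + k → 3 * k ≤ p → ⊥
prime-in-window {m} {k} {s} {p} st s<2k pp m<p p≤n 3k≤p = <⇒≱
  (stuck⇒<3k {i = p ∸ m} st s<2k pp (m<n⇒0<n∸m m<p) (m≤n+o⇒m∸n≤o p m p≤n) (subst (p ∣_) (sym (m+[n∸m]≡n (<⇒≤ m<p))) ∣-refl)) 3k≤p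

-- C(n,k) is at least C((t+1)k, k), and C(s+k, k) is at most C(3k, k). So per unit of k the number
-- (t+1)^(t+1)/t^t competes with (27/4) · 2^(41/25), the last factor being the cost of Ψ(k). δ is
-- the certified surplus in units of 1/25 bit, and the terms of lower order have to pay for it: E
-- bounds the constants, e linearises log k, and 82 r is the cost of Ψ(r)².
chunk : ∀ t δ E e {m k s} r → 1 ≤ t → 1 ≤ k → Stuck m k s → s < 2 * k → t * k ≤ m →
  m + k + s < suc r * suc r → m + k + s < suc k * suc k →
  (t ^ t * 3 ^ 3) ^ 25 * 2 ^ (41 + δ) ≤ (suc t ^ suc t * 2 ^ 2) ^ 25 → (suc t * t * 6) ^ 75 ≤ 2 ^ E →
  δ * k ≤ E + (e + k ÷ 2 ^ e) * 150 + 82 * r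
chunk t δ E e {m} {k} {s} r 1≤t 1≤k st s<2k tk≤m <r² <k² hA hE = 2^-cancel-≤ (*-cancelˡ-≤′ _ _ pos (begin
  (Z ^ 25) ^ k * 2 ^ (41 * k) * 2 ^ (δ * k)
    ≡⟨ trans (*-assoc ((Z ^ 25) ^ k) _ _) (trans (cong ((Z ^ 25) ^ k *_) (trans (sym (^-distribˡ-+-* 2 (41 * k) (δ * k))) (trans (cong (2 ^_) (sym (*-distribʳ-+ k 41 δ))) (sym (^-*-assoc 2 (41 + δ) k))))) (sym (*-^ (Z ^ 25) (2 ^ (41 + δ)) k))) ⟩
  (Z ^ 25 * 2 ^ (41 + δ)) ^ k                ≤⟨ ^-monoˡ-≤ k hA ⟩
  ((A * 2 ^ 2) ^ 25) ^ k                     ≡⟨ ^-^-comm (A * 2 ^ 2) 25 k ⟩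
  ((A * 2 ^ 2) ^ k) ^ 25                     ≤⟨ ^-monoˡ-≤ 25 main ⟩
  (Z ^ k * (M₁ ^ 3 * M₂ ^ 3) * Ψ k * (Ψ r * Ψ r)) ^ 25
    ≡⟨ trans (*-^ (Z ^ k * (M₁ ^ 3 * M₂ ^ 3) * Ψ k) (Ψ r * Ψ r) 25) (cong₂ _*_ (trans (*-^ (Z ^ k * (M₁ ^ 3 * M₂ ^ 3)) (Ψ k) 25) (cong (_* Ψ k ^ 25) (*-^ (Z ^ k) (M₁ ^ 3 * M₂ ^ 3) 25))) (*-^ (Ψ r) (Ψ r) 25)) ⟩
  (Z ^ k) ^ 25 * (M₁ ^ 3 * M₂ ^ 3) ^ 25 * Ψ k ^ 25 * (Ψ r ^ 25 * Ψ r ^ 25)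
    ≤⟨ *-mono-≤ (*-mono-≤ (*-monoʳ-≤ ((Z ^ k) ^ 25) M≤) (Ψ-bound k)) (*≤2^ {a = 41 * r} (Ψ-bound r) (Ψ-bound r)) ⟩
  (Z ^ k) ^ 25 * 2 ^ (E + (e + k ÷ 2 ^ e) * 150) * 2 ^ (41 * k) * 2 ^ (41 * r + 41 * r)
    ≡⟨ cong₂ (λ x y → x * 2 ^ (E + (e + k ÷ 2 ^ e) * 150) * 2 ^ (41 * k) * 2 ^ y) (^-^-comm Z k 25) (s₁ r) ⟩
  (Z ^ 25) ^ k * 2 ^ (E + (e + k ÷ 2 ^ e) * 150) * 2 ^ (41 * k) * 2 ^ (82 * r)
    ≡⟨ s₂ ((Z ^ 25) ^ k) (2 ^ (E + (e + k ÷ 2 ^ e) * 150)) (2 ^ (41 * k)) (2 ^ (82 * r)) ⟩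
  (Z ^ 25) ^ k * 2 ^ (41 * k) * (2 ^ (E + (e + k ÷ 2 ^ e) * 150) * 2 ^ (82 * r))
    ≡⟨ cong ((Z ^ 25) ^ k * 2 ^ (41 * k) *_) (sym (^-distribˡ-+-* 2 (E + (e + k ÷ 2 ^ e) * 150) (82 * r))) ⟩
  (Z ^ 25) ^ k * 2 ^ (41 * k) * 2 ^ (E + (e + k ÷ 2 ^ e) * 150 + 82 * r) ∎))
  where
  open ≤-Reasoning
  Z = t ^ t * 3 ^ 3
  A = suc t ^ suc t
  M₁ = suc t * t * k
  M₂ = 3 * 2 * k
  ^-^-comm : ∀ x a b → (x ^ a) ^ b ≡ (x ^ b) ^ a
  ^-^-comm x a b = trans (^-*-assoc x a b) (trans (cong (x ^_) (*-comm a b)) (sym (^-*-assoc x b a)))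
  pos : 1 ≤ (Z ^ 25) ^ k * 2 ^ (41 * k)
  pos = *-mono-≤ (1≤^ k (1≤^ 25 (*-mono-≤ (1≤^ t 1≤t) (1≤^ {3} 3 (s≤s z≤n))))) (1≤^ (41 * k) (s≤s z≤n))
  s₁ : ∀ r → 41 * r + 41 * r ≡ 82 * r
  s₁ r = sym (*-distribʳ-+ r 41 41)
  s₂ : ∀ a b c d → a * b * c * d ≡ a * c * (b * d)
  s₂ = solve-∀
  b₁≤ : bin (t * k) k ≤ bin (2 * k) k * Ψ k * (Ψ r * Ψ r)
  b₁≤ = ≤-trans (bin-monoˡ k tk≤m) (≤-trans (stuck-bin≤ m k s r st 1≤k <r² <k²)
    (*-monoˡ-≤ (Ψ r * Ψ r) (*-monoˡ-≤ (Ψ k) (bin-monoˡ k (<⇒≤ s<2k)))))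
  main : (A * 2 ^ 2) ^ k ≤ Z ^ k * (M₁ ^ 3 * M₂ ^ 3) * Ψ k * (Ψ r * Ψ r)
  main = begin
    (A * 2 ^ 2) ^ k                                   ≡⟨ *-^ A (2 ^ 2) k ⟩
    A ^ k * (2 ^ 2) ^ k                               ≤⟨ *-monoˡ-≤ ((2 ^ 2) ^ k) (≤-trans (Central.bin-lower t k 1≤t 1≤k) (*-monoˡ-≤ (M₁ ^ 3) (*-monoˡ-≤ ((t ^ t) ^ k) b₁≤))) ⟩
    bin (2 * k) k * Ψ k * (Ψ r * Ψ r) * (t ^ t) ^ k * M₁ ^ 3 * (2 ^ 2) ^ k
      ≡⟨ s₃ (bin (2 * k) k) (Ψ k) (Ψ r * Ψ r) ((t ^ t) ^ k) (M₁ ^ 3) ((2 ^ 2) ^ k) ⟩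
    bin (2 * k) k * (2 ^ 2) ^ k * ((t ^ t) ^ k * M₁ ^ 3 * (Ψ k * (Ψ r * Ψ r)))
      ≤⟨ *-monoˡ-≤ ((t ^ t) ^ k * M₁ ^ 3 * (Ψ k * (Ψ r * Ψ r))) (Central.bin-upper 2 k (s≤s z≤n) 1≤k) ⟩
    (3 ^ 3) ^ k * M₂ ^ 3 * ((t ^ t) ^ k * M₁ ^ 3 * (Ψ k * (Ψ r * Ψ r)))
      ≡⟨ s₄ ((3 ^ 3) ^ k) (M₂ ^ 3) ((t ^ t) ^ k) (M₁ ^ 3) (Ψ k) (Ψ r * Ψ r) ⟩
    (t ^ t) ^ k * (3 ^ 3) ^ k * (M₁ ^ 3 * M₂ ^ 3) * Ψ k * (Ψ r * Ψ r)
      ≡⟨ cong (λ z → z * (M₁ ^ 3 * M₂ ^ 3) * Ψ k * (Ψ r * Ψ r)) (sym (*-^ (t ^ t) (3 ^ 3) k)) ⟩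
    Z ^ k * (M₁ ^ 3 * M₂ ^ 3) * Ψ k * (Ψ r * Ψ r)     ∎
    where
    s₃ : ∀ b p q x m f → b * p * q * x * m * f ≡ b * f * (x * m * (p * q))
    s₃ = solve-∀
    s₄ : ∀ f m₂ x m₁ p q → f * m₂ * (x * m₁ * (p * q)) ≡ x * f * (m₁ * m₂) * p * q
    s₄ = solve-∀
  M≤ : (M₁ ^ 3 * M₂ ^ 3) ^ 25 ≤ 2 ^ (E + (e + k ÷ 2 ^ e) * 150)
  M≤ = ≤-trans (≤-reflexive eq) (*≤2^ {a = E} hE (pow≤2^ {k} {e + k ÷ 2 ^ e} 150 (n≤2^ k e)))
    where
    s₅ : ∀ t k → suc t * t * k * (3 * 2 * k) ≡ suc t * t * 6 * (k * k)
    s₅ = solve-∀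
    eq : (M₁ ^ 3 * M₂ ^ 3) ^ 25 ≡ (suc t * t * 6) ^ 75 * k ^ 150
    eq = trans (cong (_^ 25) (sym (*-^ M₁ M₂ 3))) (trans (^-*-assoc (M₁ * M₂) 3 25) (trans (cong (_^ 75) (s₅ t k))
      (trans (*-^ (suc t * t * 6) (k * k) 75) (cong ((suc t * t * 6) ^ 75 *_) (trans (cong (λ z → (k * z) ^ 75) (sym (*-identityʳ k))) (^-*-assoc k 2 75))))))

linear-contradiction : ∀ {k q r} δ K w v P U V X D k₀ → k₀ ≤ k → 1 ≤ P → P * q ≤ k → U * r ≤ V * k + X →
  δ * k ≤ K + q * w + v * r →
  U * w + P * (v * V) + D ≤ δ * (P * U) → P * U * K + P * (v * X) < D * k₀ → ⊥
linear-contradiction {k} {q} {r} δ K w v P U V X D k₀ k₀≤k 1≤P hq hr h hD hC = <⇒≱ hC (≤-trans (*-monoʳ-≤ D k₀≤k)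
  (+-cancelˡ-≤ ((U * w + P * (v * V)) * k) _ _ (begin
    (U * w + P * (v * V)) * k + D * k         ≡⟨ sym (*-distribʳ-+ k (U * w + P * (v * V)) D) ⟩
    (U * w + P * (v * V) + D) * k             ≤⟨ *-monoˡ-≤ k hD ⟩
    δ * (P * U) * k                           ≡⟨ s₁ δ P U k ⟩
    P * U * (δ * k)                           ≤⟨ *-monoʳ-≤ (P * U) h ⟩
    P * U * (K + q * w + v * r)               ≡⟨ s₂ P U K q w v r ⟩
    P * U * K + U * w * (P * q) + P * v * (U * r) ≤⟨ +-mono-≤ (+-monoʳ-≤ (P * U * K) (*-monoʳ-≤ (U * w) hq)) (*-monoʳ-≤ (P * v) hr) ⟩
    P * U * K + U * w * k + P * v * (V * k + X) ≡⟨ s₃ P U K w k v V X ⟩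
    (U * w + P * (v * V)) * k + (P * U * K + P * (v * X)) ∎)))
  where
  open ≤-Reasoning
  s₁ : ∀ δ P U k → δ * (P * U) * k ≡ P * U * (δ * k)
  s₁ = solve-∀
  s₂ : ∀ P U K q w v r → P * U * (K + q * w + v * r) ≡ P * U * K + U * w * (P * q) + P * v * (U * r)
  s₂ = solve-∀
  s₃ : ∀ P U K w k v V X → P * U * K + U * w * k + P * v * (V * k + X) ≡ (U * w + P * (v * V)) * k + (P * U * K + P * (v * X))
  s₃ = solve-∀

sqrt-bound : ∀ {r x} R → r * r ≤ x → 2 * R * r ≤ x + R * R
sqrt-bound {r} {x} R h = ≤-trans (≤-reflexive (s R r)) (≤-trans (am-gm r R) (+-monoˡ-≤ (R * R) h))
  where
  s : ∀ R r → 2 * R * r ≡ 2 * (r * R)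
  s = solve-∀

K-split : ∀ E e q w v r → E + (e + q) * w + v * r ≡ E + e * w + q * w + v * r
K-split = solve-∀

chunk-⊥ : ∀ t δ E e U V X D k₀ {m k s} r → k₀ ≤ k → 1 ≤ t → 1 ≤ k → Stuck m k s → s < 2 * k → t * k ≤ m →
  m + k + s < suc r * suc r → m + k + s < suc k * suc k → U * r ≤ V * k + X →
  (t ^ t * 3 ^ 3) ^ 25 * 2 ^ (41 + δ) ≤ (suc t ^ suc t * 2 ^ 2) ^ 25 → (suc t * t * 6) ^ 75 ≤ 2 ^ E →
  U * 150 + 2 ^ e * (82 * V) + D ≤ δ * (2 ^ e * U) → 2 ^ e * U * (E + e * 150) + 2 ^ e * (82 * X) < D * k₀ → ⊥
chunk-⊥ t δ E e U V X D k₀ {m} {k} r k₀≤k 1≤t 1≤k st s<2k tk≤m <r² <k² hr hA hE hD hC =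
  linear-contradiction {k} {k ÷ 2 ^ e} {r} δ (E + e * 150) 150 82 (2 ^ e) U V X D k₀ k₀≤k (1≤^ e (s≤s z≤n))
    (subst (_≤ k) (*-comm (k ÷ 2 ^ e) (2 ^ e)) (÷*≤ k (2 ^ e))) hr
    (subst (δ * k ≤_) (K-split E e (k ÷ 2 ^ e) 150 82 r) (chunk t δ E e r 1≤t 1≤k st s<2k tk≤m <r² <k² hA hE)) hD hC

-- t = 8, 19 and 99 belong to n ≥ 9k, 20k and 100k. For t = 8 the surplus is only 3, which is why
-- that range starts at k = 20000.
ca-A : (8 ^ 8 * 3 ^ 3) ^ 25 * 2 ^ 44 ≤ (9 ^ 9 * 2 ^ 2) ^ 25
ca-A = ≤! ((8 ^ 8 * 3 ^ 3) ^ 25 * 2 ^ 44) ((9 ^ 9 * 2 ^ 2) ^ 25) refl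
ca-E : (9 * 8 * 6) ^ 75 ≤ 2 ^ 657
ca-E = ≤! ((9 * 8 * 6) ^ 75) (2 ^ 657) refl
cb-A : (19 ^ 19 * 3 ^ 3) ^ 25 * 2 ^ 74 ≤ (20 ^ 20 * 2 ^ 2) ^ 25
cb-A = ≤! ((19 ^ 19 * 3 ^ 3) ^ 25 * 2 ^ 74) ((20 ^ 20 * 2 ^ 2) ^ 25) refl
cb-E : (20 * 19 * 6) ^ 75 ≤ 2 ^ 837
cb-E = ≤! ((20 * 19 * 6) ^ 75) (2 ^ 837) refl
cc-A : (99 ^ 99 * 3 ^ 3) ^ 25 * 2 ^ 133 ≤ (100 ^ 100 * 2 ^ 2) ^ 25
cc-A = ≤! ((99 ^ 99 * 3 ^ 3) ^ 25 * 2 ^ 133) ((100 ^ 100 * 2 ^ 2) ^ 25) refl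
cc-E : (100 * 99 * 6) ^ 75 ≤ 2 ^ 1190
cc-E = ≤! ((100 * 99 * 6) ^ 75) (2 ^ 1190) refl

small-sq : ∀ {x k c} → x < c * k → c ≤ k → x < suc k * suc k
small-sq {x} {k} {c} h l = <-≤-trans h (≤-trans (*-monoˡ-≤ k l) (*-mono-≤ (n≤1+n k) (n≤1+n k)))

n+s< : ∀ {n s k} c → n < c * k → s < 2 * k → n + s < (c + 2) * k
n+s< {k = k} c a b = <-≤-trans (+-mono-< a b) (≤-reflexive (sym (*-distribʳ-+ k c 2)))

t*k≤ : ∀ {m k} t → suc t * k ≤ m + k → t * k ≤ m
t*k≤ {m} {k} t h = +-cancelʳ-≤ k (t * k) m (subst (_≤ m + k) (+-comm k (t * k)) h)

stuck-9-20 : ∀ {m k s} → 20000 ≤ k → Stuck m k s → s < 2 * k → 9 * k ≤ m + k → m + k < 20 * k → ⊥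
stuck-9-20 {m} {k} {s} hk st s<2k lo hi with isqrt (m + k + s)
-- 660 is close to √(22 · 20000), which makes the bound 2 · 660 r ≤ 22k + 660² nearly sharp where
-- the range begins.
... | r , r²≤ , <r² = chunk-⊥ 8 3 657 14 (2 * 660) 22 (660 * 660) (3 * (2 ^ 14 * 1320) ∸ (1320 * 150 + 2 ^ 14 * (82 * 22))) 20000 r hk
      (s≤s z≤n) (≤-trans (≤! 1 20000 refl) hk) st s<2k (t*k≤ 8 lo) <r² (small-sq {m + k + s} {k} {22} n+s<22k (≤-trans (≤! 22 20000 refl) hk))
      (sqrt-bound {r} 660 (≤-trans r²≤ (<⇒≤ n+s<22k))) ca-A ca-E (≤! _ _ refl) (<! _ _ refl)
  where
  n+s<22k : m + k + s < 22 * k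
  n+s<22k = n+s< {m + k} {s} {k} 20 hi s<2k

stuck-20-100 : ∀ {m k s} → 850 ≤ k → Stuck m k s → s < 2 * k → 20 * k ≤ m + k → m + k < 100 * k → ⊥
stuck-20-100 {m} {k} {s} hk st s<2k lo hi with isqrt (m + k + s)
... | r , r²≤ , <r² = chunk-⊥ 19 33 837 10 (2 * 294) 102 (294 * 294) (33 * (2 ^ 10 * 588) ∸ (588 * 150 + 2 ^ 10 * (82 * 102))) 850 r hk
      (s≤s z≤n) (≤-trans (≤! 1 850 refl) hk) st s<2k (t*k≤ 19 lo) <r² (small-sq {m + k + s} {k} {102} n+s<102k (≤-trans (≤! 102 850 refl) hk))
      (sqrt-bound {r} 294 (≤-trans r²≤ (<⇒≤ n+s<102k))) cb-A cb-E (≤! _ _ refl) (<! _ _ refl)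
  where
  n+s<102k : m + k + s < 102 * k
  n+s<102k = n+s< {m + k} {s} {k} 100 hi s<2k

stuck-100-k² : ∀ {m k s} → 850 ≤ k → Stuck m k s → s < 2 * k → 100 * k ≤ m + k → m + k ≤ k * k → ⊥
stuck-100-k² {m} {k} {s} hk st s<2k lo hi with isqrt (m + k + s)
-- No quadratic mean is needed here: r ≤ k, and the surplus 92 beats the cost 82 of Ψ(r)² with room
-- for log k.
... | r , r²≤ , <r² = chunk-⊥ 99 92 1190 10 1 1 0 (92 * (2 ^ 10 * 1) ∸ (1 * 150 + 2 ^ 10 * (82 * 1))) 850 r hk
      (s≤s z≤n) (≤-trans (≤! 1 850 refl) hk) st s<2k (t*k≤ 99 lo) <r² <k²
      (≤-trans (≤-reflexive (*-identityˡ r)) (≤-trans r≤k (≤-reflexive (trans (sym (*-identityˡ k)) (sym (+-identityʳ (1 * k)))))))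
      cc-A cc-E (≤! _ _ refl) (<! _ _ refl)
  where
  s₁ : ∀ k → 1 + (k * k + 2 * k) ≡ suc k * suc k
  s₁ = solve-∀
  <k² : m + k + s < suc k * suc k
  <k² = subst (suc (m + k + s) ≤_) (s₁ k) (s≤s (+-mono-≤ hi (<⇒≤ s<2k)))
  r≤k : r ≤ k
  r≤k = ≮⇒≥ λ l → <⇒≱ (<-≤-trans <k² (*-mono-≤ l l)) r²≤

-- Binomial coefficients against the number of small primes

power-count : ∀ q n → 1 ≤ n → Prime q → ∃ λ a → ∏ n (λ d → q ^ χ (Λ d ≟ q)) ≡ q ^ a × q ^ a ≤ n × n < q ^ suc a
power-count q (suc zero) _ pq = 0 , trans (*-identityˡ _) (cong (q ^_) (χ-no (1 ≟ q) (<⇒≢ (prime≥2 pq)))) , ≤-refl ,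
  ≤-trans (prime≥2 pq) (≤-reflexive (sym (*-identityʳ q)))
power-count q (suc n@(suc _)) _ pq with power-count q n (s≤s z≤n) pq
... | a , e , l , u with Λ (suc n) ≟ q
...   | no ne = a , trans (cong₂ _*_ e (cong (q ^_) (χ-no (Λ (suc n) ≟ q) ne))) (*-identityʳ (q ^ a)) , m≤n⇒m≤1+n l ,
          ≤∧≢⇒< u (λ x → ne (trans (cong Λ x) (Λ-power a pq)))
...   | yes eq with Λ-view (suc n)
...     | unit e′ = ⊥-elim (<⇒≢ (prime≥2 pq) (trans (sym e′) eq))
...     | power p b pp e₁ e₂ with trans (sym e₂) eq
...       | refl = suc a , trans (cong₂ _*_ e (cong (q ^_) (χ-yes (Λ (suc n) ≟ q) eq))) (trans (cong (q ^ a *_) (*-identityʳ q)) (*-comm (q ^ a) q)) ,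
            ≤-reflexive qa≡ , subst (_< q * q ^ suc a) qa≡ (subst (q ^ suc a <_) (*-comm (q ^ suc a) q) (m<m*n (q ^ suc a) q {{m^n≢0 q (suc a) {{prime⇒nonZero pq}}}} (prime≥2 pq)))
  where
  a≤b : a ≤ b
  a≤b = ≮⇒≥ λ b<a → <⇒≱ (s≤s l) (subst (_≤ q ^ a) (sym e₁) (^-monoʳ-≤ q {{prime⇒nonZero pq}} b<a))
  b≤a : b ≤ a
  b≤a = ≮⇒≥ λ a<b → <⇒≱ (^-monoʳ-< q (prime≥2 pq) (s≤s a<b)) (subst (_≤ q ^ suc a) e₁ u)
  qa≡ : q ^ suc a ≡ suc n
  qa≡ = trans (cong (λ z → q ^ suc z) (≤-antisym a≤b b≤a)) (sym e₁)

power-count-≤ : ∀ q n → 1 ≤ n → ∏ n (λ d → q ^ χ (Λ d ≟ q)) ≤ n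
power-count-≤ q n 1≤n with prime? q
... | yes pq with power-count q n 1≤n pq
...   | a , e , l , _ = subst (_≤ n) (sym e) l
power-count-≤ q n 1≤n | no nq = ≤-trans (≤-reflexive (trans (∏-cong n λ d _ _ → one d) (∏-1 n))) 1≤n
  where
  one : ∀ d → q ^ χ (Λ d ≟ q) ≡ 1
  one d with q ≟ 1
  ... | yes refl = ^-zeroˡ (χ (Λ d ≟ 1))
  ... | no q≢1 = cong (q ^_) (χ-no (Λ d ≟ q) ne)
    where
    ne : ¬ Λ d ≡ q
    ne e with Λ-view d
    ... | unit e′ = q≢1 (trans (sym e) e′)
    ... | power p b pp _ e′ = nq (subst Prime (trans (sym e′) e) pp)

-- `full Q` pays for all powers of the primes in Q, which costs at most n for each of them; `once B`
-- pays for the first power only, which costs the prime itself.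
full once : List ℕ → ℕ → ℕ
full []      d = 1
full (q ∷ Q) d = q ^ χ (Λ d ≟ q) * full Q d
once []      d = 1
once (b ∷ B) d = b ^ χ (d ≟ b) * once B d

∏-full : ∀ n Q → 1 ≤ n → ∏ n (full Q) ≤ n ^ length Q
∏-full n []      _   = ≤-reflexive (∏-1 n)
∏-full n (q ∷ Q) 1≤n = ≤-trans (≤-reflexive (∏-* n _ _)) (*-mono-≤ (power-count-≤ q n 1≤n) (∏-full n Q 1≤n))

∏-once : ∀ n B → All (1 ≤_) B → ∏ n (once B) ≤ product B
∏-once n []      _        = ≤-reflexive (∏-1 n)
∏-once n (b ∷ B) (h ∷ hs) = ≤-trans (≤-reflexive (∏-* n _ _)) (*-mono-≤ (∏-δ-≤ n b b h h) (∏-once n B hs))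

full≥1 : ∀ Q d → All (1 ≤_) Q → 1 ≤ full Q d
full≥1 []      d _        = ≤-refl
full≥1 (q ∷ Q) d (h ∷ hs) = *-mono-≤ (1≤^ (χ (Λ d ≟ q)) h) (full≥1 Q d hs)

once≥1 : ∀ B d → All (1 ≤_) B → 1 ≤ once B d
once≥1 []      d _        = ≤-refl
once≥1 (q ∷ Q) d (h ∷ hs) = *-mono-≤ (1≤^ (χ (d ≟ q)) h) (once≥1 Q d hs)

x≤x*y : ∀ x {y} → 1 ≤ y → x ≤ x * y
x≤x*y x h = ≤-trans (≤-reflexive (sym (*-identityʳ x))) (*-monoʳ-≤ x h)

x≤y*x : ∀ x {y} → 1 ≤ y → x ≤ y * x
x≤y*x x h = ≤-trans (≤-reflexive (sym (*-identityˡ x))) (*-monoˡ-≤ x h)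

∈-full : ∀ {Q d p} → All (1 ≤_) Q → p ∈ Q → Λ d ≡ p → p ≤ full Q d
∈-full {q ∷ Q} {d} (h ∷ hs) (here refl) e = ≤-trans (≤-reflexive (sym (trans (cong (q ^_) (χ-yes (Λ d ≟ q) e)) (*-identityʳ q)))) (x≤x*y _ (full≥1 Q d hs))
∈-full {q ∷ Q} {d} (h ∷ hs) (there m) e = ≤-trans (∈-full hs m e) (x≤y*x _ (1≤^ (χ (Λ d ≟ q)) h))

∈-once : ∀ {B d} → All (1 ≤_) B → d ∈ B → d ≤ once B d
∈-once {q ∷ Q} {d} (h ∷ hs) (here refl) = ≤-trans (≤-reflexive (sym (trans (cong (q ^_) (χ-yes (d ≟ q) refl)) (*-identityʳ q)))) (x≤x*y _ (once≥1 Q d hs))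
∈-once {q ∷ Q} {d} (h ∷ hs) (there m) = ≤-trans (∈-once hs m) (x≤y*x _ (1≤^ (χ (d ≟ q)) h))

bin≤^length : ∀ m k Q B → 1 ≤ m + k → All (1 ≤_) Q → All (1 ≤_) B →
  (∀ p a → Prime p → 1 ≤ carry m k (p ^ suc a) → p ∈ Q ⊎ (a ≡ 0 × p ∈ B)) →
  bin m k ≤ (m + k) ^ length Q * product B
bin≤^length m k Q B 1≤n hQ hB h = begin
  bin m k                                ≡⟨ sym (bin-Λ m k n ≤-refl) ⟩
  ∏ n (λ d → Λ d ^ carry m k d)          ≤⟨ ∏-mono n (λ d 1≤d _ → pt d 1≤d (Λ-view d)) ⟩
  ∏ n (λ d → full Q d * once B d)        ≡⟨ ∏-* n _ _ ⟩
  ∏ n (full Q) * ∏ n (once B)            ≤⟨ *-mono-≤ (∏-full n Q 1≤n) (∏-once n B hB) ⟩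
  n ^ length Q * product B               ∎
  where
  open ≤-Reasoning
  n = m + k
  triv : ∀ d → Λ d ^ carry m k d ≡ 1 → Λ d ^ carry m k d ≤ full Q d * once B d
  triv d e = ≤-trans (≤-reflexive e) (*-mono-≤ (full≥1 Q d hQ) (once≥1 B d hB))
  pt : ∀ d → 1 ≤ d → ΛView d → Λ d ^ carry m k d ≤ full Q d * once B d
  pt d 1≤d (unit e) = triv d (trans (cong (_^ carry m k d) e) (^-zeroˡ (carry m k d)))
  pt d 1≤d (power p a pp e eΛ) with carry m k d ≟ 0
  ... | yes z = triv d (cong (Λ d ^_) z)
  ... | no nz with h p a pp (subst (λ z → 1 ≤ carry m k z) e (n≢0⇒n>0 nz))
  ...   | inj₁ p∈ = ≤-trans le (≤-trans (∈-full hQ p∈ eΛ) (x≤x*y _ (once≥1 B d hB)))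
    where
    le : Λ d ^ carry m k d ≤ p
    le = ≤-trans (Λ^-mono d (carry≤1 m k d 1≤d)) (≤-reflexive (trans (*-identityʳ (Λ d)) eΛ))
  ...   | inj₂ (refl , p∈) = ≤-trans le (≤-trans (subst (λ z → z ≤ once B z) (sym (trans e (*-identityʳ p))) (∈-once hB p∈)) (x≤y*x _ (full≥1 Q d hQ)))
    where
    le : Λ d ^ carry m k d ≤ d
    le = ≤-trans (Λ^-mono d (carry≤1 m k d 1≤d)) (≤-reflexive (trans (*-identityʳ (Λ d)) (trans eΛ (sym (trans e (*-identityʳ p))))))

primesTo : ℕ → List ℕ
primesTo zero    = []
primesTo (suc n) = if does (prime? (suc n)) then suc n ∷ primesTo n else primesTo n

primesTo-≥1 : ∀ n → All (1 ≤_) (primesTo n)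
primesTo-≥1 zero = []
primesTo-≥1 (suc n) with does (prime? (suc n))
... | true  = s≤s z≤n ∷ primesTo-≥1 n
... | false = primesTo-≥1 n

does-yes : ∀ {P : Set} (x : Dec P) → P → does x ≡ true
does-yes (yes _) _ = refl
does-yes (no n) p = ⊥-elim (n p)

does-no : ∀ {P : Set} (x : Dec P) → ¬ P → does x ≡ false
does-no (yes p) n = ⊥-elim (n p)
does-no (no _) _ = refl

∈-primesTo : ∀ {p} n → Prime p → p ≤ n → p ∈ primesTo n
∈-primesTo zero pp l = ⊥-elim (<⇒≱ (prime≥1 pp) l)
∈-primesTo {p} (suc n) pp l with m≤n⇒m<n∨m≡n l
... | inj₂ refl = subst (λ b → suc n ∈ (if b then suc n ∷ primesTo n else primesTo n)) (sym (does-yes (prime? (suc n)) pp)) (here refl)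
... | inj₁ (s≤s l′) with does (prime? (suc n))
...   | true  = there (∈-primesTo n pp l′)
...   | false = ∈-primesTo n pp l′

-- all primes meeting the window are at most 3k
stuck-bin≤π : ∀ {m k s} → Stuck m k s → s < 2 * k → 1 ≤ k → bin m k ≤ (m + k) ^ length (primesTo (3 * k))
stuck-bin≤π {m} {k} {s} st s<2k 1≤k = ≤-trans
  (bin≤^length m k (primesTo (3 * k)) [] (≤-trans 1≤k (m≤n+m k m)) (primesTo-≥1 (3 * k)) [] h)
  (≤-reflexive (*-identityʳ _))
  where
  h : ∀ p a → Prime p → 1 ≤ carry m k (p ^ suc a) → p ∈ primesTo (3 * k) ⊎ (a ≡ 0 × p ∈ [])
  h p a pp c with p ≤? k
  ... | yes l = inj₁ (∈-primesTo (3 * k) pp (≤-trans l (m≤n*m k 3)))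
  ... | no g with carry⇒window {m} {k} {p ^ suc a} (1≤^ (suc a) (prime≥1 pp)) (<-≤-trans (≰⇒> g) (≤-trans (≤-reflexive (sym (*-identityʳ p))) (*-monoʳ-≤ p (1≤^ a (prime≥1 pp))))) c
  ...   | i , 1≤i , i≤k , d = inj₁ (∈-primesTo (3 * k) pp (<⇒≤ (stuck⇒<3k st s<2k pp 1≤i i≤k (∣-trans (m∣m*n (p ^ a)) d))))

-- There are at most y primes up to y, and each prime between y and x contributes at least y to
-- Ψ(x).
^length-Ψ : ∀ y x → y ≤ x → y ^ length (primesTo x) ≤ y ^ y * Ψ x
^length-Ψ y zero z≤n = ≤-refl
^length-Ψ y (suc x) l with m≤n⇒m<n∨m≡n l
... | inj₂ refl = ≤-trans (^-monoʳ-≤ (suc x) (len (suc x))) (x≤x*y _ (Ψ≥1 (suc x)))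
  where
  len : ∀ n → length (primesTo n) ≤ n
  len zero = z≤n
  len (suc n) with does (prime? (suc n))
  ... | true  = s≤s (len n)
  ... | false = m≤n⇒m≤1+n (len n)
... | inj₁ (s≤s y≤x) with prime? (suc x)
...   | yes pp = ≤-trans (*-mono-≤ (m≤n⇒m≤1+n y≤x) (^length-Ψ y x y≤x)) (≤-reflexive
          (trans (s (suc x) (y ^ y) (Ψ x)) (cong (λ z → y ^ y * (Ψ x * z)) (sym (trans (cong Λ (sym (*-identityʳ (suc x)))) (Λ-power 0 pp))))))
  where
  s : ∀ a b c → a * (b * c) ≡ b * (c * a)
  s = solve-∀
...   | no np = ≤-trans (^length-Ψ y x y≤x) (*-monoʳ-≤ (y ^ y) (x≤x*y (Ψ x) (Λ≥1 (suc x))))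

π-large : ∀ x → 151500 ≤ x → 6 * length (primesTo x) ≤ x
π-large x h = ≮⇒≥ λ l → <⇒≱ 2^<y (≤-trans (y≤ l) (≤-reflexive refl))
  where
  -- If π(x) > x/6, the bounds for y^π(x) leave y^(2/15) ≤ 2^(41/25), that is y^10 ≤ 2^123, for
  -- which 5050 = 151500/30 is just too large.
  y = x ÷ 30
  π = length (primesTo x)
  5050≤y : 5050 ≤ y
  5050≤y = ≤-÷ {5050} {x} {30} (s≤s z≤n) h
  2^<y : 2 ^ 123 < y ^ 10
  2^<y = <-≤-trans (<! (2 ^ 123) (5050 ^ 10) refl) (^-monoˡ-≤ 10 5050≤y)
  1≤y : 1 ≤ y
  1≤y = ≤-trans (≤! 1 5050 refl) 5050≤y
  30y≤x : 30 * y ≤ x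
  30y≤x = subst (_≤ x) (*-comm y 30) (÷*≤ x 30)
  nz = >-nonZero 1≤y
  y≤ : x < 6 * π → y ^ 10 ≤ 2 ^ 123
  y≤ l = ^-cancelˡ-≤ (2 * x) (*-mono-≤ {1} {2} (s≤s z≤n) (≤-trans (≤! 1 151500 refl) h)) (*-cancelˡ-≤′ _ _ (1≤^ (5 * x) 1≤y) (begin
    y ^ (5 * x) * (y ^ 10) ^ (2 * x)       ≡⟨ trans (cong (y ^ (5 * x) *_) (^-*-assoc y 10 (2 * x))) (sym (^-distribˡ-+-* y (5 * x) (10 * (2 * x)))) ⟩
    y ^ (5 * x + 10 * (2 * x))             ≤⟨ ^-monoʳ-≤ y {{nz}} (≤-trans (≤-reflexive (s₁ x)) (≤-trans (*-monoʳ-≤ 25 (<⇒≤ l)) (≤-reflexive (s₂ π)))) ⟩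
    y ^ (π * 150)                          ≡⟨ sym (^-*-assoc y π 150) ⟩
    (y ^ π) ^ 150                          ≤⟨ ^-monoˡ-≤ 150 (^length-Ψ y x (÷-≤-self x 30)) ⟩
    (y ^ y * Ψ x) ^ 150                    ≡⟨ trans (*-^ (y ^ y) (Ψ x) 150) (cong₂ _*_ (^-*-assoc y y 150) (sym (^-*-assoc (Ψ x) 25 6))) ⟩
    y ^ (y * 150) * (Ψ x ^ 25) ^ 6         ≤⟨ *-mono-≤ (^-monoʳ-≤ y {{nz}} (≤-trans (≤-reflexive (s₃ y)) (*-monoʳ-≤ 5 30y≤x))) (^-monoˡ-≤ 6 (Ψ-bound x)) ⟩
    y ^ (5 * x) * (2 ^ (41 * x)) ^ 6       ≡⟨ cong (y ^ (5 * x) *_) (trans (^-*-assoc 2 (41 * x) 6) (trans (cong (2 ^_) (s₄ x)) (sym (^-*-assoc 2 123 (2 * x))))) ⟩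
    y ^ (5 * x) * (2 ^ 123) ^ (2 * x)      ∎))
    where
    open ≤-Reasoning
    s₁ : ∀ x → 5 * x + 10 * (2 * x) ≡ 25 * x
    s₁ = solve-∀
    s₂ : ∀ p → 25 * (6 * p) ≡ p * 150
    s₂ = solve-∀
    s₃ : ∀ y → y * 150 ≡ 5 * (30 * y)
    s₃ = solve-∀
    s₄ : ∀ x → 41 * x * 6 ≡ 123 * (2 * x)
    s₄ = solve-∀

noProperDivisor : List ℕ → ℕ → Bool
noProperDivisor []       n = true
noProperDivisor (q ∷ qs) n = if (q <ᵇ n) ∧ does (q ∣? n) then false else noProperDivisor qs n

noProperDivisor-prime : ∀ qs n → Prime n → All (2 ≤_) qs → noProperDivisor qs n ≡ true
noProperDivisor-prime [] n pn _ = refl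
noProperDivisor-prime (q ∷ qs) n pn (a ∷ hs) with q <ᵇ n in e
... | false = noProperDivisor-prime qs n pn hs
... | true  = trans (cong (λ z → if z then false else noProperDivisor qs n) (does-no (q ∣? n) nd)) (noProperDivisor-prime qs n pn hs)
  where
  nd : ¬ q ∣ n
  nd d with prime⇒irreducible pn d
  ... | inj₁ refl = <-irrefl refl a
  ... | inj₂ refl = <-irrefl refl (<ᵇ⇒< q n (≡true⇒T e))

-- Sieving by these keeps every prime and is exact below 37². The composites that survive beyond
-- only enlarge the count, which is harmless in an upper bound for π.
sievePrimes : List ℕ
sievePrimes = 2 ∷ 3 ∷ 5 ∷ 7 ∷ 11 ∷ 13 ∷ 17 ∷ 19 ∷ 23 ∷ 29 ∷ 31 ∷ []

sieveᵇ : ℕ → Bool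
sieveᵇ n = (2 ≤ᵇ n) ∧ noProperDivisor sievePrimes n

sieveᵇ-prime : ∀ n → Prime n → sieveᵇ n ≡ true
sieveᵇ-prime n pn rewrite T⇒≡true (≤⇒≤ᵇ (prime≥2 pn)) = noProperDivisor-prime sievePrimes n pn
  (2≤ 2 ∷ 2≤ 3 ∷ 2≤ 5 ∷ 2≤ 7 ∷ 2≤ 11 ∷ 2≤ 13 ∷ 2≤ 17 ∷ 2≤ 19 ∷ 2≤ 23 ∷ 2≤ 29 ∷ 2≤ 31 ∷ [])
  where
  2≤ : ∀ q {_ : T (2 ≤ᵇ q)} → 2 ≤ q
  2≤ q {a} = ≤ᵇ⇒≤ 2 q a

sieve-step : ℕ → ℕ → ℕ
sieve-step x c = if sieveᵇ (suc x) then suc c else c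

length-primesTo-suc : ∀ n {c} → length (primesTo n) ≤ c → length (primesTo (suc n)) ≤ sieve-step n c
length-primesTo-suc n hc with prime? (suc n)
... | yes pp rewrite sieveᵇ-prime (suc n) pp = s≤s hc
... | no _ with sieveᵇ (suc n)
...   | true  = m≤n⇒m≤1+n hc
...   | false = hc

πloop : ℕ → ℕ → ℕ → Bool
πloop zero    n c = true
πloop (suc f) n c = ((n <ᵇ 2550) ∨ (6 * c ≤ᵇ n)) ∧ πloop f (suc n) (sieve-step n c)

πloop-sound : ∀ f n c → length (primesTo n) ≤ c → T (πloop f n c) → ∀ x → n ≤ x → x < n + f → 2550 ≤ x → 6 * length (primesTo x) ≤ x
πloop-sound zero n c _ _ x a b _ = ⊥-elim (<⇒≱ b (subst (_≤ x) (sym (+-identityʳ n)) a))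
πloop-sound (suc f) n c hc t x a b big with ∧-T {(n <ᵇ 2550) ∨ (6 * c ≤ᵇ n)} t | m≤n⇒m<n∨m≡n a
... | u , v | inj₁ l = πloop-sound f (suc n) (sieve-step n c) (length-primesTo-suc n hc) v x l (subst (x <_) (+-suc n f) b) big
... | u , v | inj₂ refl with Equivalence.to (T-∨ {n <ᵇ 2550}) u
...   | inj₁ w = ⊥-elim (<⇒≱ (<ᵇ⇒< n 2550 w) big)
...   | inj₂ w = ≤-trans (*-monoʳ-≤ 6 hc) (≤ᵇ⇒≤ (6 * c) n w)

πloop-ok : πloop 151501 0 0 ≡ true
πloop-ok = refl

π-small : ∀ x → x < 151501 → 2550 ≤ x → 6 * length (primesTo x) ≤ x
π-small x = πloop-sound 151501 0 0 z≤n (≡true⇒T πloop-ok) x z≤n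

π-bound : ∀ x → 2550 ≤ x → 6 * length (primesTo x) ≤ x
π-bound x h with x <? 151501
... | yes l = π-small x l h
... | no g = π-large x (≤-trans (≤! 151500 151501 refl) (≮⇒≥ g))

-- (n/k)^k ≤ C(n,k) ≤ n^π(3k) and π(3k) ≤ k/2 together give n ≤ k².
stuck-huge : ∀ {m k s} → 850 ≤ k → Stuck m k s → s < 2 * k → k * k < m + k → ⊥
stuck-huge {m} {k} {s} hk st s<2k h = <⇒≱ h (^-cancelˡ-≤ k 1≤k (*-cancelˡ-≤′ _ _ (1≤^ k 1≤n) (begin
  n ^ k * n ^ k                          ≤⟨ *-mono-≤ le le ⟩
  k ^ k * n ^ π * (k ^ k * n ^ π)        ≡⟨ *-swap₄ (k ^ k) (n ^ π) (k ^ k) (n ^ π) ⟩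
  k ^ k * k ^ k * (n ^ π * n ^ π)        ≡⟨ cong₂ _*_ (sym (*-^ k k k)) (sym (^-distribˡ-+-* n π π)) ⟩
  (k * k) ^ k * n ^ (π + π)              ≤⟨ *-monoʳ-≤ ((k * k) ^ k) (^-monoʳ-≤ n {{>-nonZero 1≤n}} 2π≤k) ⟩
  (k * k) ^ k * n ^ k                    ≡⟨ *-comm ((k * k) ^ k) (n ^ k) ⟩
  n ^ k * (k * k) ^ k                    ∎)))
  where
  open ≤-Reasoning
  n = m + k
  π = length (primesTo (3 * k))
  1≤k : 1 ≤ k
  1≤k = ≤-trans (≤! 1 850 refl) hk
  1≤n : 1 ≤ n
  1≤n = ≤-trans 1≤k (m≤n+m k m)
  le : n ^ k ≤ k ^ k * n ^ π
  le = ≤-trans (^≤^*bin m k) (*-monoʳ-≤ (k ^ k) (stuck-bin≤π st s<2k 1≤k))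
  s₁ : ∀ p → 6 * p ≡ 3 * (p + p)
  s₁ = solve-∀
  2π≤k : π + π ≤ k
  2π≤k = *-cancelˡ-≤ 3 (subst (_≤ 3 * k) (s₁ π) (π-bound (3 * k) (≤-trans (≤! 2550 2550 refl) (*-monoʳ-≤ 3 hk))))

stuck-large : ∀ {m k s} → 850 ≤ k → Stuck m k s → s < 2 * k → 9 * k ≤ m + k → ⊥
stuck-large {m} {k} {s} hk st s<2k lo with k * k <? m + k
... | yes h = stuck-huge hk st s<2k h
... | no g with m + k <? 20 * k
...   | no g₂₀ with m + k <? 100 * k
...     | yes l = stuck-20-100 hk st s<2k (≮⇒≥ g₂₀) l
...     | no g₁₀₀ = stuck-100-k² hk st s<2k (≮⇒≥ g₁₀₀) (≮⇒≥ g)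
stuck-large {m} {k} {s} hk st s<2k lo | no g | yes l with k <? 20000
... | no g′ = stuck-9-20 (≮⇒≥ g′) st s<2k lo l
-- Here k is too small for the thin surplus of `chunk`, but n < 400000 provides a prime in (19n/20,
-- n]. It lies in the window because n < 20k, and it is at least 3k because n ≥ 9k.
... | yes l′ with gap₂₀ (m + k) (≤-trans (≤-trans (≤! 211 (9 * 850) refl) (*-monoʳ-≤ 9 hk)) lo) (<-≤-trans l (*-monoʳ-≤ 20 (<⇒≤ l′)))
...   | p , pp , p≤n , gp = prime-in-window st s<2k pp m<p p≤n 3k≤p
  where
  1≤k : 1 ≤ k
  1≤k = ≤-trans (≤! 1 850 refl) hk
  s₁ : ∀ m k → 20 * m + 20 * k ≡ 20 * (m + k)
  s₁ = solve-∀
  s₂ : ∀ n → 20 * n ≡ n + 19 * n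
  s₂ = solve-∀
  s₃ : ∀ p k → 20 * k + 20 * p ≡ 20 * p + 20 * k
  s₃ = solve-∀
  m<p : m < p
  m<p = *-cancelˡ-< 20 m p (+-cancelʳ-< (20 * k) (20 * m) (20 * p) (subst₂ _<_ (sym (trans (s₁ m k) (s₂ (m + k)))) (s₃ p k) (+-mono-< l gp)))
  3k≤p : 3 * k ≤ p
  3k≤p = ≮⇒≥ λ p<3k → <⇒≱ gp (≤-trans (*-monoʳ-≤ 20 (<⇒≤ p<3k)) (≤-trans (≤-trans (≤-reflexive (s₄ k)) (m≤n+m (60 * k) (111 * k)))
      (≤-trans (≤-reflexive (s₅ k)) (*-monoʳ-≤ 19 lo))))
    where
    s₄ : ∀ k → 20 * (3 * k) ≡ 60 * k
    s₄ = solve-∀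
    s₅ : ∀ k → 111 * k + 60 * k ≡ 19 * (9 * k)
    s₅ = solve-∀

-- Bounds for n when 10 ≤ k < 850

Allowed : ℕ → ℕ → ℕ → ℕ → Set
Allowed k s i p = suc (s ÷ p) * p ≤ s + (k ∸ i)

-- For small k a carry may also come from higher digits. But k - i + s < p² always holds, so if p² ∣
-- m + i no carry occurs from p² on and the lowest digit must carry. If s < p, that digit carries by
-- `stuck⇒≤`.
stuck-dichotomy : ∀ {m k s p i} → Stuck m k s → s < 2 * k → Prime p → k < p → 1 ≤ i → i ≤ k → p ∣ m + i →
  Allowed k s i p ⊎ (p ≤ s × ¬ p * p ∣ m + i)
stuck-dichotomy {m} {k} {s} {p} {i} st s<2k pp k<p 1≤i i≤k d with suc (s ÷ p) * p ≤? s + (k ∸ i)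
... | yes a = inj₁ a
... | no na = inj₂ (p≤s , p²∤)
  where
  low = ≰⇒> na
  p≤s : p ≤ s
  p≤s = ≮⇒≥ λ s<p → na (subst (_≤ s + (k ∸ i)) (sym (trans (cong (λ z → suc z * p) (<⇒÷≡0 s<p)) (*-identityˡ p)))
    (≤-trans (stuck⇒≤ st pp k<p 1≤i i≤k d) (≤-reflexive (+-comm (k ∸ i) s))))
  l+s<p² : k ∸ i + s < p * p
  l+s<p² = <-≤-trans (≤-<-trans (+-monoˡ-≤ s (m∸n≤m k i)) (+-monoʳ-< k s<2k))
      (≤-trans (+-monoˡ-≤ (2 * k) (x≤x*y k (≤-trans 1≤i i≤k))) (≤-trans (n≤1+n _) (≤-trans (≤-reflexive (s₁ k)) (*-mono-≤ k<p k<p))))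
    where
    s₁ : ∀ k → 1 + (k * k + 2 * k) ≡ suc k * suc k
    s₁ = solve-∀
  p²∤ : ¬ p * p ∣ m + i
  p²∤ dd = no-carry⇒∤bin (m + k) s pp nc (st p i pp k<p 1≤i i≤k d)
    where
    nc : ∀ j → carry (m + k) s (p ^ suc j) ≡ 0
    nc zero = subst (λ z → carry (m + k) s z ≡ 0) (sym (*-identityʳ p)) (low-carry-0 i≤k d low)
    nc (suc j) = subst (λ z → carry (m + k) s z ≡ 0) (*-assoc p p (p ^ j))
      (carry-0-mult (_∣_.quotient dd) (k ∸ i) (p ^ j) (1≤^ j (prime≥1 pp)) (window-form i≤k dd) l+s<p²)

∈-filterᵇ : ∀ f {x} {xs : List ℕ} → x ∈ xs → f x ≡ true → x ∈ filterᵇ f xs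
∈-filterᵇ f m e = ∈-filter⁺ (T? ∘ f) m (≡true⇒T e)

P₁₂₀ : List ℕ
P₁₂₀ = 113 ∷ 109 ∷ 107 ∷ 103 ∷ 101 ∷ 97 ∷ 89 ∷ 83 ∷ 79 ∷ 73 ∷ 71 ∷ 67 ∷ 61 ∷ 59 ∷ 53 ∷ 47 ∷ 43 ∷ 41 ∷ 37 ∷ 31 ∷ 29 ∷ 23 ∷ 19 ∷ 17 ∷ 13 ∷ 11 ∷ 7 ∷ 5 ∷ 3 ∷ 2 ∷ []

memᵇ : ℕ → List ℕ → Bool
memᵇ x []       = false
memᵇ x (y ∷ ys) = (x ≡ᵇ y) ∨ memᵇ x ys

memᵇ-sound : ∀ x ys → T (memᵇ x ys) → x ∈ ys
memᵇ-sound x (y ∷ ys) h with Equivalence.to (T-∨ {x ≡ᵇ y}) h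
... | inj₁ e = here (≡ᵇ⇒≡ x y e)
... | inj₂ m = there (memᵇ-sound x ys m)

P₁₂₀ᵇ : ℕ → Bool
P₁₂₀ᵇ p = not (sieveᵇ p) ∨ memᵇ p P₁₂₀

P₁₂₀-complete : all< 121 P₁₂₀ᵇ ≡ true
P₁₂₀-complete = refl

allᵇ : (ℕ → Bool) → List ℕ → Bool
allᵇ f []       = true
allᵇ f (x ∷ xs) = f x ∧ allᵇ f xs

allᵇ-sound : ∀ f xs → T (allᵇ f xs) → All (λ x → T (f x)) xs
allᵇ-sound f []       _ = []
allᵇ-sound f (x ∷ xs) h with ∧-T {f x} h
... | a , b = a ∷ allᵇ-sound f xs b

P₁₂₀-≥1 : All (1 ≤_) P₁₂₀
P₁₂₀-≥1 = All.map (λ {x} → ≤ᵇ⇒≤ 1 x) (allᵇ-sound (1 ≤ᵇ_) P₁₂₀ tt)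

∈-P₁₂₀ : ∀ {p} → Prime p → p ≤ 120 → p ∈ P₁₂₀
∈-P₁₂₀ {p} pp h = memᵇ-sound p P₁₂₀ (subst (λ b → T (not b ∨ memᵇ p P₁₂₀)) (sieveᵇ-prime p pp)
  (all<-sound 121 P₁₂₀ᵇ (≡true⇒T P₁₂₀-complete) (s≤s h)))

-- The primes whose exponent is not restricted: those up to k and those with a carry at the lowest
-- digit for some position, i = 1 being the weakest case. Without such a carry, the primes of `badᵇ`
-- enter to the first power only.
freeᵇ : ℕ → ℕ → ℕ → Bool
freeᵇ k s p = (p ≤ᵇ k) ∨ (suc (s ÷ p) * p ≤ᵇ s + (k ∸ 1))

badᵇ : ℕ → ℕ → ℕ → Bool
badᵇ k s p = (k <ᵇ p) ∧ (p ≤ᵇ s)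

opaque
  freeL badL : ℕ → ℕ → List ℕ
  freeL k s = filterᵇ (freeᵇ k s) P₁₂₀
  badL k s = filterᵇ (badᵇ k s) P₁₂₀

  ∈-freeL : ∀ {k s p} → p ∈ P₁₂₀ → freeᵇ k s p ≡ true → p ∈ freeL k s
  ∈-freeL {k} {s} = ∈-filterᵇ (freeᵇ k s)

  ∈-badL : ∀ {k s p} → p ∈ P₁₂₀ → badᵇ k s p ≡ true → p ∈ badL k s
  ∈-badL {k} {s} = ∈-filterᵇ (badᵇ k s)

  freeL-≥1 : ∀ k s → All (1 ≤_) (freeL k s)
  freeL-≥1 k s = All.filter⁺ (T? ∘ freeᵇ k s) P₁₂₀-≥1

  badL-≥1 : ∀ k s → All (1 ≤_) (badL k s)
  badL-≥1 k s = All.filter⁺ (T? ∘ badᵇ k s) P₁₂₀-≥1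

∨-left : ∀ {a b} → T a → a ∨ b ≡ true
∨-left {true} _ = refl

∨-right : ∀ {a b} → T b → a ∨ b ≡ true
∨-right {true} _ = refl
∨-right {false} h = T⇒≡true h

∧-≡ : ∀ {a b} → T a → T b → a ∧ b ≡ true
∧-≡ {true} _ h = T⇒≡true h

stuck-bin≤lists : ∀ {m k s} Q B → Stuck m k s → s < 2 * k → 1 ≤ k → All (1 ≤_) Q → All (1 ≤_) B →
  (∀ p → Prime p → p ≤ 3 * k → p ≤ k ⊎ suc (s ÷ p) * p ≤ s + (k ∸ 1) → p ∈ Q) →
  (∀ p → Prime p → p ≤ 3 * k → k < p → p ≤ s → p ∈ B) →
  bin m k ≤ (m + k) ^ length Q * product B
stuck-bin≤lists {m} {k} {s} Q B st s<2k 1≤k hQ hB inQ inB = bin≤^length m k Q B (≤-trans 1≤k (m≤n+m k m)) hQ hB h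
  where
  h : ∀ p a → Prime p → 1 ≤ carry m k (p ^ suc a) → p ∈ Q ⊎ (a ≡ 0 × p ∈ B)
  h p a pp c with p ≤? k
  ... | yes l = inj₁ (inQ p pp (≤-trans l (m≤n*m k 3)) (inj₁ l))
  ... | no g with carry⇒window {m} {k} {p ^ suc a} (1≤^ (suc a) (prime≥1 pp)) (<-≤-trans (≰⇒> g) (x≤x*y p (1≤^ a (prime≥1 pp)))) c
  ...   | i , 1≤i , i≤k , d = go (stuck-dichotomy st s<2k pp (≰⇒> g) 1≤i i≤k p∣) a d
    where
    p∣ : p ∣ m + i
    p∣ = ∣-trans (m∣m*n (p ^ a)) d
    p≤3k : p ≤ 3 * k
    p≤3k = <⇒≤ (stuck⇒<3k st s<2k pp 1≤i i≤k p∣)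
    go : Allowed k s i p ⊎ (p ≤ s × ¬ p * p ∣ m + i) → ∀ a → p ^ suc a ∣ m + i → p ∈ Q ⊎ (a ≡ 0 × p ∈ B)
    go (inj₁ al) a _ = inj₁ (inQ p pp p≤3k (inj₂ (≤-trans al (+-monoʳ-≤ s (∸-monoʳ-≤ k 1≤i)))))
    go (inj₂ (p≤s , _)) zero _ = inj₂ (refl , inB p pp p≤3k (≰⇒> g) p≤s)
    go (inj₂ (_ , nd)) (suc a) dd = ⊥-elim (nd (∣-trans (subst (p * p ∣_) (*-assoc p p (p ^ a)) (m∣m*n (p ^ a))) dd))

freeᵇ-true : ∀ k s p → p ≤ k ⊎ suc (s ÷ p) * p ≤ s + (k ∸ 1) → freeᵇ k s p ≡ true
freeᵇ-true k s p (inj₁ l) = ∨-left (≤⇒≤ᵇ l)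
freeᵇ-true k s p (inj₂ l) = ∨-right {p ≤ᵇ k} (≤⇒≤ᵇ l)

badᵇ-true : ∀ k s p → k < p → p ≤ s → badᵇ k s p ≡ true
badᵇ-true k s p a b = ∧-≡ (<⇒<ᵇ a) (≤⇒≤ᵇ b)

stuck-bin≤s : ∀ {m k s} → Stuck m k s → s < 2 * k → 1 ≤ k → k ≤ 40 →
  bin m k ≤ (m + k) ^ length (freeL k s) * product (badL k s)
stuck-bin≤s {m} {k} {s} st s<2k 1≤k k≤40 = stuck-bin≤lists (freeL k s) (badL k s) st s<2k 1≤k (freeL-≥1 k s) (badL-≥1 k s)
  (λ p pp l h → ∈-freeL {k} {s} (∈-P₁₂₀ pp (≤-trans l 3k≤120)) (freeᵇ-true k s p h))
  (λ p pp l a b → ∈-badL {k} {s} (∈-P₁₂₀ pp (≤-trans l 3k≤120)) (badᵇ-true k s p a b))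
  where
  3k≤120 : 3 * k ≤ 120
  3k≤120 = *-monoʳ-≤ 3 k≤40

-- (m+1)/(m+k) increases with m, so the inequality at m₀ persists
far-persists : ∀ {m m₀ k L} c → 1 ≤ k → L ≤ k → m₀ ≤ m → c * (m₀ + k) ^ L < suc m₀ ^ k → c * (m + k) ^ L < suc m ^ k
far-persists {m} {m₀} {k@(suc k′)} {L} c 1≤k L≤k m₀≤m h = *-cancelʳ-< ((m + k) ^ r * (m₀ + k) ^ k) _ _ (begin-strict
  c * (m + k) ^ L * ((m + k) ^ r * (m₀ + k) ^ k)    ≡⟨ cong (λ z → c * (m + k) ^ L * ((m + k) ^ r * z)) (split (m₀ + k)) ⟩
  c * (m + k) ^ L * ((m + k) ^ r * ((m₀ + k) ^ L * (m₀ + k) ^ r)) ≡⟨ s₁ c ((m + k) ^ L) ((m + k) ^ r) ((m₀ + k) ^ L) ((m₀ + k) ^ r) ⟩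
  c * (m₀ + k) ^ L * ((m + k) ^ L * (m + k) ^ r * (m₀ + k) ^ r)   ≡⟨ cong (λ z → c * (m₀ + k) ^ L * (z * (m₀ + k) ^ r)) (sym (split (m + k))) ⟩
  c * (m₀ + k) ^ L * ((m + k) ^ k * (m₀ + k) ^ r)   <⟨ *-monoˡ-< _ {{>-nonZero (*-mono-≤ (1≤^ k 1≤m+k) (1≤^ r 1≤m₀+k))}} h ⟩
  suc m₀ ^ k * ((m + k) ^ k * (m₀ + k) ^ r)         ≡⟨ trans (sym (*-assoc (suc m₀ ^ k) _ _)) (cong (_* (m₀ + k) ^ r) (sym (*-^ (suc m₀) (m + k) k))) ⟩
  (suc m₀ * (m + k)) ^ k * (m₀ + k) ^ r             ≤⟨ *-mono-≤ (^-monoˡ-≤ k cross) (^-monoˡ-≤ r (+-monoˡ-≤ k m₀≤m)) ⟩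
  (suc m * (m₀ + k)) ^ k * (m + k) ^ r              ≡⟨ trans (cong (_* (m + k) ^ r) (*-^ (suc m) (m₀ + k) k)) (s₂ (suc m ^ k) ((m₀ + k) ^ k) ((m + k) ^ r)) ⟩
  suc m ^ k * ((m + k) ^ r * (m₀ + k) ^ k)          ∎)
  where
  open ≤-Reasoning
  r = k ∸ L
  1≤m+k : 1 ≤ m + k
  1≤m+k = ≤-trans 1≤k (m≤n+m k m)
  1≤m₀+k : 1 ≤ m₀ + k
  1≤m₀+k = ≤-trans 1≤k (m≤n+m k m₀)
  split : ∀ x → x ^ k ≡ x ^ L * x ^ r
  split x = trans (cong (x ^_) (sym (m+[n∸m]≡n L≤k))) (^-distribˡ-+-* x L r)
  s₁ : ∀ c a b d e → c * a * (b * (d * e)) ≡ c * d * (a * b * e)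
  s₁ = solve-∀
  s₂ : ∀ a b c → a * b * c ≡ a * (c * b)
  s₂ = solve-∀
  cross : suc m₀ * (m + k) ≤ suc m * (m₀ + k)
  cross = subst₂ _≤_ (s₃ m m₀ k′) (s₄ m m₀ k′) (+-monoˡ-≤ (m * m₀ + m + m₀ + 1 + k′) (*-monoˡ-≤ k′ m₀≤m))
    where
    s₃ : ∀ m m₀ k → m₀ * k + (m * m₀ + m + m₀ + 1 + k) ≡ (1 + m₀) * (m + (1 + k))
    s₃ = solve-∀
    s₄ : ∀ m m₀ k → m * k + (m * m₀ + m + m₀ + 1 + k) ≡ (1 + m) * (m₀ + (1 + k))
    s₄ = solve-∀

-- (m+1)^k ≤ k! C(m+k, k) contradicts the upper bound at n = N, and by `far-persists` at every
-- larger n, so one numerical inequality confines n below N.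
far-⊥ : ∀ {m k N L L′ c f} → k ≤ N → N ≤ m + k → 1 ≤ k → k ! ≡ f → L ≤ L′ → L′ ≤ k → bin m k ≤ (m + k) ^ L * c →
  f * c * N ^ L′ < suc (N ∸ k) ^ k → ⊥
far-⊥ {m} {k} {N} {L} {L′} {c} k≤N N≤n 1≤k refl L≤L′ L′≤k b h = <⇒≱
  (far-persists {m} {N ∸ k} (k ! * c) 1≤k L′≤k (≤-trans (∸-monoˡ-≤ k N≤n) (≤-reflexive (m+n∸n≡m m k)))
    (subst (λ z → k ! * c * z ^ L′ < suc (N ∸ k) ^ k) (sym (m∸n+n≡m k≤N)) h))
  (≤-trans (suc^≤bin m k) (≤-trans (*-monoˡ-≤ (k !) (≤-trans b (*-monoˡ-≤ c (^-monoʳ-≤ (m + k) {{>-nonZero (≤-trans 1≤k (m≤n+m k m))}} L≤L′))))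
    (≤-reflexive (s ((m + k) ^ L′) c (k !)))))
  where
  s : ∀ x c f → x * c * f ≡ f * c * x
  s = solve-∀

farL : ℕ → ℕ → List ℕ → List ℕ → Bool
farL N k Q B = (length Q ≤ᵇ k) ∧ ((k !) * product B * N ^ length Q <ᵇ suc (N ∸ k) ^ k)

far-lists : ∀ {m k} N Q B → farL N k Q B ≡ true → k ≤ N → 1 ≤ k → bin m k ≤ (m + k) ^ length Q * product B → m + k < N
far-lists {m} {k} N Q B t k≤N 1≤k h with ∧-T {length Q ≤ᵇ k} (≡true⇒T t)
... | a , b = ≰⇒> λ l → far-⊥ {L = length Q} {L′ = length Q} {c = product B} {f = k !} k≤N l 1≤k refl ≤-refl (≤ᵇ⇒≤ (length Q) k a) h
    (<ᵇ⇒< ((k !) * product B * N ^ length Q) (suc (N ∸ k) ^ k) b)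

all<-sound≡ : ∀ n f → all< n f ≡ true → ∀ {u} → u < n → f u ≡ true
all<-sound≡ n f h l = T⇒≡true (all<-sound n f (≡true⇒T h) l)

far-rangeᵇ : ℕ → ℕ → ℕ → Bool
far-rangeᵇ N a c = all< c (λ j → all< (2 * (a + j)) (λ s → farL N (a + j) (freeL (a + j) s) (badL (a + j) s)))

far-range : ∀ N a c → far-rangeᵇ N a c ≡ true → a + c ≤ 40 → 40 ≤ N → 1 ≤ a → ∀ {m k s} → a ≤ k → k < a + c → Stuck m k s → s < 2 * k → m + k < N
far-range N a c t h 40≤N 1≤a {m} {k} {s} a≤k k<a+c st s<2k = far-lists N (freeL k s) (badL k s)
  (split-sum k e s<2k)
  (≤-trans k≤40 40≤N) (≤-trans 1≤a a≤k) (stuck-bin≤s st s<2k (≤-trans 1≤a a≤k) k≤40)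
  where
  j = k ∸ a
  e : a + j ≡ k
  e = m+[n∸m]≡n a≤k
  j<c : j < c
  j<c = +-cancelˡ-< a j c (subst (_< a + c) (sym e) k<a+c)
  k≤40 : k ≤ 40
  k≤40 = ≤-trans (<⇒≤ k<a+c) h
  split-sum : ∀ k → a + j ≡ k → s < 2 * k → farL N k (freeL k s) (badL k s) ≡ true
  split-sum _ refl s< = all<-sound≡ (2 * (a + j)) _ (all<-sound≡ c _ t j<c) s<

-- From k = 40 on it is enough to count all primes up to 3k. The loop updates c, an upper bound for
-- that count, and F = k! instead of recomputing them.
far-loop : ℕ → ℕ → ℕ → ℕ → ℕ → Bool
far-loop zero    N k c F = true
far-loop (suc f) N k c F = ((c ≤ᵇ k) ∧ (F * 1 * N ^ c <ᵇ suc (N ∸ k) ^ k)) ∧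
  far-loop f N (suc k) (sieve-step (suc (suc (3 * k))) (sieve-step (suc (3 * k)) (sieve-step (3 * k) c))) (suc k * F)

far-loop-sound : ∀ f N k c F → length (primesTo (3 * k)) ≤ c → k ! ≡ F → T (far-loop f N k c F) → k + f ≤ N → 1 ≤ k →
  ∀ {m k′ s} → k ≤ k′ → k′ < k + f → Stuck m k′ s → s < 2 * k′ → m + k′ < N
far-loop-sound zero N k c F _ _ _ _ _ a b = ⊥-elim (<⇒≱ b (≤-trans (≤-reflexive (+-identityʳ k)) a))
far-loop-sound (suc f) N k c F hc hF t hN 1≤k {m} {k′} a b st s< with ∧-T {(c ≤ᵇ k) ∧ (F * 1 * N ^ c <ᵇ suc (N ∸ k) ^ k)} t | m≤n⇒m<n∨m≡n a
... | u , v | inj₁ l = far-loop-sound f N (suc k) _ (suc k * F) hc′ (cong (suc k *_) hF) v (≤-trans (≤-reflexive (sym (+-suc k f))) hN) (s≤s z≤n)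
        l (subst (k′ <_) (+-suc k f) b) st s<
  where
  3k : 3 * suc k ≡ suc (suc (suc (3 * k)))
  3k = *-suc 3 k
  hc′ : length (primesTo (3 * suc k)) ≤ _
  hc′ = subst (λ z → length (primesTo z) ≤ sieve-step (suc (suc (3 * k))) (sieve-step (suc (3 * k)) (sieve-step (3 * k) c))) (sym 3k)
    (length-primesTo-suc (suc (suc (3 * k))) (length-primesTo-suc (suc (3 * k)) (length-primesTo-suc (3 * k) hc)))
... | u , v | inj₂ refl with ∧-T {c ≤ᵇ k} u
...   | c≤k , lt = ≰⇒> λ l → far-⊥ {c = 1} (≤-trans (m≤m+n k (suc f)) hN) l 1≤k hF hc (≤ᵇ⇒≤ c k c≤k)
        (≤-trans (stuck-bin≤π st s< 1≤k) (≤-reflexive (sym (*-identityʳ _)))) (<ᵇ⇒< (F * 1 * N ^ c) (suc (N ∸ k) ^ k) lt)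

sieve-count : ℕ → ℕ
sieve-count zero    = 0
sieve-count (suc n) = sieve-step n (sieve-count n)

length≤sieve-count : ∀ n → length (primesTo n) ≤ sieve-count n
length≤sieve-count zero    = z≤n
length≤sieve-count (suc n) = length-primesTo-suc n (length≤sieve-count n)

-- Windows that contain a number with a large prime factor

Rough : ℕ → ℕ → Set
Rough B x = ∃ λ p → Prime p × B ≤ p × p ∣ x

-- A number up to 2^e has at most e prime factors, and those up to B divide B!. So failing to divide
-- (B!)^e exposes a prime factor above B without factoring x. This is the sense of `Rough`, which
-- asks for one large prime factor, whereas `_Rough_` forbids all small ones.
smooth-∣ : ∀ B e x → 1 ≤ x → x ≤ 2 ^ e → (∀ p → Prime p → p ∣ x → p < suc B) → x ∣ (B !) ^ e
smooth-∣ B zero x a b h = subst (_∣ 1) (≤-antisym a b) ∣-refl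
smooth-∣ B (suc e) x a b h with x ≟ 1
... | yes refl = 1∣ _
... | no x≢1 with pfac-prime (≤∧≢⇒< a (x≢1 ∘ sym))
...   | pp , divides y eq with pfac x
...     | p = subst (_∣ B ! * (B !) ^ e) (sym (trans eq (*-comm y p))) (∣-trans (*-monoʳ-∣ p (smooth-∣ B e y 1≤y y≤ h′)) (*-monoˡ-∣ ((B !) ^ e) (∣! (prime≥1 pp) (≤-pred (h p pp (divides y eq))))))
  where
  1≤y : 1 ≤ y
  1≤y = n≢0⇒n>0 λ { refl → <-irrefl refl (subst (1 ≤_) eq a) }
  y≤ : y ≤ 2 ^ e
  y≤ = *-cancelˡ-≤ 2 (≤-trans (≤-trans (*-monoˡ-≤ y (prime≥2 pp)) (≤-reflexive (trans (*-comm p y) (sym eq)))) b)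
  h′ : ∀ q → Prime q → q ∣ y → q < suc B
  h′ q pq d = h q pq (∣-trans d (divides p (trans eq (*-comm y p))))
  ∣! : ∀ {p n} → 1 ≤ p → p ≤ n → p ∣ n !
  ∣! {p} {zero} (s≤s _) ()
  ∣! {p} {suc n} 1≤p l with m≤n⇒m<n∨m≡n l
  ... | inj₂ refl = m∣m*n (n !)
  ... | inj₁ (s≤s l′) = ∣-trans (∣! 1≤p l′) (n∣m*n (suc n))

module Runs (Q B e gap N : ℕ) (Q≡ : Q ≡ (B !) ^ e) where
  roughᵇ : ℕ → Bool
  roughᵇ x = ((1 ≤ᵇ x) ∧ (x ≤ᵇ 2 ^ e)) ∧ not (does (x ∣? Q))

  roughᵇ-sound : ∀ x → T (roughᵇ x) → Rough (suc B) x
  roughᵇ-sound x t with ∧-T {(1 ≤ᵇ x) ∧ (x ≤ᵇ 2 ^ e)} t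
  ... | u , v with ∧-T {1 ≤ᵇ x} u
  ...   | a , b with anyUpTo? (λ p → prime? p ×-dec ((suc B ≤? p) ×-dec (p ∣? x))) (suc x)
  ...     | yes (p , _ , pp , l , d) = p , pp , l , d
  ...     | no none = ⊥-elim (absurd v (subst (x ∣_) (sym Q≡) (smooth-∣ B e x 1≤x (≤ᵇ⇒≤ x (2 ^ e) b)
              λ p pp d → ≰⇒> λ l → none (p , s≤s (∣⇒≤ {{>-nonZero 1≤x}} d) , pp , l , d))))
    where
    1≤x = ≤ᵇ⇒≤ 1 x a
    absurd : T (not (does (x ∣? Q))) → x ∣ Q → ⊥
    absurd t d = subst (λ z → T (not z)) (does-yes (x ∣? Q) d) t

  search : ℕ → ℕ → ℕ
  search zero    y = y
  search (suc j) y = if roughᵇ y then y else search j (y ∸ 1)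

  -- Walks from x to N along rough numbers, each step going to the farthest one within `gap`, so
  -- that for every n in between one of the `gap` numbers ending in n is rough.
  run : ℕ → ℕ → Bool
  run zero    x = false
  run (suc f) x = if N <ᵇ suc x then roughᵇ x else (roughᵇ x ∧ next (search gap (x + gap)))
    where
    next : ℕ → Bool
    next y = ((x <ᵇ y) ∧ (y ≤ᵇ x + gap)) ∧ run f y

  run-sound : ∀ f x → T (run f x) → ∀ n → x ≤ n → n < N → ∃ λ y → Rough (suc B) y × y ≤ n × n < y + gap
  run-sound (suc f) x t n x≤n n<N with N <ᵇ suc x in e′
  ... | true = ⊥-elim (<⇒≱ (<-≤-trans n<N (≤-pred (<ᵇ⇒< N (suc x) (≡true⇒T e′)))) x≤n)
  ... | false with ∧-T {roughᵇ x} t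
  ...   | rx , nx with search gap (x + gap)
  ...     | y with ∧-T {(x <ᵇ y) ∧ (y ≤ᵇ x + gap)} nx
  ...       | u , v with ∧-T {x <ᵇ y} u
  ...         | _ , y≤ with y ≤? n
  ...           | yes l = run-sound f y v n l n<N
  ...           | no g = x , roughᵇ-sound x rx , x≤n , <-≤-trans (≰⇒> g) (≤ᵇ⇒≤ y (x + gap) y≤)

stuck-no-rough : ∀ {m k s B y} → Stuck m k s → s < 2 * k → 3 * k ≤ B → Rough B y → m < y → y ≤ m + k → ⊥
stuck-no-rough {m} {k} {s} {B} {y} st s<2k h (p , pp , B≤p , d) m<y y≤ = <⇒≱
  (stuck⇒<3k {i = y ∸ m} st s<2k pp (m<n⇒0<n∸m m<y) (m≤n+o⇒m∸n≤o y m y≤) (subst (p ∣_) (sym (m+[n∸m]≡n (<⇒≤ m<y))) d)) (≤-trans h B≤p)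

opaque
  unfolding freeL

  far-10 : far-rangeᵇ 410000 10 4 ≡ true
  far-10 = refl

  far-14 : far-rangeᵇ 656000 14 6 ≡ true
  far-14 = refl

  far-20 : far-rangeᵇ 58000 20 20 ≡ true
  far-20 = refl

far-40 : far-loop 810 62000 40 (sieve-count 120) (40 !) ≡ true
far-40 = refl

stuck-run : ∀ a Q B e N x (Q≡ : Q ≡ (B !) ^ e) → Runs.run Q B e a N Q≡ N x ≡ true →
  ∀ {m k s} → a ≤ k → 3 * k ≤ suc B → Stuck m k s → s < 2 * k → x ≤ m + k → m + k < N → ⊥
stuck-run a Q B e N x Q≡ t {m} {k} a≤k 3k≤ st s<2k x≤ lt with Runs.run-sound Q B e a N Q≡ N x (≡true⇒T t) (m + k) x≤ lt
... | y , ry , y≤ , l = stuck-no-rough st s<2k 3k≤ ry (+-cancelʳ-< k m y (<-≤-trans l (+-monoʳ-≤ y a≤k))) y≤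

-- In this and the following runs, B = 3b - 4 serves the k < b, which have 3k ≤ B + 1; 2^e exceeds
-- all numbers visited; the gap is the least k, and the start is a rough number just below 9 times
-- the gap.
run-10 : Runs.run ((38 !) ^ 19) 38 19 10 410000 refl 410000 89 ≡ true
run-10 = refl

run-14 : Runs.run ((56 !) ^ 20) 56 20 14 656000 refl 656000 122 ≡ true
run-14 = refl

run-20 : Runs.run ((80 !) ^ 16) 80 16 20 58000 refl 58000 179 ≡ true
run-20 = refl

run-28 : Runs.run ((116 !) ^ 16) 116 16 28 58000 refl 58000 251 ≡ true
run-28 = refl

run-40 : Runs.run ((236 !) ^ 16) 236 16 40 62000 refl 62000 359 ≡ true
run-40 = refl

run-80 : Runs.run ((476 !) ^ 16) 476 16 80 62000 refl 62000 719 ≡ true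
run-80 = refl

run-160 : Runs.run ((956 !) ^ 16) 956 16 160 62000 refl 62000 1439 ≡ true
run-160 = refl

run-320 : Runs.run ((1916 !) ^ 16) 1916 16 320 62000 refl 62000 2879 ≡ true
run-320 = refl

run-640 : Runs.run ((2546 !) ^ 16) 2546 16 640 62000 refl 62000 5758 ≡ true
run-640 = refl

stuck-far : ∀ {m k s} → 10 ≤ k → k < 850 → Stuck m k s → s < 2 * k → (k < 14 × m + k < 410000) ⊎ ((14 ≤ k × k < 20 × m + k < 656000) ⊎ ((20 ≤ k × k < 40 × m + k < 58000) ⊎ (40 ≤ k × m + k < 62000)))
stuck-far {m} {k} {s} 10≤k k<850 st s< with k <? 14
... | yes l = inj₁ (l , far-range 410000 10 4 far-10 (≤! 14 40 refl) (≤! 40 410000 refl) (≤! 1 10 refl) 10≤k l st s<)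
... | no g with k <? 20
...   | yes l = inj₂ (inj₁ (≮⇒≥ g , l , far-range 656000 14 6 far-14 (≤! 20 40 refl) (≤! 40 656000 refl) (≤! 1 14 refl) (≮⇒≥ g) l st s<))
...   | no g₁ with k <? 40
...     | yes l = inj₂ (inj₂ (inj₁ (≮⇒≥ g₁ , l , far-range 58000 20 20 far-20 (≤! 40 40 refl) (≤! 40 58000 refl) (≤! 1 20 refl) (≮⇒≥ g₁) l st s<)))
...     | no g₂ = inj₂ (inj₂ (inj₂ (≮⇒≥ g₂ , far-loop-sound 810 62000 40 (sieve-count 120) (40 !) (length≤sieve-count 120) refl (≡true⇒T far-40) (≤! 850 62000 refl) (≤! 1 40 refl) (≮⇒≥ g₂) k<850 st s<)))

start : ∀ {m k} x a → x ≤ 9 * a → a ≤ k → 9 * k ≤ m + k → x ≤ m + k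
start x a h a≤k lo = ≤-trans h (≤-trans (*-monoʳ-≤ 9 a≤k) lo)

3*< : ∀ {k} b B → k < b → 3 * b ≤ suc B + 3 → 3 * k ≤ suc B
3*< {k} b B l h = +-cancelʳ-≤ 3 (3 * k) (suc B) (≤-trans (≤-trans (≤-reflexive (trans (+-comm (3 * k) 3) (sym (*-suc 3 k)))) (*-monoʳ-≤ 3 l)) h)

stuck-mid : ∀ {m k s} → 10 ≤ k → k < 850 → Stuck m k s → s < 2 * k → 9 * k ≤ m + k → ⊥
stuck-mid {m} {k} {s} 10≤k k<850 st s< lo with stuck-far 10≤k k<850 st s<
... | inj₁ (l , n<) = stuck-run 10 ((38 !) ^ 19) 38 19 410000 89 refl run-10 10≤k (3*< 14 38 l (≤! 42 42 refl)) st s< (start 89 10 (≤! 89 90 refl) 10≤k lo) n<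
... | inj₂ (inj₁ (g , l , n<)) = stuck-run 14 ((56 !) ^ 20) 56 20 656000 122 refl run-14 g (3*< 20 56 l (≤! 60 60 refl)) st s< (start 122 14 (≤! 122 126 refl) g lo) n<
... | inj₂ (inj₂ (inj₁ (g , l , n<))) with k <? 28
...   | yes l′ = stuck-run 20 ((80 !) ^ 16) 80 16 58000 179 refl run-20 g (3*< 28 80 l′ (≤! 84 84 refl)) st s< (start 179 20 (≤! 179 180 refl) g lo) n<
...   | no g′ = stuck-run 28 ((116 !) ^ 16) 116 16 58000 251 refl run-28 (≮⇒≥ g′) (3*< 40 116 l (≤! 120 120 refl)) st s< (start 251 28 (≤! 251 252 refl) (≮⇒≥ g′) lo) n<
stuck-mid {m} {k} {s} 10≤k k<850 st s< lo | inj₂ (inj₂ (inj₂ (g , n<))) with k <? 80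
... | yes l = stuck-run 40 ((236 !) ^ 16) 236 16 62000 359 refl run-40 g (3*< 80 236 l (≤! 240 240 refl)) st s< (start 359 40 (≤! 359 360 refl) g lo) n<
... | no g₁ with k <? 160
...   | yes l = stuck-run 80 ((476 !) ^ 16) 476 16 62000 719 refl run-80 (≮⇒≥ g₁) (3*< 160 476 l (≤! 480 480 refl)) st s< (start 719 80 (≤! 719 720 refl) (≮⇒≥ g₁) lo) n<
...   | no g₂ with k <? 320
...     | yes l = stuck-run 160 ((956 !) ^ 16) 956 16 62000 1439 refl run-160 (≮⇒≥ g₂) (3*< 320 956 l (≤! 960 960 refl)) st s< (start 1439 160 (≤! 1439 1440 refl) (≮⇒≥ g₂) lo) n<
...     | no g₃ with k <? 640
...       | yes l = stuck-run 320 ((1916 !) ^ 16) 1916 16 62000 2879 refl run-320 (≮⇒≥ g₃) (3*< 640 1916 l (≤! 1920 1920 refl)) st s< (start 2879 320 (≤! 2879 2880 refl) (≮⇒≥ g₃) lo) n<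
...       | no g₄ = stuck-run 640 ((2546 !) ^ 16) 2546 16 62000 5758 refl run-640 (≮⇒≥ g₄) (3*< 850 2546 k<850 (≤! 2550 2550 refl)) st s< (start 5758 640 (≤! 5758 5760 refl) (≮⇒≥ g₄) lo) n<

stuck-beyond-9k : ∀ {m k s} → 10 ≤ k → Stuck m k s → s < 2 * k → 9 * k ≤ m + k → ⊥
stuck-beyond-9k {k = k} 10≤k st s< lo with k <? 850
... | yes l = stuck-mid 10≤k l st s< lo
... | no g = stuck-large (≮⇒≥ g) st s< lo

-- n < 9k and small n

-- If s ≤ 7n/9 a prime in (8n/9, n] works, otherwise one in (8s/9, s].
stuck-near : ∀ {m k s} → 48 ≤ m + k → Stuck m k s → 1 ≤ k → k ≤ m → s < 2 * k → m + k ≤ 9 * k → ⊥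
stuck-near {m} {k} {s} big st 1≤k k≤m s< hi with 9 * s ≤? 7 * (m + k)
... | yes le with gap₉ (m + k) (≤-trans (≤! 37 48 refl) big)
-- `stuck⇒≤` and p + (k - i) = n give 2p ≤ n + s ≤ 16n/9, against 8n < 9p.
...   | p , pp , p≤n , lt = <⇒≱ lt′ (≤-trans 2p≤ (≤-reflexive refl))
  where
  m<p : m < p
  m<p = *-cancelˡ-< 9 m p (≤-<-trans (+-cancelʳ-≤ (9 * k) (9 * m) (8 * (m + k)) (≤-trans (≤-reflexive (s₁ m k)) (+-monoʳ-≤ (8 * (m + k)) hi))) lt)
    where
    s₁ : ∀ m k → 9 * m + 9 * k ≡ 8 * (m + k) + (m + k)
    s₁ = solve-∀
  i = p ∸ m
  m+i = m+[n∸m]≡n (<⇒≤ m<p)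
  1≤i = m<n⇒0<n∸m m<p
  i≤k = m≤n+o⇒m∸n≤o p m p≤n
  k<p : k < p
  k<p = ≤-<-trans k≤m m<p
  p+l : p + (k ∸ i) ≡ m + k
  p+l = trans (cong (_+ (k ∸ i)) (sym m+i)) (trans (+-assoc m i (k ∸ i)) (cong (m +_) (m+[n∸m]≡n i≤k)))
  p≤ : p + p ≤ m + k + s
  p≤ = ≤-trans (+-monoʳ-≤ p (stuck⇒≤ st pp k<p 1≤i i≤k (subst (p ∣_) (sym m+i) ∣-refl))) (≤-reflexive (trans (sym (+-assoc p (k ∸ i) s)) (cong (_+ s) p+l)))
  2p≤ : 9 * (p + p) ≤ 16 * (m + k)
  2p≤ = ≤-trans (*-monoʳ-≤ 9 p≤) (≤-trans (≤-reflexive (*-distribˡ-+ 9 (m + k) s)) (≤-trans (+-monoʳ-≤ (9 * (m + k)) le) (≤-reflexive (s₂ (m + k)))))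
    where
    s₂ : ∀ n → 9 * n + 7 * n ≡ 16 * n
    s₂ = solve-∀
  lt′ : 16 * (m + k) < 9 * (p + p)
  lt′ = subst₂ _<_ (s₃ (m + k)) (s₄ p) (*-monoʳ-< 2 lt)
    where
    s₃ : ∀ n → 2 * (8 * n) ≡ 16 * n
    s₃ = solve-∀
    s₄ : ∀ p → 2 * (9 * p) ≡ 9 * (p + p)
    s₄ = solve-∀
stuck-near {m} {k} {s} big st 1≤k k≤m s< hi | no g with gap₉ s 37≤s
  where
  37≤s : 37 ≤ s
  37≤s = *-cancelˡ-≤ 9 (≤-trans (≤! (9 * 37) (7 * 48) refl) (≤-trans (*-monoʳ-≤ 7 big) (<⇒≤ (≰⇒> g))))
-- As p ≤ s, the carry gives 2p ≤ s + (k - i), and p + (k - i) = n turns this into 3p ≤ n + s. But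
-- 7n < 9s and 8s < 9p give n + s < 18p/7.
... | p , pp , p≤s , lt = <⇒≱ n+s<3p 3p≤
  where
  n = m + k
  7n<9s = ≰⇒> g
  k+k≤n : k + k ≤ n
  k+k≤n = +-monoˡ-≤ k k≤m
  m<p : m < p
  m<p = *-cancelˡ-< 162 m p (≤-<-trans 162m≤ (<-≤-trans (*-monoʳ-< 16 7n<9s) (≤-trans (≤-reflexive (s₁ s)) (≤-trans (*-monoʳ-≤ 18 (<⇒≤ lt)) (≤-reflexive (s₂ p))))))
    where
    s₁ : ∀ s → 16 * (9 * s) ≡ 18 * (8 * s)
    s₁ = solve-∀
    s₂ : ∀ p → 18 * (9 * p) ≡ 162 * p
    s₂ = solve-∀
    s₃ : ∀ m k → 162 * m + 162 * k ≡ 162 * (m + k)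
    s₃ = solve-∀
    s₄ : ∀ n → 162 * n ≡ 16 * (7 * n) + (50 * n)
    s₄ = solve-∀
    7n≤18k : 7 * n ≤ 18 * k
    7n≤18k = ≤-trans (<⇒≤ 7n<9s) (≤-trans (*-monoʳ-≤ 9 (<⇒≤ s<)) (≤-reflexive (s₅ k)))
      where
      s₅ : ∀ k → 9 * (2 * k) ≡ 18 * k
      s₅ = solve-∀
    162m≤ : 162 * m ≤ 16 * (7 * n)
    162m≤ = +-cancelʳ-≤ (162 * k) (162 * m) (16 * (7 * n)) (≤-trans (≤-reflexive (trans (s₃ m k) (s₄ n))) (+-monoʳ-≤ (16 * (7 * n)) 50n≤))
      where
      s₆ : ∀ n → 50 * n + 13 * n ≡ 9 * (7 * n)
      s₆ = solve-∀
      s₇ : ∀ k → 9 * (18 * k) ≡ 162 * k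
      s₇ = solve-∀
      50n≤ : 50 * n ≤ 162 * k
      50n≤ = ≤-trans (m≤m+n (50 * n) (13 * n)) (≤-trans (≤-reflexive (s₆ n)) (≤-trans (*-monoʳ-≤ 9 7n≤18k) (≤-reflexive (s₇ k))))
  p≤n : p ≤ n
  p≤n = ≤-trans p≤s (≤-trans (<⇒≤ s<) (≤-trans (≤-reflexive (cong (k +_) (+-identityʳ k))) k+k≤n))
  i = p ∸ m
  m+i = m+[n∸m]≡n (<⇒≤ m<p)
  1≤i = m<n⇒0<n∸m m<p
  i≤k = m≤n+o⇒m∸n≤o p m p≤n
  p+l : p + (k ∸ i) ≡ n
  p+l = trans (cong (_+ (k ∸ i)) (sym m+i)) (trans (+-assoc m i (k ∸ i)) (cong (m +_) (m+[n∸m]≡n i≤k)))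
  n+s<3p : n + s < 3 * p
  n+s<3p = *-cancelˡ-< 56 (n + s) (3 * p) (<-≤-trans (subst₂ _<_ (s₁ n s) (s₂ s) (+-monoˡ-< (56 * s) (*-monoʳ-< 8 7n<9s)))
      (≤-trans (≤-reflexive (s₃ s)) (≤-trans (*-monoʳ-≤ 16 (<⇒≤ lt)) (≤-trans (m≤m+n (16 * (9 * p)) (24 * p)) (≤-reflexive (s₄ p))))))
    where
    s₁ : ∀ n s → 8 * (7 * n) + 56 * s ≡ 56 * (n + s)
    s₁ = solve-∀
    s₂ : ∀ s → 8 * (9 * s) + 56 * s ≡ 128 * s
    s₂ = solve-∀
    s₃ : ∀ s → 128 * s ≡ 16 * (8 * s)
    s₃ = solve-∀
    s₄ : ∀ p → 16 * (9 * p) + 24 * p ≡ 56 * (3 * p)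
    s₄ = solve-∀
  3≤p : 3 ≤ p
  3≤p = ≤-trans (s≤s (≤-trans (≤-trans (≤! 2 24 refl) (*-cancelˡ-≤ 2 (≤-trans big (≤-trans (+-monoʳ-≤ m k≤m) (≤-reflexive (cong (m +_) (sym (+-identityʳ m)))))))) ≤-refl)) m<p
  carryp : suc (s ÷ p) * p ≤ s + (k ∸ i)
  carryp = stuck⇒carry st pp (≤-<-trans k≤m m<p) (<-≤-trans n+s<3p (*-monoˡ-≤ p 3≤p)) 1≤i i≤k (subst (p ∣_) (sym m+i) ∣-refl)
  3p≤ : 3 * p ≤ n + s
  3p≤ = ≤-trans (+-monoʳ-≤ p (≤-trans (*-monoˡ-≤ p (s≤s (1≤÷ (prime≥1 pp) p≤s))) carryp))
    (≤-reflexive (trans (s₁ p s (k ∸ i)) (cong (_+ s) p+l)))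
    where
    s₁ : ∀ p s l → p + (s + l) ≡ p + l + s
    s₁ = solve-∀

-- Computation for n < 90

Exceptional : List (ℕ × ℕ × ℕ)
Exceptional = (4 , 2 , 2) ∷ (6 , 3 , 4) ∷ (9 , 3 , 5) ∷ (9 , 4 , 5) ∷ (9 , 4 , 6) ∷ (10 , 5 , 4) ∷ (10 , 5 , 5) ∷ (10 , 5 , 6) ∷ (12 , 6 , 10) ∷ (16 , 7 , 10) ∷ (16 , 8 , 10) ∷ []

mem₃ᵇ : ℕ → ℕ → ℕ → List (ℕ × ℕ × ℕ) → Bool
mem₃ᵇ n k s []                 = false
mem₃ᵇ n k s ((a , b , c) ∷ ts) = ((n ≡ᵇ a) ∧ ((k ≡ᵇ b) ∧ (s ≡ᵇ c))) ∨ mem₃ᵇ n k s ts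

mem₃ᵇ-sound : ∀ n k s ts → T (mem₃ᵇ n k s ts) → (n , k , s) ∈ ts
mem₃ᵇ-sound n k s ((a , b , c) ∷ ts) h with Equivalence.to (T-∨ {(n ≡ᵇ a) ∧ ((k ≡ᵇ b) ∧ (s ≡ᵇ c))}) h
... | inj₂ t = there (mem₃ᵇ-sound n k s ts t)
... | inj₁ t with ∧-T {n ≡ᵇ a} t
...   | x , y with ∧-T {k ≡ᵇ b} y
...     | y₁ , y₂ rewrite ≡ᵇ⇒≡ n a x | ≡ᵇ⇒≡ k b y₁ | ≡ᵇ⇒≡ s c y₂ = here refl

anyᵇ : (ℕ → Bool) → List ℕ → Bool
anyᵇ f []       = false
anyᵇ f (x ∷ xs) = f x ∨ anyᵇ f xs

anyᵇ-sound : ∀ {P : ℕ → Set} f xs → All P xs → T (anyᵇ f xs) → ∃ λ x → P x × T (f x)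
anyᵇ-sound f (x ∷ xs) (p ∷ ps) h with Equivalence.to (T-∨ {f x}) h
... | inj₁ t = x , p , t
... | inj₂ t = anyᵇ-sound f xs ps t

P₁₂₀-prime : All Prime P₁₂₀
P₁₂₀-prime = All.map (λ {x} → primeᵇ-sound x) (allᵇ-sound primeᵇ P₁₂₀ tt)

-- The condition n mod p < k puts a multiple of p into the window, at i = k - (n mod p).
witnessᵇ : ℕ → ℕ → ℕ → ℕ → Bool
witnessᵇ c n k p = ((k <ᵇ p) ∧ (p ≤ᵇ n)) ∧ (((n ∸ (n ÷ p) * p) <ᵇ k) ∧ not (does (p ∣? c)))

bruteᵇ : ℕ → ℕ → ℕ → ℕ → Bool
bruteᵇ c n s k = (((k <ᵇ 2) ∨ (n <ᵇ 2 * k)) ∨ ((2 * k ≤ᵇ s) ∨ mem₃ᵇ n k s Exceptional)) ∨ anyᵇ (witnessᵇ c n k) P₁₂₀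

brute-rowᵇ : ℕ → ℕ → Bool
brute-rowᵇ n s = (λ c → all< (suc (n ÷ 2)) (bruteᵇ c n s)) ((n + s) C s)

brute-allᵇ : ℕ → Bool
brute-allᵇ n = all< n (brute-rowᵇ n)

brute-ok : all< 90 brute-allᵇ ≡ true
brute-ok = refl

brute-at : ∀ {n s k} → n < 90 → s < n → k < suc (n ÷ 2) → bruteᵇ ((n + s) C s) n s k ≡ true
brute-at {n} {s} {k} n< s< k< = all<-sound≡ (suc (n ÷ 2)) (bruteᵇ ((n + s) C s) n s)
  (all<-sound≡ n (brute-rowᵇ n) (all<-sound≡ 90 brute-allᵇ brute-ok n<) s<) k<

not-T : ∀ {b} → T (not b) → b ≡ true → ⊥
not-T {false} _ ()

witness-⊥ : ∀ {m k s p} → Stuck m k s → Prime p → T (witnessᵇ ((m + k + s) C s) (m + k) k p) → ⊥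
witness-⊥ {m} {k} {s} {p} st pp t with ∧-T {(k <ᵇ p) ∧ (p ≤ᵇ m + k)} t
... | u , v with ∧-T {k <ᵇ p} u | ∧-T {(m + k ∸ ((m + k) ÷ p) * p) <ᵇ k} v
...   | u₁ , _ | v₁ , v₂ = not-T v₂ (does-yes (p ∣? ((m + k + s) C s))
        (st p i pp (<ᵇ⇒< k p u₁) (m<n⇒0<n∸m l<k) (m∸n≤m k l) (divides ((m + k) ÷ p) m+i)))
  where
  q = (m + k) ÷ p
  l = m + k ∸ q * p
  l<k : l < k
  l<k = <ᵇ⇒< l k v₁
  i = k ∸ l
  m+i : m + i ≡ q * p
  m+i = +-cancelʳ-≡ l (m + i) (q * p) (trans (+-assoc m i l) (trans (cong (m +_) (m∸n+n≡m (<⇒≤ l<k))) (sym (m+[n∸m]≡n (÷*≤ (m + k) p)))))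

stuck-brute : ∀ {m k s} → m + k < 90 → Stuck m k s → 2 ≤ k → k ≤ m → s < 2 * k → (m + k , k , s) ∈ Exceptional
stuck-brute {m} {k} {s} n<90 st 2≤k k≤m s< = go (Equivalence.to (T-∨ {A ∨ B}) t)
  where
  n = m + k
  A = (k <ᵇ 2) ∨ (n <ᵇ 2 * k)
  B = (2 * k ≤ᵇ s) ∨ mem₃ᵇ n k s Exceptional
  2k≤n : 2 * k ≤ n
  2k≤n = ≤-trans (≤-reflexive (cong (k +_) (+-identityʳ k))) (+-monoˡ-≤ k k≤m)
  s<n : s < n
  s<n = <-≤-trans s< 2k≤n
  k≤ : k < suc (n ÷ 2)
  k≤ = s≤s (≤-÷ {k} (s≤s z≤n) (≤-trans (≤-reflexive (*-comm k 2)) 2k≤n))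
  t : T (bruteᵇ ((n + s) C s) n s k)
  t = ≡true⇒T (brute-at {n} {s} {k} n<90 s<n k≤)
  go : T (A ∨ B) ⊎ T (anyᵇ (witnessᵇ ((n + s) C s) n k) P₁₂₀) → (n , k , s) ∈ Exceptional
  go (inj₂ w) with anyᵇ-sound (witnessᵇ ((n + s) C s) n k) P₁₂₀ P₁₂₀-prime w
  ... | p , pp , tw = ⊥-elim (witness-⊥ {s = s} st pp tw)
  go (inj₁ ab) with Equivalence.to (T-∨ {A}) ab
  ... | inj₁ a with Equivalence.to (T-∨ {k <ᵇ 2}) a
  ...   | inj₁ x = ⊥-elim (<⇒≱ (<ᵇ⇒< k 2 x) 2≤k)
  ...   | inj₂ x = ⊥-elim (<⇒≱ (<ᵇ⇒< n (2 * k) x) 2k≤n)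
  go (inj₁ ab) | inj₂ b with Equivalence.to (T-∨ {2 * k ≤ᵇ s}) b
  ... | inj₁ x = ⊥-elim (<⇒≱ s< (≤ᵇ⇒≤ (2 * k) s x))
  ... | inj₂ x = mem₃ᵇ-sound n k s Exceptional x

-- k < 10: distinct prime powers in the window

∣-by-prime-powers : ∀ M x → 1 ≤ x → (∀ p e → Prime p → p ^ e ∣ x → p ^ e ∣ M) → x ∣ M
∣-by-prime-powers M = <-rec _ go
  where
  go : ∀ x → (∀ {y} → y < x → 1 ≤ y → (∀ p e → Prime p → p ^ e ∣ y → p ^ e ∣ M) → y ∣ M) →
       1 ≤ x → (∀ p e → Prime p → p ^ e ∣ x → p ^ e ∣ M) → x ∣ M
  go x rec 1≤x h with x ≟ 1
  ... | yes refl = 1∣ M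
  ... | no x≢1 with pfac-prime (≤∧≢⇒< 1≤x (x≢1 ∘ sym))
  ...   | pp , p∣x with val-split pp x 1≤x
  ...     | zero , w , e , n = ⊥-elim (n (subst (pfac x ∣_) (trans e (*-identityˡ w)) p∣x))
  ...     | suc v , w , e , n with rec {w} w<x 1≤w (λ q f pq d → h q f pq (∣-trans d (subst (w ∣_) (sym e) (n∣m*n (p ^ suc v)))))
    where
    p = pfac x
    1≤w : 1 ≤ w
    1≤w = n≢0⇒n>0 λ { refl → <-irrefl refl (subst (1 ≤_) (trans e (*-zeroʳ (p ^ suc v))) 1≤x) }
    w<x : w < x
    w<x = subst (w <_) (trans (*-comm w _) (sym e)) (m<m*n w (p ^ suc v) {{>-nonZero 1≤w}} (≤-trans (s≤s (s≤s z≤n)) (2≤⇒n<^ (suc v) (prime≥2 pp))))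
  ...       | divides c M≡ = subst₂ _∣_ (sym e) (sym M≡) (*-monoˡ-∣ w (prime-pow-cancel pp n (suc v) c
              (subst (pfac x ^ suc v ∣_) (trans M≡ (*-comm c w)) (h (pfac x) (suc v) pp (subst (pfac x ^ suc v ∣_) (sym e) (m∣m*n w))))))

P₂₇ : List ℕ
P₂₇ = 2 ∷ 3 ∷ 5 ∷ 7 ∷ 11 ∷ 13 ∷ 17 ∷ 19 ∷ 23 ∷ []

P₂₇ᵇ : ℕ → Bool
P₂₇ᵇ p = not (sieveᵇ p) ∨ memᵇ p P₂₇

P₂₇-complete : all< 27 P₂₇ᵇ ≡ true
P₂₇-complete = refl

∈-P₂₇ : ∀ {p} → Prime p → p < 27 → p ∈ P₂₇
∈-P₂₇ {p} pp h = memᵇ-sound p P₂₇ (subst (λ b → T (not b ∨ memᵇ p P₂₇)) (sieveᵇ-prime p pp) (all<-sound 27 P₂₇ᵇ (≡true⇒T P₂₇-complete) h))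

P₂₇-prime : All Prime P₂₇
P₂₇-prime = All.map (λ {x} → primeᵇ-sound x) (allᵇ-sound primeᵇ P₂₇ tt)

allᵇ-∈ : ∀ f {x xs} → allᵇ f xs ≡ true → x ∈ xs → f x ≡ true
allᵇ-∈ f {x} {xs} h m = T⇒≡true (All.lookup (allᵇ-sound f xs (≡true⇒T h)) m)

anyᵇ-∈ : ∀ f {x xs} → x ∈ xs → f x ≡ true → anyᵇ f xs ≡ true
anyᵇ-∈ f (here refl) e rewrite e = refl
anyᵇ-∈ f {xs = y ∷ ys} (there m) e with f y
... | true  = refl
... | false = anyᵇ-∈ f m e

powUp : ℕ → ℕ → ℕ → ℕ → ℕ
powUp zero    k q v = v
powUp (suc f) k q v = if k ≤ᵇ v then v else powUp f k q (q * v)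

powUp-∣ : ∀ f k q a e → 2 ≤ q → k ≤ q ^ e → a ≤ e → powUp f k q (q ^ a) ∣ q ^ e
powUp-∣ zero k q a e _ _ a≤e = subst (q ^ a ∣_) (*-identityʳ (q ^ e)) (≤⇒^∣^* q 1 a≤e)
powUp-∣ (suc f) k q a e 2≤q h a≤e with k ≤ᵇ q ^ a in eq
... | true  = subst (q ^ a ∣_) (*-identityʳ (q ^ e)) (≤⇒^∣^* q 1 a≤e)
... | false = powUp-∣ f k q (suc a) e 2≤q h (≤∧≢⇒< a≤e λ { refl → case trans (sym eq) (T⇒≡true (≤⇒≤ᵇ h)) of λ () })

-- A power of q that is at least k, hence divides at most one of k consecutive numbers. Four
-- multiplications suffice for k < 10, since 2^4 ≥ 9.
cap : ℕ → ℕ → ℕ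
cap k q = if q ≤ᵇ k then powUp 4 k q 1 else q

-- The primes that may capture m + i, that is, divide it to the power `cap`. Primes with 14 ≤ q ≤ s
-- may occur to the first power only, but are counted here because they would make the cofactor too
-- large.
okᵇ : ℕ → ℕ → ℕ → ℕ → Bool
okᵇ k s i q = (q ≤ᵇ k) ∨ ((suc (s ÷ q) * q ≤ᵇ s + (k ∸ i)) ∨ ((14 ≤ᵇ q) ∧ (q ≤ᵇ s)))

lcmBelow : ℕ → ℕ
lcmBelow 2 = 1
lcmBelow 3 = 2
lcmBelow 4 = 6
lcmBelow 5 = 12
lcmBelow 6 = 60
lcmBelow 7 = 60
lcmBelow 8 = 420
lcmBelow _ = 840

smallBad : ℕ → ℕ → List ℕ
smallBad k s = filterᵇ (badᵇ k s) (3 ∷ 5 ∷ 7 ∷ 11 ∷ 13 ∷ [])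

-- A multiple of whatever in m + i belongs to no capturing prime: powers below k of primes up to k,
-- which divide lcm(1, ..., k - 1), and first powers of the primes between k and s below 14. Its
-- largest value is 840 · 11 · 13 = 120120 < 124990 ≤ m, so every m + i is captured.
cofactor : ℕ → ℕ → ℕ
cofactor k s = lcmBelow k * product (smallBad k s)

capᵇ : ℕ → Bool
capᵇ k = (k <ᵇ 2) ∨ (allᵇ (λ q → k ≤ᵇ cap k q) P₂₇ ∧ all< k (λ j → (j ≡ᵇ 0) ∨ does (j ∣? lcmBelow k)))

capᵇ-ok : all< 10 capᵇ ≡ true
capᵇ-ok = refl

capᵇ-at : ∀ {k} → 2 ≤ k → k < 10 → T (allᵇ (λ q → k ≤ᵇ cap k q) P₂₇ ∧ all< k (λ j → (j ≡ᵇ 0) ∨ does (j ∣? lcmBelow k)))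
capᵇ-at {suc (suc k)} (s≤s (s≤s z≤n)) l = all<-sound 10 capᵇ (≡true⇒T capᵇ-ok) l

≤-cap : ∀ {k q} → 2 ≤ k → k < 10 → q ∈ P₂₇ → k ≤ cap k q
≤-cap {k} {q} 2≤k k<10 m = ≤ᵇ⇒≤ k (cap k q) (All.lookup (allᵇ-sound (λ q → k ≤ᵇ cap k q) P₂₇ (proj₁ (∧-T {allᵇ (λ q → k ≤ᵇ cap k q) P₂₇} (capᵇ-at 2≤k k<10)))) m)

does-∣ : ∀ {a b} → T (does (a ∣? b)) → a ∣ b
does-∣ {a} {b} h with a ∣? b
... | yes d = d

below-∣ : ∀ {k j} → 2 ≤ k → k < 10 → 1 ≤ j → j < k → j ∣ lcmBelow k
below-∣ {k} {j@(suc _)} 2≤k k<10 _ j<k = does-∣ (all<-sound k (λ j → (j ≡ᵇ 0) ∨ does (j ∣? lcmBelow k)) (proj₂ (∧-T {allᵇ (λ q → k ≤ᵇ cap k q) P₂₇} (capᵇ-at 2≤k k<10))) j<k)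

module _ {m k s : ℕ} (2≤k : 2 ≤ k) (k<10 : k < 10) (st : Stuck m k s) (s< : s < 2 * k) where

  uncaptured-∣ : ∀ {i} p e → 1 ≤ i → i ≤ k → Prime p → p ^ e ∣ m + i → (okᵇ k s i p ≡ true → ¬ cap k p ∣ m + i) → p ^ e ∣ cofactor k s
  uncaptured-∣ p zero _ _ _ _ _ = 1∣ _
  uncaptured-∣ {i} p e@(suc e′) 1≤i i≤k pp d nc with p ≤? k
  ... | yes l = ∣-trans (below-∣ 2≤k k<10 (1≤^ e (prime≥1 pp)) (≰⇒> λ k≤ → nc (∨-left (≤⇒≤ᵇ l))
          (∣-trans (subst (_∣ p ^ e) (sym capeq) (powUp-∣ 4 k p 0 e (prime≥2 pp) k≤ z≤n)) d))) (m∣m*n (product (smallBad k s)))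
    where
    capeq : cap k p ≡ powUp 4 k p 1
    capeq = cong (λ b → if b then powUp 4 k p 1 else p) (T⇒≡true (≤⇒≤ᵇ l))
  ... | no g with stuck-dichotomy st s< pp (≰⇒> g) 1≤i i≤k (∣-trans (m∣m*n (p ^ e′)) d)
  ...   | inj₁ al = ⊥-elim (nc (∨-right {p ≤ᵇ k} (≡true⇒T (∨-left {b = (14 ≤ᵇ p) ∧ (p ≤ᵇ s)} (≤⇒≤ᵇ al)))) (big e′ d))
    where
    big : ∀ e′ → p ^ suc e′ ∣ m + i → cap k p ∣ m + i
    big e′ d = subst (_∣ m + i) (sym (cong (λ b → if b then powUp 4 k p 1 else p) (¬T⇒false (λ t → g (≤ᵇ⇒≤ p k t))))) (∣-trans (m∣m*n (p ^ e′)) d)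
      where
      ¬T⇒false : ∀ {b} → ¬ T b → b ≡ false
      ¬T⇒false {false} _ = refl
      ¬T⇒false {true} n = ⊥-elim (n tt)
  ...   | inj₂ (p≤s , nd) with 14 ≤? p
  ...     | yes h = ⊥-elim (nc (∨-right {p ≤ᵇ k} (≡true⇒T (∨-right {suc (s ÷ p) * p ≤ᵇ s + (k ∸ i)} (≡true⇒T (∧-≡ (≤⇒≤ᵇ h) (≤⇒≤ᵇ p≤s)))))) (big e′ d))
    where
    big : ∀ e′ → p ^ suc e′ ∣ m + i → cap k p ∣ m + i
    big e′ d = subst (_∣ m + i) (sym (cong (λ b → if b then powUp 4 k p 1 else p) (¬T⇒false (λ t → g (≤ᵇ⇒≤ p k t))))) (∣-trans (m∣m*n (p ^ e′)) d)
      where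
      ¬T⇒false : ∀ {b} → ¬ T b → b ≡ false
      ¬T⇒false {false} _ = refl
      ¬T⇒false {true} n = ⊥-elim (n tt)
  ...     | no h = fin e′ d
    where
    p∈ : p ∈ 3 ∷ 5 ∷ 7 ∷ 11 ∷ 13 ∷ []
    p∈ with ∈-P₂₇ pp (<-trans (≰⇒> h) (≤! 15 27 refl))
    ... | here refl = ⊥-elim (g 2≤k)
    ... | there (here e) = here e
    ... | there (there (here e)) = there (here e)
    ... | there (there (there (here e))) = there (there (here e))
    ... | there (there (there (there (here e)))) = there (there (there (here e)))
    ... | there (there (there (there (there (here e))))) = there (there (there (there (here e))))
    ... | there (there (there (there (there (there (here refl)))))) = ⊥-elim (h (≤! 14 17 refl))
    ... | there (there (there (there (there (there (there (here refl))))))) = ⊥-elim (h (≤! 14 19 refl))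
    ... | there (there (there (there (there (there (there (there (here refl)))))))) = ⊥-elim (h (≤! 14 23 refl))
    fin : ∀ e′ → p ^ suc e′ ∣ m + i → p ^ suc e′ ∣ cofactor k s
    fin zero _ = subst (_∣ cofactor k s) (sym (*-identityʳ p)) (∣-trans (∈⇒∣product (∈-filterᵇ (badᵇ k s) p∈ (badᵇ-true k s p (≰⇒> g) p≤s))) (n∣m*n (lcmBelow k)))
    fin (suc e″) d = ⊥-elim (nd (∣-trans (subst (p * p ∣_) (*-assoc p p (p ^ e″)) (m∣m*n (p ^ e″))) d))

  cap-unique : ∀ {q i j} → q ∈ P₂₇ → 1 ≤ i → i < j → j ≤ k → cap k q ∣ m + i → cap k q ∣ m + j → ⊥
  cap-unique {q} {i} {j} q∈ 1≤i i<j j≤k di dj = <⇒≱ (<-≤-trans (≤-<-trans (∣⇒≤ {{>-nonZero (m<n⇒0<n∸m i<j)}} d) j∸i<k) (≤-cap 2≤k k<10 q∈)) ≤-refl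
    where
    d : cap k q ∣ j ∸ i
    d = ∣m+n∣m⇒∣n (subst (cap k q ∣_) (trans (cong (m +_) (sym (m+[n∸m]≡n (<⇒≤ i<j)))) (sym (+-assoc m i (j ∸ i)))) dj) di
    j∸i<k : j ∸ i < k
    j∸i<k = <-≤-trans (∸-monoʳ-< {j} {i} {0} 1≤i (<⇒≤ i<j)) j≤k

  cap-unique′ : ∀ {q i j} → q ∈ P₂₇ → 1 ≤ i → i ≤ k → 1 ≤ j → j ≤ k → ¬ i ≡ j → cap k q ∣ m + i → cap k q ∣ m + j → ⊥
  cap-unique′ {i = i} {j} q∈ 1≤i i≤k 1≤j j≤k ne di dj with <-cmp i j
  ... | tri< l _ _ = cap-unique q∈ 1≤i l j≤k di dj
  ... | tri≈ _ e _ = ne e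
  ... | tri> _ _ l = cap-unique q∈ 1≤j l i≤k dj di

findᵇ : (ℕ → Bool) → List ℕ → ℕ
findᵇ f []       = 0
findᵇ f (x ∷ xs) = if f x then x else findᵇ f xs

findᵇ-sound : ∀ f xs → anyᵇ f xs ≡ true → findᵇ f xs ∈ xs × f (findᵇ f xs) ≡ true
findᵇ-sound f (x ∷ xs) h with f x in e
... | true  = here refl , e
... | false with findᵇ-sound f xs h
...   | m , t = there m , t

Assoc : Set
Assoc = List (ℕ × ℕ)

hasVal : ℕ → Assoc → Bool
hasVal q []             = false
hasVal q ((_ , r) ∷ as) = (q ≡ᵇ r) ∨ hasVal q as

hasPair : ℕ → ℕ → Assoc → Bool
hasPair i q []             = false
hasPair i q ((j , r) ∷ as) = ((i ≡ᵇ j) ∧ (q ≡ᵇ r)) ∨ hasPair i q as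

-- Every other prime that could capture m + i is assigned to another element, and captures only that
-- one; so m + i is a power of q times a divisor of the cofactor.
completeᵇ : ℕ → ℕ → Assoc → ℕ → ℕ → Bool
completeᵇ k s as i q = allᵇ (λ p → (p ≡ᵇ q) ∨ (not (okᵇ k s i p) ∨ hasVal p as)) P₂₇

Unit : Set
Unit = ℕ × ℕ × ℕ × ℕ

matchᵇ : ℕ → ℕ → Assoc → Unit → ℕ → Bool
matchᵇ k s as (q , q′ , d , _) i = (hasPair i q as ∧ hasPair (i + d) q′ as) ∧ (completeᵇ k s as i q ∧ completeᵇ k s as (i + d) q′)

leafᵇ : ℕ → ℕ → List Unit → Assoc → Bool
leafᵇ k s []       as = false
leafᵇ k s (t ∷ ts) as = not (all< (suc k) (λ i → not (matchᵇ k s as t i))) ∨ leafᵇ k s ts as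

-- Backtracking over systems of distinct representatives: false when no choice of one prime power per window element survives the tables.
sdr : ℕ → ℕ → List Unit → ℕ → Assoc → Bool
sdr k s tb zero    as = not (leafᵇ k s tb as)
sdr k s tb (suc i) as = anyᵇ (λ q → (okᵇ k s (suc i) q ∧ not (hasVal q as)) ∧ sdr k s tb i ((suc i , q) ∷ as)) P₂₇

-- The first of v, q v, q² v, ... to reach 90000. The numbers in the window are larger than that, so
-- small solutions of q^a u + d = q′^b u′ and the pre-periods of the powers modulo M + 1 drop out.
startVal : ℕ → ℕ → ℕ → ℕ
startVal zero    q v = v
startVal (suc f) q v = if 90000 ≤ᵇ v then v else startVal f q (q * v)

startVal-power : ∀ f q v a → 90000 ≤ q ^ a * v → ∃ λ b → q ^ a * v ≡ q ^ b * startVal f q v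
startVal-power zero    q v a _ = a , refl
startVal-power (suc f) q v a h with 90000 ≤ᵇ v in e
... | true = a , refl
startVal-power (suc f) q v zero h | false = case trans (sym e) (T⇒≡true (≤⇒≤ᵇ (subst (90000 ≤_) (*-identityˡ v) h))) of λ ()
startVal-power (suc f) q v (suc a) h | false with startVal-power f q (q * v) a (subst (90000 ≤_) (sw q (q ^ a) v) h)
  where
  sw : ∀ q x v → q * x * v ≡ x * (q * v)
  sw = solve-∀
... | b , eq = b , trans (sw q (q ^ a) v) eq
  where
  sw : ∀ q x v → q * x * v ≡ x * (q * v)
  sw = solve-∀

orbit : ℕ → ℕ → ℕ → ℕ → ℕ → List ℕ
orbit zero    q M v₀ v = []
orbit (suc f) q M v₀ v = v ∷ (if ((q * v) % suc M) ≡ᵇ v₀ then [] else orbit f q M v₀ ((q * v) % suc M))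

orbits : ℕ → ℕ → ℕ → ℕ → ℕ → List ℕ
orbits F X q M zero    = []
orbits F X q M (suc u) = if does (suc u ∣? X) ∧ not (does (q ∣? suc u))
  then (λ v → orbit (suc F) q M v v) (startVal F q (suc u) % suc M) ++ orbits F X q M u
  else orbits F X q M u

∈-++ʳ : ∀ {x : ℕ} xs {ys} → x ∈ ys → x ∈ xs ++ ys
∈-++ʳ []       m = m
∈-++ʳ (_ ∷ xs) m = there (∈-++ʳ xs m)

∈-orbits : ∀ F X q M n {u} → 1 ≤ u → u ≤ n → u ∣ X → ¬ q ∣ u → startVal F q u % suc M ∈ orbits F X q M n
∈-orbits F X q M zero 1≤u u≤n _ _ = ⊥-elim (<⇒≱ 1≤u u≤n)
∈-orbits F X q M (suc n) {u} 1≤u u≤n d nd with m≤n⇒m<n∨m≡n u≤n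
... | inj₂ refl = subst (λ b → startVal F q (suc n) % suc M ∈ (if b then orbit (suc F) q M (startVal F q (suc n) % suc M) (startVal F q (suc n) % suc M) ++ orbits F X q M n else orbits F X q M n))
      (sym (cong₂ _∧_ (does-yes (suc n ∣? X) d) (cong not (does-no (q ∣? suc n) nd)))) (here refl)
... | inj₁ (s≤s l) with does (suc n ∣? X) ∧ not (does (q ∣? suc n))
...   | true  = ∈-++ʳ (orbit (suc F) q M (startVal F q (suc n) % suc M) (startVal F q (suc n) % suc M)) (∈-orbits F X q M n 1≤u l d nd)
...   | false = ∈-orbits F X q M n 1≤u l d nd

closedᵇ : ℕ → ℕ → List ℕ → Bool
closedᵇ q M A = allᵇ (λ y → memᵇ ((q * y) % suc M) A) A

disjointᵇ : ℕ → ℕ → List ℕ → List ℕ → Bool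
disjointᵇ d M A B = allᵇ (λ x → not (memᵇ ((x + d) % suc M) B)) A

-- `A` and `B` contain the residues modulo M + 1 of all q^a u and q′^b u′ from 90000 on, with u and
-- u′ dividing the cofactor. If A + d misses B, no two such numbers differ by d.
unitᵇ : ℕ → ℕ → ℕ → Unit → Bool
unitᵇ F k s (q , q′ , d , M) = (λ A B → (closedᵇ q M A ∧ closedᵇ q′ M B) ∧ disjointᵇ d M A B) (orbits F (cofactor k s) q M (cofactor k s)) (orbits F (cofactor k s) q′ M (cofactor k s))

memᵇ-complete : ∀ {x xs} → x ∈ xs → memᵇ x xs ≡ true
memᵇ-complete {x} {y ∷ ys} (here refl) = ∨-left (≡⇒≡ᵇ x x refl)
memᵇ-complete {x} {y ∷ ys} (there m) = ∨-right {x ≡ᵇ y} (≡true⇒T (memᵇ-complete m))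

power-residue : ∀ q M A v b → closedᵇ q M A ≡ true → v % suc M ∈ A → (q ^ b * v) % suc M ∈ A
power-residue q M A v zero    c m = subst (λ z → z % suc M ∈ A) (sym (*-identityˡ v)) m
power-residue q M A v (suc b) c m = subst (_∈ A) e (memᵇ-sound _ A (≡true⇒T (allᵇ-∈ (λ y → memᵇ ((q * y) % suc M) A) c (power-residue q M A v b c m))))
  where
  e : (q * ((q ^ b * v) % suc M)) % suc M ≡ (q * q ^ b * v) % suc M
  e = trans (%-distribˡ-* q ((q ^ b * v) % suc M) (suc M)) (trans (cong (λ z → ((q % suc M) * z) % suc M) (m%n%n≡m%n (q ^ b * v) (suc M)))
        (trans (sym (%-distribˡ-* q (q ^ b * v) (suc M))) (cong (_% suc M) (sym (*-assoc q (q ^ b) v)))))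

unit-residue : ∀ {F X q M x} → Prime q → 1 ≤ X → closedᵇ q M (orbits F X q M X) ≡ true → 1 ≤ x → 90000 ≤ x →
  (∀ p e → Prime p → ¬ p ≡ q → p ^ e ∣ x → p ^ e ∣ X) → x % suc M ∈ orbits F X q M X
unit-residue {F} {X} {q} {M} {x} pq 1≤X c 1≤x big h with val-split pq x 1≤x
... | a , u , x≡ , nd with startVal-power F q u a (subst (90000 ≤_) x≡ big)
...   | b , e = subst (λ z → z % suc M ∈ orbits F X q M X) (sym (trans x≡ e))
        (power-residue q M (orbits F X q M X) (startVal F q u) b c (∈-orbits F X q M X 1≤u (∣⇒≤ {{>-nonZero 1≤X}} u∣X) u∣X nd))
  where
  1≤u : 1 ≤ u
  1≤u = n≢0⇒n>0 λ { refl → nd (q ∣0) }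
  u∣X : u ∣ X
  u∣X = ∣-by-prime-powers X u 1≤u h′
    where
    h′ : ∀ p e → Prime p → p ^ e ∣ u → p ^ e ∣ X
    h′ p zero _ _ = 1∣ X
    h′ p (suc e) pp d with p ≟ q
    ... | yes refl = ⊥-elim (nd (∣-trans (m∣m*n (p ^ e)) d))
    ... | no ne = h p (suc e) pp ne (∣-trans d (subst (u ∣_) (sym x≡) (n∣m*n (q ^ a))))

unit-⊥ : ∀ {F X q q′ d M x} → Prime q → Prime q′ → 1 ≤ X → closedᵇ q M (orbits F X q M X) ≡ true → closedᵇ q′ M (orbits F X q′ M X) ≡ true →
  disjointᵇ d M (orbits F X q M X) (orbits F X q′ M X) ≡ true → 90000 ≤ x →
  (∀ p e → Prime p → ¬ p ≡ q → p ^ e ∣ x → p ^ e ∣ X) → (∀ p e → Prime p → ¬ p ≡ q′ → p ^ e ∣ x + d → p ^ e ∣ X) → ⊥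
unit-⊥ {F} {X} {q} {q′} {d} {M} {x} pq pq′ 1≤X c c′ dj big h h′ = not-T (≡true⇒T (allᵇ-∈ (λ x → not (memᵇ ((x + d) % suc M) (orbits F X q′ M X))) dj (unit-residue pq 1≤X c 1≤x big h)))
    (memᵇ-complete (subst (_∈ orbits F X q′ M X) e (unit-residue pq′ 1≤X c′ (≤-trans 1≤x (m≤m+n x d)) (≤-trans big (m≤m+n x d)) h′)))
  where
  1≤x : 1 ≤ x
  1≤x = ≤-trans (≤! 1 90000 refl) big
  e : (x + d) % suc M ≡ (x % suc M + d) % suc M
  e = trans (%-distribˡ-+ x d (suc M)) (trans (cong (λ z → (z + d % suc M) % suc M) (sym (m%n%n≡m%n x (suc M)))) (sym (%-distribˡ-+ (x % suc M) d (suc M))))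

hasPair-sound : ∀ i q as → T (hasPair i q as) → (i , q) ∈ as
hasPair-sound i q ((j , r) ∷ as) h with Equivalence.to (T-∨ {(i ≡ᵇ j) ∧ (q ≡ᵇ r)}) h
... | inj₂ t = there (hasPair-sound i q as t)
... | inj₁ t with ∧-T {i ≡ᵇ j} t
...   | a , b rewrite ≡ᵇ⇒≡ i j a | ≡ᵇ⇒≡ q r b = here refl

hasVal-sound : ∀ q as → T (hasVal q as) → ∃ λ j → (j , q) ∈ as
hasVal-sound q ((j , r) ∷ as) h with Equivalence.to (T-∨ {q ≡ᵇ r}) h
... | inj₁ a rewrite ≡ᵇ⇒≡ q r a = j , here refl
... | inj₂ t with hasVal-sound q as t
...   | j′ , m = j′ , there m

not-all< : ∀ n (f : ℕ → Bool) → T (not (all< n (λ i → not (f i)))) → ∃ λ i → T (f i)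
not-all< zero f ()
not-all< (suc n) f h with f n in e
... | true  = n , ≡true⇒T e
... | false = not-all< n f h

allUnits : ℕ → ℕ → ℕ → List Unit → Bool
allUnits F k s []       = true
allUnits F k s (t ∷ ts) = unitᵇ F k s t ∧ allUnits F k s ts

false≢true : ∀ {b} → b ≡ false → b ≡ true → ⊥
false≢true refl ()

module _ {m k s : ℕ} (2≤k : 2 ≤ k) (k<10 : k < 10) (st : Stuck m k s) (s< : s < 2 * k) (big : 125000 ≤ m + k)
         (F : ℕ) (tb : List Unit) (C< : cofactor k s < 124990) (1≤X : 1 ≤ cofactor k s) (units : allUnits F k s tb ≡ true) where

  capturesᵇ : ℕ → ℕ → Bool
  capturesᵇ i q = okᵇ k s i q ∧ does (cap k q ∣? (m + i))

  124990≤m : 124990 ≤ m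
  124990≤m = +-cancelʳ-≤ 10 124990 m (≤-trans big (+-monoʳ-≤ m (<⇒≤ k<10)))

  p<27 : ∀ {p i} → Prime p → 1 ≤ i → i ≤ k → p ∣ m + i → p < 27
  p<27 pp 1≤i i≤k d = <-≤-trans (stuck⇒<3k st s< pp 1≤i i≤k d) (*-monoʳ-≤ 3 (≤-pred k<10))

  captured : ∀ i → 1 ≤ i → i ≤ k → anyᵇ (capturesᵇ i) P₂₇ ≡ true
  captured i 1≤i i≤k with anyᵇ (capturesᵇ i) P₂₇ in eq
  ... | true = refl
  ... | false = ⊥-elim (<⇒≱ C< (≤-trans (≤-trans 124990≤m (m≤m+n m i)) (∣⇒≤ {{>-nonZero 1≤X}} d)))
    where
    d : m + i ∣ cofactor k s
    d = ∣-by-prime-powers (cofactor k s) (m + i) (≤-trans 1≤i (m≤n+m i m)) h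
      where
      h : ∀ p e → Prime p → p ^ e ∣ m + i → p ^ e ∣ cofactor k s
      h p zero _ _ = 1∣ cofactor k s
      h p (suc e) pp dv = uncaptured-∣ 2≤k k<10 st s< p (suc e) 1≤i i≤k pp dv λ ok c → false≢true eq
        (anyᵇ-∈ (capturesᵇ i) (∈-P₂₇ pp (p<27 pp 1≤i i≤k (∣-trans (m∣m*n (p ^ e)) dv))) (∧-≡ (≡true⇒T ok) (≡true⇒T (does-yes (cap k p ∣? (m + i)) c))))

  -- The prime that captures m + i. By `cap-unique` different elements have different ones, so f is
  -- among the assignments that `sdr` enumerates.
  f : ℕ → ℕ
  f i = findᵇ (capturesᵇ i) P₂₇

  f∈ : ∀ i → 1 ≤ i → i ≤ k → f i ∈ P₂₇
  f∈ i a b = proj₁ (findᵇ-sound (capturesᵇ i) P₂₇ (captured i a b))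

  f-ok : ∀ i → 1 ≤ i → i ≤ k → T (okᵇ k s i (f i)) × cap k (f i) ∣ m + i
  f-ok i a b with ∧-T {okᵇ k s i (f i)} (≡true⇒T (proj₂ (findᵇ-sound (capturesᵇ i) P₂₇ (captured i a b))))
  ... | x , y = x , does-∣ y

  Inv : ℕ → Assoc → Set
  Inv i as = ∀ {j q} → (j , q) ∈ as → q ≡ f j × i < j × j ≤ k

  others : ∀ {as i} → Inv 0 as → (i , f i) ∈ as → completeᵇ k s as i (f i) ≡ true →
    ∀ p e → Prime p → ¬ p ≡ f i → p ^ e ∣ m + i → p ^ e ∣ cofactor k s
  others _ _ _ p zero _ _ _ = 1∣ cofactor k s
  others {as} {i} inv i∈ c p (suc e) pp ne d with inv i∈
  ... | _ , 1≤i , i≤k = uncaptured-∣ 2≤k k<10 st s< p (suc e) 1≤i i≤k pp d λ ok cd → go ok cd (Equivalence.to (T-∨ {p ≡ᵇ f i}) (≡true⇒T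
        (allᵇ-∈ (λ p → (p ≡ᵇ f i) ∨ (not (okᵇ k s i p) ∨ hasVal p as)) c p∈)))
    where
    p∈ = ∈-P₂₇ pp (p<27 pp 1≤i i≤k (∣-trans (m∣m*n (p ^ e)) d))
    go : okᵇ k s i p ≡ true → cap k p ∣ m + i → T (p ≡ᵇ f i) ⊎ T (not (okᵇ k s i p) ∨ hasVal p as) → ⊥
    go ok cd (inj₁ x) = ne (≡ᵇ⇒≡ p (f i) x)
    go ok cd (inj₂ y) with Equivalence.to (T-∨ {not (okᵇ k s i p)}) y
    ... | inj₁ z = not-T z ok
    ... | inj₂ z with hasVal-sound p as z
    ...   | j , j∈ with inv j∈
    ...     | refl , 1≤j , j≤k = cap-unique′ 2≤k k<10 st s< p∈ 1≤i i≤k 1≤j j≤k (λ { refl → ne refl }) cd (proj₂ (f-ok j 1≤j j≤k))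

  leaf-⊥ : ∀ ts {as} → allUnits F k s ts ≡ true → Inv 0 as → T (leafᵇ k s ts as) → ⊥
  leaf-⊥ ((q , q′ , d , M) ∷ ts) {as} us inv h with ∧-T {unitᵇ F k s (q , q′ , d , M)} (≡true⇒T us) | Equivalence.to (T-∨ {not (all< (suc k) (λ i → not (matchᵇ k s as (q , q′ , d , M) i)))}) h
  ... | u , us′ | inj₂ h′ = leaf-⊥ ts (T⇒≡true us′) inv h′
  ... | u , us′ | inj₁ h′ with not-all< (suc k) (matchᵇ k s as (q , q′ , d , M)) h′
  ...   | i , mt with ∧-T {hasPair i q as ∧ hasPair (i + d) q′ as} mt
  ...     | ab , cd with ∧-T {hasPair i q as} ab | ∧-T {completeᵇ k s as i q} cd
  ...       | a , b | c , c′ with hasPair-sound i q as a | hasPair-sound (i + d) q′ as b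
  ...         | i∈ | j∈ with inv i∈ | inv j∈
  ...           | refl , 1≤i , i≤k | refl , 1≤j , j≤k = fin (∧-T {closedᵇ (f i) M A ∧ closedᵇ (f (i + d)) M B} u)
    where
    X = cofactor k s
    A = orbits F X (f i) M X
    B = orbits F X (f (i + d)) M X
    prime-f : ∀ j → 1 ≤ j → j ≤ k → Prime (f j)
    prime-f j a b = All.lookup P₂₇-prime (f∈ j a b)
    fin : T (closedᵇ (f i) M A ∧ closedᵇ (f (i + d)) M B) × T (disjointᵇ d M A B) → ⊥
    fin (cc , dj) with ∧-T {closedᵇ (f i) M A} cc
    ... | c₁ , c₂ = unit-⊥ {F} {X} {d = d} {M} {m + i} (prime-f i 1≤i i≤k) (prime-f (i + d) 1≤j j≤k) 1≤X (T⇒≡true c₁) (T⇒≡true c₂) (T⇒≡true dj)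
          (≤-trans (≤! 90000 124990 refl) (≤-trans 124990≤m (m≤m+n m i)))
          (others inv i∈ (T⇒≡true c))
          (λ p e pp ne dv → others inv j∈ (T⇒≡true c′) p e pp ne (subst (p ^ e ∣_) (+-assoc m i d) dv))

  -- Follows the branch of the search in which every element receives its actual prime.
  sdr-⊥ : ∀ i as → i ≤ k → Inv i as → sdr k s tb i as ≡ false → ⊥
  sdr-⊥ zero as _ inv h = leaf-⊥ tb units inv (flip (leafᵇ k s tb as) h)
    where
    flip : ∀ b → not b ≡ false → T b
    flip true _ = tt
  sdr-⊥ (suc i) as i<k inv h = go (hasVal (f (suc i)) as) refl
    where
    body : ℕ → Bool
    body q = (okᵇ k s (suc i) q ∧ not (hasVal q as)) ∧ sdr k s tb i ((suc i , q) ∷ as)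
    inv′ : Inv i ((suc i , f (suc i)) ∷ as)
    inv′ (here refl) = refl , ≤-refl , i<k
    inv′ (there x) with inv x
    ... | a , b , c = a , <-trans (n<1+n i) b , c
    go : ∀ b → hasVal (f (suc i)) as ≡ b → ⊥
    go true e with hasVal-sound (f (suc i)) as (≡true⇒T e)
    ... | j , j∈ with inv j∈
    ...   | fe , si<j , j≤k = cap-unique 2≤k k<10 st s< (f∈ (suc i) (s≤s z≤n) i<k) (s≤s z≤n) si<j j≤k (proj₂ (f-ok (suc i) (s≤s z≤n) i<k))
              (subst (λ z → cap k z ∣ m + j) (sym fe) (proj₂ (f-ok j (≤-trans (s≤s z≤n) si<j) j≤k)))
    go false e = sdr-⊥ i ((suc i , f (suc i)) ∷ as) (<⇒≤ i<k) inv′ (bool (sdr k s tb i ((suc i , f (suc i)) ∷ as)) refl)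
      where
      bool : ∀ b → sdr k s tb i ((suc i , f (suc i)) ∷ as) ≡ b → sdr k s tb i ((suc i , f (suc i)) ∷ as) ≡ false
      bool false x = x
      bool true x = ⊥-elim (false≢true h (anyᵇ-∈ body (f∈ (suc i) (s≤s z≤n) i<k) (∧-≡ {okᵇ k s (suc i) (f (suc i)) ∧ not (hasVal (f (suc i)) as)}
        (≡true⇒T (∧-≡ (proj₁ (f-ok (suc i) (s≤s z≤n) i<k)) (≡true⇒T (cong not e)))) (≡true⇒T x))))

-- entries (q , q′ , d , M): no q^a u + d = q′^b u′ modulo M + 1
unitTable : ℕ → ℕ → List Unit
unitTable 2 2 = (3 , 2 , 1 , 7) ∷ []
unitTable 3 3 = (5 , 2 , 2 , 7) ∷ (5 , 2 , 1 , 7) ∷ []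
unitTable 3 4 = (5 , 2 , 2 , 7) ∷ (5 , 2 , 1 , 7) ∷ (2 , 3 , 2 , 159) ∷ []
unitTable 3 5 = (3 , 2 , 1 , 6551) ∷ (2 , 3 , 1 , 1311) ∷ []
unitTable 4 4 = (3 , 2 , 1 , 7) ∷ (3 , 2 , 2 , 31) ∷ (2 , 3 , 1 , 159) ∷ (2 , 3 , 2 , 159) ∷ []
unitTable 5 9 = (5 , 2 , 2 , 6199) ∷ (3 , 2 , 1 , 15767) ∷ (5 , 2 , 1 , 6199) ∷ (2 , 3 , 1 , 159) ∷ (2 , 3 , 2 , 159) ∷ (2 , 3 , 3 , 159) ∷ (2 , 5 , 1 , 2911) ∷ []
unitTable 6 9 = (5 , 2 , 2 , 6199) ∷ (3 , 2 , 1 , 15767) ∷ (5 , 2 , 1 , 6199) ∷ (2 , 5 , 1 , 2911) ∷ (2 , 5 , 2 , 2911) ∷ (2 , 5 , 3 , 5439) ∷ []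
unitTable 6 10 = (5 , 2 , 2 , 6199) ∷ (3 , 2 , 1 , 15767) ∷ (5 , 2 , 1 , 6199) ∷ (3 , 5 , 4 , 2519) ∷ (3 , 2 , 2 , 63071) ∷ (5 , 2 , 4 , 24799) ∷ (2 , 3 , 1 , 6559) ∷ (2 , 5 , 1 , 2911) ∷ (2 , 5 , 2 , 2911) ∷ (2 , 5 , 3 , 5439) ∷ (2 , 3 , 5 , 11807) ∷ (2 , 3 , 2 , 13119) ∷ (2 , 3 , 3 , 5439) ∷ (2 , 5 , 5 , 14559) ∷ []
unitTable _ _ = []

sdrᵇ : ℕ → ℕ → Bool
sdrᵇ k s = ((cofactor k s <ᵇ 124990) ∧ (1 ≤ᵇ cofactor k s)) ∧ (allUnits 1000 k s (unitTable k s) ∧ not (sdr k s (unitTable k s) k []))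

sdrᵇ-row : ℕ → Bool
sdrᵇ-row k = (k <ᵇ 2) ∨ all< (2 * k) (sdrᵇ k)

sdrᵇ-ok : all< 10 sdrᵇ-row ≡ true
sdrᵇ-ok = refl

sdrᵇ-at : ∀ k s → 2 ≤ k → k < 10 → s < 2 * k → sdrᵇ k s ≡ true
sdrᵇ-at k s 2≤k k<10 s< = all<-sound≡ (2 * k) (sdrᵇ k) (drop k 2≤k (all<-sound≡ 10 sdrᵇ-row sdrᵇ-ok k<10)) s<
  where
  drop : ∀ k → 2 ≤ k → sdrᵇ-row k ≡ true → all< (2 * k) (sdrᵇ k) ≡ true
  drop (suc (suc k)) _ h = h
  drop (suc zero) (s≤s ()) _

stuck-sdr : ∀ {m k s} → 2 ≤ k → k < 10 → Stuck m k s → s < 2 * k → 125000 ≤ m + k → ⊥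
stuck-sdr {m} {k} {s} 2≤k k<10 st s< big = go 1000 (unitTable k s) (sdrᵇ-at k s 2≤k k<10 s<)
  where
  go : ∀ F tb → ((cofactor k s <ᵇ 124990) ∧ (1 ≤ᵇ cofactor k s)) ∧ (allUnits F k s tb ∧ not (sdr k s tb k [])) ≡ true → ⊥
  go F tb h with ∧-T {(cofactor k s <ᵇ 124990) ∧ (1 ≤ᵇ cofactor k s)} (≡true⇒T h)
  ... | ab , cd with ∧-T {cofactor k s <ᵇ 124990} ab | ∧-T {allUnits F k s tb} cd
  ...   | a , b | c , d = sdr-⊥ 2≤k k<10 st s< big F tb (<ᵇ⇒< (cofactor k s) 124990 a) (≤ᵇ⇒≤ 1 (cofactor k s) b) (T⇒≡true c) k [] ≤-refl (λ ()) (un (sdr k s tb k []) d)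
    where
    un : ∀ b → T (not b) → b ≡ false
    un false _ = refl

run-2 : Runs.run ((5 !) ^ 17) 5 17 2 125000 refl 125000 89 ≡ true
run-2 = refl

run-3 : Runs.run ((8 !) ^ 17) 8 17 3 125000 refl 125000 89 ≡ true
run-3 = refl

run-4 : Runs.run ((11 !) ^ 17) 11 17 4 125000 refl 125000 89 ≡ true
run-4 = refl

run-5 : Runs.run ((14 !) ^ 17) 14 17 5 125000 refl 125000 89 ≡ true
run-5 = refl

run-6 : Runs.run ((17 !) ^ 17) 17 17 6 125000 refl 125000 89 ≡ true
run-6 = refl

run-7 : Runs.run ((20 !) ^ 17) 20 17 7 125000 refl 125000 89 ≡ true
run-7 = refl

run-8 : Runs.run ((23 !) ^ 17) 23 17 8 125000 refl 125000 89 ≡ true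
run-8 = refl

run-9 : Runs.run ((26 !) ^ 17) 26 17 9 125000 refl 125000 89 ≡ true
run-9 = refl

small-run : ∀ k → 2 ≤ k → ∀ {m s} → k < 10 → Stuck m k s → s < 2 * k → 90 ≤ m + k → m + k < 125000 → ⊥
small-run 0 () _ _ _ _ _
small-run 1 (s≤s ()) _ _ _ _ _
small-run 2 _ _ st s< lo hi = stuck-run 2 ((5 !) ^ 17) 5 17 125000 89 refl run-2 ≤-refl ≤-refl st s< (≤-trans (≤! 89 90 refl) lo) hi
small-run 3 _ _ st s< lo hi = stuck-run 3 ((8 !) ^ 17) 8 17 125000 89 refl run-3 ≤-refl ≤-refl st s< (≤-trans (≤! 89 90 refl) lo) hi
small-run 4 _ _ st s< lo hi = stuck-run 4 ((11 !) ^ 17) 11 17 125000 89 refl run-4 ≤-refl ≤-refl st s< (≤-trans (≤! 89 90 refl) lo) hi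
small-run 5 _ _ st s< lo hi = stuck-run 5 ((14 !) ^ 17) 14 17 125000 89 refl run-5 ≤-refl ≤-refl st s< (≤-trans (≤! 89 90 refl) lo) hi
small-run 6 _ _ st s< lo hi = stuck-run 6 ((17 !) ^ 17) 17 17 125000 89 refl run-6 ≤-refl ≤-refl st s< (≤-trans (≤! 89 90 refl) lo) hi
small-run 7 _ _ st s< lo hi = stuck-run 7 ((20 !) ^ 17) 20 17 125000 89 refl run-7 ≤-refl ≤-refl st s< (≤-trans (≤! 89 90 refl) lo) hi
small-run 8 _ _ st s< lo hi = stuck-run 8 ((23 !) ^ 17) 23 17 125000 89 refl run-8 ≤-refl ≤-refl st s< (≤-trans (≤! 89 90 refl) lo) hi
small-run 9 _ _ st s< lo hi = stuck-run 9 ((26 !) ^ 17) 26 17 125000 89 refl run-9 ≤-refl ≤-refl st s< (≤-trans (≤! 89 90 refl) lo) hi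
small-run (suc (suc (suc (suc (suc (suc (suc (suc (suc (suc k)))))))))) _ l _ _ _ _ = ⊥-elim (<⇒≱ l (≤-trans (≤! 10 10 refl) (m≤m+n 10 k)))

stuck-small : ∀ {m k s} → 2 ≤ k → k < 10 → Stuck m k s → s < 2 * k → 90 ≤ m + k → ⊥
stuck-small {m} {k} {s} 2≤k k<10 st s< big with m + k <? 125000
... | yes l = small-run k 2≤k k<10 st s< big l
... | no g = stuck-sdr 2≤k k<10 st s< (≮⇒≥ g)

stuck⇒exceptional : ∀ {m k s} → Stuck m k s → 2 ≤ k → k ≤ m → s < 2 * k → (m + k , k , s) ∈ Exceptional
stuck⇒exceptional {m} {k} {s} st 2≤k k≤m s< with m + k <? 90
... | yes l = stuck-brute l st 2≤k k≤m s<
... | no g with k <? 10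
...   | yes k<10 = ⊥-elim (stuck-small 2≤k k<10 st s< (≮⇒≥ g))
...   | no k≮10 with 9 * k ≤? m + k
...     | yes h = ⊥-elim (stuck-beyond-9k (≮⇒≥ k≮10) st s< h)
...     | no h = ⊥-elim (stuck-near (≤-trans (≤! 48 90 refl) (≮⇒≥ g)) st (≤-trans (s≤s z≤n) 2≤k) k≤m s< (<⇒≤ (≰⇒> h)))

import Data.Sum
open import Data.Integer as ℤ using (ℤ) renaming (∣_∣ to abs; +_ to pos)
import Data.Integer.Properties as ℤ
import Data.Integer.Divisibility.Signed as ℤ∣
open import Relation.Binary.Definitions using (Decidable; Transitive)
open import Defs
open import Data.Rational as ℚ using (ℚ; 0ℚ; 1ℚ)
import Data.Rational.Properties as ℚ
open import Data.Rational.Unnormalised as ℚᵘ using (ℚᵘ; mkℚᵘ; *≡*; *≤*)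
import Data.Rational.Unnormalised.Properties as ℚᵘ
import Data.Integer.Tactic.RingSolver as ℤ-Ring
open import Data.Fin as Fin using (Fin)
open import Data.List using (tabulate)
open import Function using (id)

-- Newton polygons

record Exact (r e : ℕ) (x : ℤ) : Set where
  constructor exactly
  field
    divides-abs : r ^ e ∣ abs x
    ∤-abs       : ¬ r ^ suc e ∣ abs x
open Exact public

∣-+ : ∀ d x y → d ∣ abs x → d ∣ abs y → d ∣ abs (x ℤ.+ y)
∣-+ d x y dx dy = ℤ∣.∣⇒∣ᵤ (ℤ∣.∣m∣n⇒∣m+n {pos d} {x} {y} (ℤ∣.∣ᵤ⇒∣ {pos d} {x} dx) (ℤ∣.∣ᵤ⇒∣ {pos d} {y} dy))

∣-+⁻ : ∀ d x y → d ∣ abs (x ℤ.+ y) → d ∣ abs x → d ∣ abs y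
∣-+⁻ d x y dxy dx = ℤ∣.∣⇒∣ᵤ (ℤ∣.∣m+n∣m⇒∣n {pos d} {x} {y} (ℤ∣.∣ᵤ⇒∣ {pos d} {x ℤ.+ y} dxy) (ℤ∣.∣ᵤ⇒∣ {pos d} {x} dx))

exact-+ : ∀ {r e} x y → Exact r e x → r ^ suc e ∣ abs y → Exact r e (x ℤ.+ y)
exact-+ {r} {e} x y (exactly d n) dy = exactly
  (∣-+ (r ^ e) x y d (∣-trans (m∣m*n r) (subst (_∣ abs y) (*-comm r (r ^ e)) dy)))
  λ h → n (∣-+⁻ (r ^ suc e) y x (subst (λ z → r ^ suc e ∣ abs z) (ℤ.+-comm x y) h) dy)

conv : (ℕ → ℤ) → (ℕ → ℤ) → ℕ → ℤ
conv f g zero    = f 0 ℤ.* g 0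
conv f g (suc m) = f 0 ℤ.* g (suc m) ℤ.+ conv (f ∘ suc) g m

conv-∣-or : ∀ d f g m →
  d ∣ abs (conv f g m) ⊎ (∃ λ i → ∃ λ j → i + j ≡ m × ¬ d ∣ abs (f i ℤ.* g j))
conv-∣-or d f g zero with d ∣? abs (f 0 ℤ.* g 0)
... | yes h = inj₁ h
... | no ¬h = inj₂ (0 , 0 , refl , ¬h)
conv-∣-or d f g (suc m) with d ∣? abs (f 0 ℤ.* g (suc m)) | conv-∣-or d (f ∘ suc) g m
... | no ¬h | _                      = inj₂ (0 , suc m , refl , ¬h)
... | yes h | inj₁ h′                = inj₁ (∣-+ d (f 0 ℤ.* g (suc m)) (conv (f ∘ suc) g m) h h′)
... | yes h | inj₂ (i , j , eq , ¬h) = inj₂ (suc i , j , cong suc eq , ¬h)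

conv-∣ : ∀ d f g m → (∀ i j → i + j ≡ m → d ∣ abs (f i ℤ.* g j)) → d ∣ abs (conv f g m)
conv-∣ d f g m h with conv-∣-or d f g m
... | inj₁ x                = x
... | inj₂ (i , j , eq , n) = ⊥-elim (n (h i j eq))

-- The ultrametric principle: a single term of least valuation decides the valuation of the sum.
conv-exact : ∀ {r e} f g i j → Exact r e (f i ℤ.* g j) →
  (∀ i′ j′ → i′ + j′ ≡ i + j → i′ ≢ i → r ^ suc e ∣ abs (f i′ ℤ.* g j′)) → Exact r e (conv f g (i + j))
conv-exact f g zero zero ex _ = ex
conv-exact {r} {e} f g zero (suc j) ex h =
  exact-+ _ _ ex (conv-∣ (r ^ suc e) (f ∘ suc) g j (λ i′ j′ eq → h (suc i′) j′ (cong suc eq) λ ()))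
conv-exact {r} {e} f g (suc i) j ex h =
  subst (Exact r e) (ℤ.+-comm (conv (f ∘ suc) g (i + j)) (f 0 ℤ.* g (suc (i + j))))
    (exact-+ (conv (f ∘ suc) g (i + j)) _
      (conv-exact (f ∘ suc) g i j ex (λ i′ j′ eq ne → h (suc i′) j′ (cong suc eq) (ne ∘ suc-injective)))
      (h 0 (suc (i + j)) refl λ ()))

Support : ℕ → (ℕ → ℤ) → Set
Support N f = ∀ i → N < i → f i ≡ pos 0

record Tie : Set₁ where
  field
    _⊳_     : ℕ → ℕ → Set
    _⊳?_    : Decidable _⊳_
    ⊳-trans : Transitive _⊳_
    irrefl  : ∀ {i} → ¬ i ⊳ i
    total   : ∀ {i j} → i ≢ j → i ⊳ j ⊎ j ⊳ i
    reverse : ∀ {i j i′ j′} → i + j ≡ i′ + j′ → i′ ⊳ i → j ⊳ j′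

sum-reverse : ∀ {i j i′ j′} → i + j ≡ i′ + j′ → i′ < i → j < j′
sum-reverse {i} {j} {i′} {j′} eq lt = ≰⇒> λ le → <⇒≢ (+-mono-<-≤ lt le) (sym eq)

lowest highest : Tie
lowest = record { _⊳_ = _<_ ; _⊳?_ = _<?_ ; ⊳-trans = <-trans ; irrefl = <-irrefl refl
                ; total = λ ne → case <-cmp _ _ of λ { (tri< l _ _) → inj₁ l ; (tri≈ _ e _) → ⊥-elim (ne e) ; (tri> _ _ g) → inj₂ g }
                ; reverse = sum-reverse }
highest = record { _⊳_ = _>_ ; _⊳?_ = _>?_ ; ⊳-trans = λ x y → <-trans y x ; irrefl = <-irrefl refl
                 ; total = λ ne → case <-cmp _ _ of λ { (tri< l _ _) → inj₂ l ; (tri≈ _ e _) → ⊥-elim (ne e) ; (tri> _ _ g) → inj₁ g }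
                 ; reverse = λ {i} {j} {i′} {j′} eq → sum-reverse {i′} {j′} {i} {j} (sym eq) }

weight-+ : ∀ b a e f i j → b * e + a * i + (b * f + a * j) ≡ b * (e + f) + a * (i + j)
weight-+ = solve-∀

module Valuation {r : ℕ} (pr : Prime r) where

  exact-split : ∀ {e x} → Exact r e x → ∃ λ w → abs x ≡ r ^ e * w × ¬ r ∣ w
  exact-split {e} {x} (exactly d n) = _∣_.quotient d , trans (_∣_.equality d) (*-comm (_∣_.quotient d) _) ,
    λ h → n (subst (r ^ suc e ∣_) (sym (_∣_.equality d)) (*-monoˡ-∣ (r ^ e) h))

  split-exact : ∀ {e x} w → abs x ≡ r ^ e * w → ¬ r ∣ w → Exact r e x
  split-exact {e} {x} w eq n = exactly (divides w (trans eq (*-comm (r ^ e) w)))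
    λ h → <⇒≱ (n<1+n e) (^∣^*⇒≤ pr (suc e) e w n (subst (r ^ suc e ∣_) eq h))

  opaque
    exact-exists : ∀ {x} → x ≢ pos 0 → ∃ λ e → Exact r e x
    exact-exists {x} ne with val-split pr (abs x) (n≢0⇒n>0 (ne ∘ ℤ.∣i∣≡0⇒i≡0))
    ... | v , w , eq , n = v , split-exact w eq n

  exact-≢0 : ∀ {e x} → Exact r e x → x ≢ pos 0
  exact-≢0 (exactly _ n) refl = n (_ ∣0)

  exact-≥ : ∀ {e x} c → Exact r e x → r ^ c ∣ abs x → c ≤ e
  exact-≥ {e} c ex d with exact-split ex
  ... | w , eq , n = ^∣^*⇒≤ pr c e w n (subst (r ^ c ∣_) eq d)

  exact-unique : ∀ {e e′ x} → Exact r e x → Exact r e′ x → e ≡ e′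
  exact-unique h h′ = ≤-antisym (exact-≥ _ h′ (divides-abs h)) (exact-≥ _ h (divides-abs h′))

  exact-* : ∀ {e f x y} → Exact r e x → Exact r f y → Exact r (e + f) (x ℤ.* y)
  exact-* {e} {f} {x} {y} hx hy with exact-split hx | exact-split hy
  ... | u , eu , nu | v , ev , nv = split-exact (u * v)
    (trans (ℤ.abs-* x y) (trans (cong₂ _*_ eu ev)
      (trans (*-swap₄ (r ^ e) u (r ^ f) v) (cong (_* (u * v)) (sym (^-distribˡ-+-* r e f))))))
    λ h → [ nu , nv ]′ (euclidsLemma u v pr h)

  exact-∣ : ∀ {e x} c → Exact r e x → c ≤ e → r ^ c ∣ abs x
  exact-∣ c h c≤e with exact-split h
  ... | w , eq , _ = subst (r ^ c ∣_) (sym eq) (≤⇒^∣^* r w c≤e)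

  *≢0 : ∀ {x y} → x ≢ pos 0 → y ≢ pos 0 → x ℤ.* y ≢ pos 0
  *≢0 {x} nx ny h = [ nx , ny ]′ (ℤ.i*j≡0⇒i≡0∨j≡0 x h)

  opaque
    conv-witness : ∀ {e} f g m → Exact r e (conv f g m) →
      ∃ λ i → ∃ λ j → ∃ λ u → ∃ λ v → i + j ≡ m × Exact r u (f i) × Exact r v (g j) × u + v ≤ e
    conv-witness {e} f g m (exactly _ n) with conv-∣-or (r ^ suc e) f g m
    ... | inj₁ h = ⊥-elim (n h)
    ... | inj₂ (i , j , eq , ¬h) = i , j , proj₁ U , proj₁ V , eq , proj₂ U , proj₂ V ,
          ≮⇒≥ (λ lt → ¬h (exact-∣ (suc e) (exact-* (proj₂ U) (proj₂ V)) lt))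
      where
      U : ∃ λ u → Exact r u (f i)
      U = exact-exists {f i} (λ h → ¬h (subst (λ z → r ^ suc e ∣ abs (z ℤ.* g j)) (sym h) (_∣0 (r ^ suc e))))
      V : ∃ λ v → Exact r v (g j)
      V = exact-exists {g j} (λ h → ¬h (subst (λ z → r ^ suc e ∣ abs (f i ℤ.* z)) (sym h)
            (subst (λ z → r ^ suc e ∣ abs z) (sym (ℤ.*-zeroʳ (f i))) (_∣0 (r ^ suc e)))))

  -- The Newton polygon of f is touched from below by a line b v + a i = const at the index `at`;
  -- among all contact points it is the last one in the order ⊳.
  record Vertex (T : Tie) (b a : ℕ) (f : ℕ → ℤ) : Set where
    open Tie T
    field
      at val : ℕ
      exact  : Exact r val (f at)
      least  : ∀ i v → Exact r v (f i) → b * val + a * at ≤ b * v + a * i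
      strict : ∀ i v → Exact r v (f i) → i ⊳ at → b * val + a * at < b * v + a * i
    level : ℕ
    level = b * val + a * at

  module _ (T : Tie) (b a : ℕ) (f : ℕ → ℤ) where
    open Tie T

    record VertexUpto (N : ℕ) : Set where
      field
        at val : ℕ
        exact  : Exact r val (f at)
        least  : ∀ i v → i ≤ N → Exact r v (f i) →
          b * val + a * at ≤ b * v + a * i × (i ⊳ at → b * val + a * at < b * v + a * i)

    vertex-upto : ∀ N → (∀ i → i ≤ N → f i ≡ pos 0) ⊎ VertexUpto N
    vertex-upto zero with f 0 ℤ.≟ pos 0
    ... | yes z = inj₁ λ { zero z≤n → z }
    ... | no nz = inj₂ record { at = 0 ; val = proj₁ E ; exact = proj₂ E
                                      ; least = λ { zero v z≤n h → ≤-reflexive (cong (λ z → b * z + a * 0) (exact-unique (proj₂ E) h)) , ⊥-elim ∘ irrefl } }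
      where E = exact-exists nz
    vertex-upto (suc M) = go (f (suc M) ℤ.≟ pos 0) (vertex-upto M)
      where
      split : ∀ {i} → i ≤ suc M → i ≤ M ⊎ i ≡ suc M
      split h = Data.Sum.map₁ s≤s⁻¹ (m≤n⇒m<n∨m≡n h)
      go : Dec (f (suc M) ≡ pos 0) → (∀ i → i ≤ M → f i ≡ pos 0) ⊎ VertexUpto M → (∀ i → i ≤ suc M → f i ≡ pos 0) ⊎ VertexUpto (suc M)
      go (yes z) (inj₁ zs) = inj₁ λ i h → [ zs i , (λ { refl → z }) ]′ (split h)
      go (yes z) (inj₂ V)  = inj₂ record { VertexUpto V ; least = λ i v h e →
        [ (λ h′ → VertexUpto.least V i v h′ e) , (λ { refl → ⊥-elim (exact-≢0 e z) }) ]′ (split h) }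
      go (no nz) (inj₁ zs) = inj₂ record { at = suc M ; val = proj₁ E ; exact = proj₂ E ; least = λ i v h e →
        [ (λ h′ → ⊥-elim (exact-≢0 e (zs i h′)))
        , (λ { refl → ≤-reflexive (cong (λ z → b * z + a * suc M) (exact-unique (proj₂ E) e)) , ⊥-elim ∘ irrefl }) ]′ (split h) }
        where E = exact-exists nz
      go (no nz) (inj₂ V) = inj₂ (choose (<-cmp (b * val + a * at) (b * u + a * suc M)))
        where
        open VertexUpto V
        E = exact-exists nz
        u = proj₁ E
        new : ∀ {v} → Exact r v (f (suc M)) → u ≡ v
        new = exact-unique (proj₂ E)
        keep : b * val + a * at ≤ b * u + a * suc M → (suc M ⊳ at → b * val + a * at < b * u + a * suc M) → VertexUpto (suc M)
        keep le lt = record { VertexUpto V ; least = λ i v h e →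
          [ (λ h′ → least i v h′ e)
          , (λ { refl → subst (λ z → b * val + a * at ≤ b * z + a * suc M × (suc M ⊳ at → b * val + a * at < b * z + a * suc M)) (new e) (le , lt) })
          ]′ (split h) }
        replace : b * u + a * suc M ≤ b * val + a * at → (∀ {i} → i ⊳ suc M → b * u + a * suc M < b * val + a * at ⊎ i ⊳ at) → VertexUpto (suc M)
        replace le lt = record { at = suc M ; val = u ; exact = proj₂ E ; least = λ i v h e →
          [ (λ h′ → ≤-trans le (proj₁ (least i v h′ e))
                  , λ o → [ (λ s → ≤-trans s (proj₁ (least i v h′ e))) , (λ o′ → ≤-<-trans le (proj₂ (least i v h′ e) o′)) ]′ (lt o))
          , (λ { refl → ≤-reflexive (cong (λ z → b * z + a * suc M) (new e)) , ⊥-elim ∘ irrefl }) ]′ (split h) }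
        choose : Tri (b * val + a * at < b * u + a * suc M) (b * val + a * at ≡ b * u + a * suc M) (b * val + a * at > b * u + a * suc M) → VertexUpto (suc M)
        choose (tri< l _ _) = keep (<⇒≤ l) (λ _ → l)
        choose (tri> _ _ g) = replace (<⇒≤ g) (λ _ → inj₁ g)
        choose (tri≈ _ e _) with suc M ⊳? at
        ... | yes o = replace (≤-reflexive (sym e)) (λ o′ → inj₂ (⊳-trans o′ o))
        ... | no ¬o = keep (≤-reflexive e) (λ o → ⊥-elim (¬o o))

    vertex : ∀ N → Support N f → (∃ λ i → f i ≢ pos 0) → Vertex T b a f
    vertex N sup (i₀ , ne) with vertex-upto N
    ... | inj₁ zs = ⊥-elim (ne (case N <? i₀ of λ { (yes l) → sup i₀ l ; (no ¬l) → zs i₀ (≮⇒≥ ¬l) }))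
    ... | inj₂ V  = record { VertexUpto V ; least = λ i v e → proj₁ (VertexUpto.least V i v (within e) e)
                           ; strict = λ i v e → proj₂ (VertexUpto.least V i v (within e) e) }
      where
      within : ∀ {i v} → Exact r v (f i) → i ≤ N
      within {i} e = ≮⇒≥ (λ l → exact-≢0 e (sup i l))

  opaque
    -- Dumas's theorem: vertices of Newton polygons add. In any other pair with the same sum of
    -- indices, one of the two indices comes before the vertex in the order of the tie, so by
    -- `strict` the pair lies strictly above the supporting lines.
    conv-vertex : ∀ {T b a f g} → 1 ≤ b → (V : Vertex T b a f) (W : Vertex T b a g) → let open Vertex in
      Exact r (val V + val W) (conv f g (at V + at W))
    conv-vertex {T} {b} {a} {f} {g} 1≤b V W = conv-exact f g V.at W.at (exact-* V.exact W.exact) divisible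
      where
      module V = Vertex V
      module W = Vertex W
      open Tie T
      bigger : ∀ i j u v → i + j ≡ V.at + W.at → Exact r u (f i) → Exact r v (g j) → i ≢ V.at → V.val + W.val < u + v
      bigger i j u v eq eu ev ne = *-cancelˡ-< b (V.val + W.val) (u + v) (+-cancelʳ-< (a * (V.at + W.at)) _ _
        (subst₂ _<_ (weight-+ b a V.val W.val V.at W.at)
          (trans (weight-+ b a u v i j) (cong (λ z → b * (u + v) + a * z) eq))
          ([ (λ o → +-mono-<-≤ (V.strict i u eu o) (W.least j v ev))
           , (λ o → +-mono-≤-< (V.least i u eu) (W.strict j v ev (reverse eq o))) ]′ (total ne))))
      divisible : ∀ i j → i + j ≡ V.at + W.at → i ≢ V.at → r ^ suc (V.val + W.val) ∣ abs (f i ℤ.* g j)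
      divisible i j eq ne with f i ℤ.≟ pos 0 | g j ℤ.≟ pos 0
      ... | yes z | _     = subst (λ y → r ^ suc (V.val + W.val) ∣ abs (y ℤ.* g j)) (sym z) (_∣0 _)
      ... | no _  | yes z = subst (λ y → r ^ suc (V.val + W.val) ∣ abs y) (sym (trans (cong (f i ℤ.*_) z) (ℤ.*-zeroʳ (f i)))) (_∣0 _)
      ... | no x  | no y with exact-exists x | exact-exists y
      ...   | u , eu | v , ev = exact-∣ _ (exact-* eu ev) (bigger i j u v eq eu ev ne)

record Factored (n k : ℕ) (F : ℕ → ℤ) : Set where
  field
    P Q  : ℕ → ℤ
    D    : ℤ
    D≢0  : D ≢ pos 0
    supP : Support k P
    lead : P k ≢ pos 0
    supQ : Support (n ∸ k) Q
    prod : ∀ j → conv P Q j ≡ D ℤ.* F j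

module Newton {r n k : ℕ} {F : ℕ → ℤ} (pr : Prime r) (1≤k : 1 ≤ k) (k≤n : k ≤ n) (fac : Factored n k F) (Fn≢0 : F n ≢ pos 0) where
  open Valuation pr
  open Factored fac

  opaque
    δ : ℕ
    δ = proj₁ (exact-exists D≢0)

    exact-D : Exact r δ D
    exact-D = proj₂ (exact-exists D≢0)

  opaque
    exact-prod : ∀ {e} j → Exact r e (F j) → Exact r (δ + e) (conv P Q j)
    exact-prod j h = subst (Exact r _) (sym (prod j)) (exact-* exact-D h)

  opaque
    exact-F : ∀ {e} j → Exact r e (conv P Q j) → ∃ λ e′ → δ + e′ ≡ e × Exact r e′ (F j)
    exact-F {e} j h with exact-exists {F j} (λ z → exact-≢0 h (trans (prod j) (trans (cong (D ℤ.*_) z) (ℤ.*-zeroʳ D))))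
    ... | e′ , x = e′ , exact-unique (exact-prod j x) h , x

  P-index : ∀ {e i} → Exact r e (P i) → i ≤ k
  P-index {i = i} h = ≮⇒≥ (λ l → exact-≢0 h (supP i l))

  Q-index : ∀ {e i} → Exact r e (Q i) → i ≤ n ∸ k
  Q-index {i = i} h = ≮⇒≥ (λ l → exact-≢0 h (supQ i l))

  Q≢0 : ∃ λ j → Q j ≢ pos 0
  Q≢0 with conv-witness P Q n (exact-prod n (proj₂ (exact-exists Fn≢0)))
  ... | _ , j , _ , _ , _ , _ , h , _ = j , exact-≢0 h

  opaque
    vP : ∀ T b a → Vertex T b a P
    vP T b a = vertex T b a P k supP (k , lead)

    vQ : ∀ T b a → Vertex T b a Q
    vQ T b a = vertex T b a Q (n ∸ k) supQ Q≢0

  module _ {E₀ : ℕ} (E-n : Exact r 0 (F n)) (div : ∀ j → j + k ≤ n → r ∣ abs (F j)) (E-0 : Exact r E₀ (F 0))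
           (above : ∀ j e → 1 ≤ j → Exact r e (F j) → k * E₀ < k * e + j) where

    -- By `div` at most k coefficients of F, the top ones, are prime to r, while Q has degree n − k; so the polygon of P has a segment of positive slope;
    -- by `above` its slope is below 1/k, and a drop of at least 1 would need more than k steps.
    no-factor : ⊥
    no-factor = <⇒≱ far (P-index V.exact)
      where
      module V = Vertex (vP lowest 1 0)
      module W = Vertex (vQ lowest 1 0)
      module V′ = Vertex (vP highest k 1)
      module W′ = Vertex (vQ highest k 1)
      -- F n is prime to r, so the least valuations in P and Q add up to at most that of D.
      flat : V.val + W.val ≤ δ
      flat with conv-witness P Q n (exact-prod n E-n)
      ... | i , j , u , v , _ , hu , hv , le = ≤-trans (+-mono-≤ (drop V.val u V.at i (V.least i u hu)) (drop W.val v W.at j (W.least j v hv))) (subst (u + v ≤_) (+-identityʳ δ) le)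
        where
        drop : ∀ x y i j → 1 * x + 0 * i ≤ 1 * y + 0 * j → x ≤ y
        drop x y _ _ = subst₂ _≤_ (trans (+-identityʳ (1 * x)) (*-identityˡ x)) (trans (+-identityʳ (1 * y)) (*-identityˡ y))
      -- Otherwise F would have a coefficient prime to r at the index `W.at`, which is at most n -
      -- k.
      positive : 0 < V.at
      positive with exact-F (V.at + W.at) (conv-vertex (s≤s z≤n) (vP lowest 1 0) (vQ lowest 1 0))
      ... | e , eq , h = n≢0⇒n>0 λ z → ∤-abs h (subst (λ y → r ^ suc y ∣ abs (F (V.at + W.at)))
              (sym (n≤0⇒n≡0 (+-cancelˡ-≤ δ e 0 (subst₂ _≤_ (sym eq) (sym (+-identityʳ δ)) flat))))
              (subst (_∣ abs (F (V.at + W.at))) (sym (*-identityʳ r))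
                (div _ (subst (λ y → y + W.at + k ≤ n) (sym z) (≤-trans (+-monoˡ-≤ k (Q-index W.exact)) (≤-reflexive (m∸n+n≡m k≤n)))))))
      -- By `above` a line of slope -1/k touches the polygon of F at 0 alone. The tie `highest`
      -- picks the last contact point of each factor, so P and Q have no other one either.
      contact-0 : V′.at + W′.at ≡ 0
      contact-0 with exact-F (V′.at + W′.at) (conv-vertex 1≤k (vP highest k 1) (vQ highest k 1)) | conv-witness P Q 0 (exact-prod 0 E-0)
      ... | e , eq , h | zero , zero , u , v , _ , hu , hv , le = n≤0⇒n≡0 (≮⇒≥ λ 1≤m → <⇒≱ (above _ e 1≤m h)
        (+-cancelˡ-≤ (k * δ) _ _ (begin
          k * δ + (k * e + (V′.at + W′.at))                 ≡⟨ shift k δ e (V′.at + W′.at) ⟩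
          k * (δ + e) + 1 * (V′.at + W′.at)                 ≡⟨ cong (λ z → k * z + 1 * (V′.at + W′.at)) eq ⟩
          k * (V′.val + W′.val) + 1 * (V′.at + W′.at)       ≡⟨ sym (weight-+ k 1 V′.val W′.val V′.at W′.at) ⟩
          V′.level + W′.level                             ≤⟨ +-mono-≤ (V′.least 0 u hu) (W′.least 0 v hv) ⟩
          k * u + 0 + (k * v + 0)                           ≡⟨ unshift k u v ⟩
          k * (u + v)                                       ≤⟨ *-monoʳ-≤ k le ⟩
          k * (δ + E₀)                                      ≡⟨ *-distribˡ-+ k δ E₀ ⟩
          k * δ + k * E₀                                    ∎)))
        where
        open ≤-Reasoning
        shift : ∀ k δ e m → k * δ + (k * e + m) ≡ k * (δ + e) + 1 * m
        shift = solve-∀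
        unshift : ∀ k u v → k * u + 0 + (k * v + 0) ≡ k * (u + v)
        unshift = solve-∀
      at-0 : V′.at ≡ 0
      at-0 = m+n≡0⇒m≡0 V′.at contact-0
      higher : V.val < V′.val
      higher = subst₂ _<_ (trans (+-identityʳ (1 * V.val)) (*-identityˡ V.val)) (trans (+-identityʳ (1 * V′.val)) (*-identityˡ V′.val))
        (V.strict 0 V′.val (subst (λ z → Exact r V′.val (P z)) at-0 V′.exact) positive)
      far : k < V.at
      far = +-cancelˡ-< (k * V.val) _ _ (begin-strict
        k * V.val + k               ≡⟨ +-comm _ k ⟩
        k + k * V.val               ≡⟨ sym (*-suc k V.val) ⟩
        k * suc V.val               ≤⟨ *-monoʳ-≤ k higher ⟩
        k * V′.val                  ≤⟨ m≤m+n _ _ ⟩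
        V′.level                   <⟨ V′.strict V.at V.val V.exact (subst (_< V.at) (sym at-0) positive) ⟩
        k * V.val + 1 * V.at        ≡⟨ cong (λ z → k * V.val + z) (*-identityˡ V.at) ⟩
        k * V.val + V.at            ∎)
        where open ≤-Reasoning

  opaque
    -- Raised by the valuation of D, a supporting line of the polygon of F is the sum of parallel
    -- supporting lines for P and Q, so every contact point of F splits into contact points of the
    -- two factors.
    contact : ∀ {b a w} → 1 ≤ b → (∀ j e → Exact r e (F j) → w ≤ b * e + a * j) →
      ∃ λ c → ∀ j e → Exact r e (F j) → b * e + a * j ≤ w → ∃ λ i → ∃ λ u → i ≤ j × i ≤ k × j ∸ i ≤ n ∸ k × b * u + a * i ≡ c
    contact {b} {a} {w} 1≤b low = V.level , hit
      where
      module V = Vertex (vP lowest b a)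
      module W = Vertex (vQ lowest b a)
      m : ℕ
      m = V.at + W.at
      base : b * δ + w ≤ V.level + W.level
      base with exact-F m (conv-vertex 1≤b (vP lowest b a) (vQ lowest b a))
      ... | e , eq , h = ≤-trans (+-monoʳ-≤ (b * δ) (low m e h)) (≤-reflexive
            (trans (trans (sym (+-assoc (b * δ) _ _)) (cong (_+ a * m) (trans (sym (*-distribˡ-+ b δ e)) (cong (b *_) eq))))
              (sym (weight-+ b a V.val W.val V.at W.at))))
      hit : ∀ j e → Exact r e (F j) → b * e + a * j ≤ w → ∃ λ i → ∃ λ u → i ≤ j × i ≤ k × j ∸ i ≤ n ∸ k × b * u + a * i ≡ V.level
      hit j e h le with conv-witness P Q j (exact-prod j h)
      ... | i , i′ , u , v , refl , hu , hv , u+v≤ = i , u , m≤m+n i i′ , P-index hu ,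
            subst (_≤ n ∸ k) (sym (m+n∸m≡n i i′)) (Q-index hv) , ≤-antisym upper (V.least i u hu)
        where
        upper : b * u + a * i ≤ V.level
        upper = +-cancelʳ-≤ W.level _ _ (≤-trans (+-monoʳ-≤ (b * u + a * i) (W.least i′ v hv)) (≤-trans (≤-reflexive (weight-+ b a u v i i′))
          (≤-trans (+-monoˡ-≤ (a * (i + i′)) (*-monoʳ-≤ b u+v≤)) (≤-trans (≤-reflexive
            (trans (cong (_+ a * (i + i′)) (*-distribˡ-+ b δ e)) (+-assoc (b * δ) _ _))) (≤-trans (+-monoʳ-≤ (b * δ) le) base)))))

  -- For an edge of slope -a/b from L to n, the degrees force the part of the end n that falls to P
  -- to be k, while the end L gives some i ≤ L. Both points lie on one line with integral heights,
  -- so b divides a (k - i).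
  edge-denominator : ∀ {b a w L E-L E-n} → 1 ≤ b → (∀ j e → Exact r e (F j) → w ≤ b * e + a * j) →
    Exact r E-L (F L) → b * E-L + a * L ≤ w → Exact r E-n (F n) → b * E-n + a * n ≤ w →
    ∃ λ i → i ≤ L × b ∣ a * (k ∸ i)
  edge-denominator {b} {a} 1≤b low hL leL hn len with contact {a = a} 1≤b low
  ... | c , hit with hit _ _ hL leL | hit _ _ hn len
  ...   | i , u , i≤L , i≤k , _ , eq | i′ , u′ , _ , i′≤k , n∸i′≤ , eq′ = i , i≤L ,
            ∣m+n∣m⇒∣n (subst (b ∣_) total (m∣m*n u)) (m∣m*n u′)
    where
    i′≡k : i′ ≡ k
    i′≡k = ≤-antisym i′≤k (+-cancelʳ-≤ (n ∸ k) k i′ (subst (_≤ i′ + (n ∸ k)) (sym (m+[n∸m]≡n k≤n))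
      (subst (_≤ i′ + (n ∸ k)) (m+[n∸m]≡n (≤-trans i′≤k k≤n)) (+-monoʳ-≤ i′ n∸i′≤))))
    total : b * u ≡ b * u′ + a * (k ∸ i)
    total = +-cancelʳ-≡ (a * i) _ _ (trans eq (trans (sym eq′) (trans (cong (λ z → b * u′ + a * z) (trans i′≡k (sym (m∸n+n≡m i≤k))))
      (trans (cong (λ z → b * u′ + z) (*-distribˡ-+ a (k ∸ i) i)) (sym (+-assoc (b * u′) _ _))))))

-- The coefficients of n! G

*-exchange : ∀ x y z → x * (y * z) ≡ y * (x * z)
*-exchange = solve-∀

∣-term-∏ : ∀ n f {d} → 1 ≤ d → d ≤ n → f d ∣ ∏ n f
∣-term-∏ zero    f 1≤d d≤0 = ⊥-elim (<⇒≱ 1≤d d≤0)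
∣-term-∏ (suc n) f 1≤d d≤n with m≤n⇒m<n∨m≡n d≤n
... | inj₁ (s≤s l) = ∣-trans (∣-term-∏ n f 1≤d l) (m∣m*n (f (suc n)))
... | inj₂ refl    = ∣n⇒∣m*n (∏ n f) ∣-refl

-- The multiples of p up to j are p, 2p, ..., ⌊j/p⌋ p; the other factors make up u.
factorial-split : ∀ {p} → Prime p → ∀ j → ∃ λ u → ¬ p ∣ u × j ! ≡ p ^ (j ÷ p) * ((j ÷ p) ! * u)
factorial-split {p} pp zero = 1 , (λ h → <⇒≢ (prime≥2 pp) (sym (∣1⇒≡1 h)))
  , sym (cong (λ z → p ^ z * (z ! * 1)) (<⇒÷≡0 (prime≥1 pp)))
factorial-split {p} pp (suc j) with factorial-split pp j | p ∣? suc j in dec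
... | u , n , eq | no ∤ = suc j * u , (λ h → [ ∤ , n ]′ (euclidsLemma (suc j) u pp h)) ,
        trans (trans (cong (suc j *_) eq) (s (suc j) (p ^ (j ÷ p)) ((j ÷ p) !) u)) (cong (λ z → p ^ z * (z ! * (suc j * u))) (sym step))
  where
  step : suc j ÷ p ≡ j ÷ p
  step = trans (÷-suc j p (prime≥1 pp)) (trans (cong (j ÷ p +_) (χ-no (p ∣? suc j) ∤)) (+-identityʳ _))
  s : ∀ a x t u → a * (x * (t * u)) ≡ x * (t * (a * u))
  s = solve-∀
... | u , n , eq | yes d = u , n ,
        trans (trans (cong₂ _*_ sj eq) (s (suc (j ÷ p)) p (p ^ (j ÷ p)) ((j ÷ p) !) u)) (cong (λ z → p ^ z * (z ! * u)) (sym step))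
  where
  step : suc j ÷ p ≡ suc (j ÷ p)
  step = trans (÷-suc j p (prime≥1 pp)) (trans (cong (j ÷ p +_) (χ-yes (p ∣? suc j) d)) (+-comm (j ÷ p) 1))
  sj : suc j ≡ suc (j ÷ p) * p
  sj = trans (_∣_.equality d) (cong (_* p) (trans (sym (*÷ (_∣_.quotient d) p (prime≥1 pp)))
    (trans (cong (_÷ p) (sym (_∣_.equality d))) step)))
  s : ∀ a p x t u → a * p * (x * (t * u)) ≡ p * x * (a * t * u)
  s = solve-∀

-- With t = ⌊j/p⌋ the valuation is t + v_p(t!), and for t > 0 induction gives (p-1) t + (p-1)
-- v_p(t!) < p t ≤ j.
legendre-bound : ∀ {q} → Prime (suc q) → ∀ j → 1 ≤ j → ∀ v → suc q ^ v ∣ j ! → q * v < j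
legendre-bound {q} pp = <-rec _ go
  where
  p = suc q
  go : ∀ j → (∀ {i} → i < j → 1 ≤ i → ∀ v → p ^ v ∣ i ! → q * v < i) → 1 ≤ j → ∀ v → p ^ v ∣ j ! → q * v < j
  go j rec 1≤j v d with factorial-split pp j
  ... | u , n , eq with j ÷ p ≟ 0
  ...   | yes z = subst (_< j) (sym (trans (cong (q *_) (n≤0⇒n≡0 (^∣^*⇒≤ pp v 0 u n
            (subst (p ^ v ∣_) (trans eq (cong (λ z → p ^ z * (z ! * u)) z ) ∙ s u) d)))) (*-zeroʳ q))) 1≤j
    where
    _∙_ : ∀ {x y z : ℕ} → x ≡ y → y ≡ z → x ≡ z
    _∙_ = trans
    s : ∀ u → p ^ 0 * (1 * u) ≡ p ^ 0 * u
    s u = cong (p ^ 0 *_) (*-identityˡ u)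
  ...   | no t≢0 with val-split pp ((j ÷ p) !) (n!≥1 (j ÷ p))
  ...     | a , w , eq′ , n′ = begin-strict
      q * v                           ≤⟨ *-monoʳ-≤ q v≤ ⟩
      q * (j ÷ p + a)                 ≡⟨ *-distribˡ-+ q (j ÷ p) a ⟩
      q * (j ÷ p) + q * a             <⟨ +-monoʳ-< (q * (j ÷ p)) (rec t<j (n≢0⇒n>0 t≢0) a (subst (p ^ a ∣_) (sym eq′) (m∣m*n w))) ⟩
      q * (j ÷ p) + j ÷ p             ≡⟨ trans (+-comm _ (j ÷ p)) (*-comm p (j ÷ p)) ⟩
      (j ÷ p) * p                     ≤⟨ ÷*≤ j p ⟩
      j                               ∎
    where
    open ≤-Reasoning
    t<j : j ÷ p < j
    t<j = <-≤-trans (m<m*n (j ÷ p) p {{≢-nonZero t≢0}} (prime≥2 pp)) (÷*≤ j p)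
    v≤ : v ≤ j ÷ p + a
    v≤ = ^∣^*⇒≤ pp v (j ÷ p + a) (w * u) (λ h → [ n′ , n ]′ (euclidsLemma w u pp h))
      (subst (p ^ v ∣_) (trans eq (trans (cong (λ z → p ^ (j ÷ p) * (z * u)) eq′)
        (trans (s (p ^ (j ÷ p)) (p ^ a) w u) (cong (_* (w * u)) (sym (^-distribˡ-+-* p (j ÷ p) a)))))) d)
      where
      s : ∀ x y w u → x * (y * w * u) ≡ x * y * (w * u)
      s = solve-∀

-- The integer n! a_j / j!, as n!/j! is the product of j + 1, ..., n.
lcoef : ℕ → ℕ → ℕ → ℕ
lcoef n s j = aCoef n s j * ∏ (n ∸ j) (λ i → j + i)

lcoef-! : ∀ n s {j} → j ≤ n → j ! * lcoef n s j ≡ aCoef n s j * n !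
lcoef-! n s {j} j≤n = trans (*-exchange (j !) (aCoef n s j) _) (cong (aCoef n s j *_) (trans (∏-rising j (n ∸ j)) (cong _! (m+[n∸m]≡n j≤n))))

lcoef-top : ∀ n s → lcoef n s n ≡ 1
lcoef-top n s rewrite n∸n≡0 n = *-identityʳ ((n + s ∸ n) C 0)

lcoef-bottom : ∀ n s → lcoef n s 0 ≡ bin n s * n !
lcoef-bottom n s = cong₂ _*_ (trans (nCk≡nC[n∸k] (m≤m+n n s)) (cong ((n + s) C_) (m+n∸m≡n n s))) (∏-fact n)

-- n! G(x) = Σ b_j lcoef_j x^j has integral coefficients.
record Twist (n s : ℕ) (B : ℕ → ℤ) (F : ℕ → ℤ) : Set where
  field
    B-bottom : abs (B 0) ≡ 1
    B-top    : abs (B n) ≡ 1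
    F-above  : Support n F
    F-below  : ∀ {j} → j ≤ n → F j ≡ B j ℤ.* pos (lcoef n s j)

  abs-F : ∀ {j} → j ≤ n → abs (F j) ≡ abs (B j) * lcoef n s j
  abs-F {j} j≤n = trans (cong abs (F-below j≤n)) (ℤ.abs-* (B j) (pos (lcoef n s j)))

  ∣-F : ∀ {d j} → j ≤ n → d ∣ lcoef n s j → d ∣ abs (F j)
  ∣-F {d} {j} j≤n h = subst (d ∣_) (sym (abs-F j≤n)) (∣n⇒∣m*n (abs (B j)) h)

  exact-coprime : ∀ {r e j} → Prime r → j ≤ n → ¬ r ∣ abs (B j) → Exact r e (pos (lcoef n s j)) → Exact r e (F j)
  exact-coprime {r} {e} {j} pr j≤n nb ex with exact-split ex
    where open Valuation pr
  ... | w , eq , nw = split-exact (abs (B j) * w) (trans (abs-F j≤n) (trans (cong (abs (B j) *_) eq) (*-exchange (abs (B j)) (r ^ e) w)))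
        λ h → [ nb , nw ]′ (euclidsLemma (abs (B j)) w pr h)
    where open Valuation pr

  exact-unit : ∀ {r e j} → Prime r → j ≤ n → abs (B j) ≡ 1 → Exact r e (pos (lcoef n s j)) → Exact r e (F j)
  exact-unit {r} pr j≤n b = exact-coprime pr j≤n λ h → <⇒≢ (prime≥2 pr) (sym (∣1⇒≡1 (subst (r ∣_) b h)))

  exact-top : ∀ {r} → Prime r → Exact r 0 (F n)
  exact-top {r} pr = exact-unit pr ≤-refl B-top (subst (λ z → Exact r 0 (pos z)) (sym (lcoef-top n s))
    (exactly ∣-refl λ h → <⇒≢ (prime≥2 pr) (sym (∣1⇒≡1 (subst (_∣ 1) (*-identityʳ r) h)))))

  top≢0 : F n ≢ pos 0
  top≢0 e = 1+n≢0 {0} (trans (sym (cong₂ _*_ B-top (lcoef-top n s))) (trans (sym (abs-F ≤-refl)) (cong abs e)))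

  within : ∀ {r e j} → Exact r e (F j) → j ≤ n
  within {r} {e} {j} h = ≮⇒≥ λ l → ∤-abs h (subst (λ z → r ^ suc e ∣ abs z) (sym (F-above j l)) (_∣0 (r ^ suc e)))

module _ {m k s : ℕ} {B F : ℕ → ℤ} (tw : Twist (m + k) s B F) (1≤k : 1 ≤ k) (fac : Factored (m + k) k F) where
  open Twist tw

  factor⇒stuck : Stuck m k s
  factor⇒stuck zero i pp = ⊥-elim (<⇒≱ (prime≥1 pp) z≤n)
  factor⇒stuck p@(suc q) i pp k<p 1≤i i≤k p∣ with p ∣? bin (m + k) s
  ... | yes h = h
  ... | no ¬h with val-split pp ((m + k) !) (n≢0⇒n>0 (≢-nonZero⁻¹ _ {{(m + k) !≢0}}))
  ...   | E₀ , w , eq , nw = ⊥-elim (no-factor (exact-top pp) p∣low exact-0 above)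
    where
    open Valuation pp
    open Newton pp 1≤k (m≤n+m k m) fac top≢0
    p∣low : ∀ j → j + k ≤ m + k → p ∣ abs (F j)
    p∣low j le = ∣-F (≤-trans j≤m (m≤m+n m k)) (∣n⇒∣m*n (aCoef (m + k) s j) (∣-trans
      (subst (p ∣_) (sym (trans (sym (+-assoc j (m ∸ j) i)) (cong (_+ i) (m+[n∸m]≡n j≤m)))) p∣)
      (∣-term-∏ (m + k ∸ j) (j +_) (≤-trans 1≤i (m≤n+m i (m ∸ j)))
        (≤-trans (+-monoʳ-≤ (m ∸ j) i≤k) (≤-reflexive (sym (+-∸-comm k j≤m)))))))
      where
      j≤m : j ≤ m
      j≤m = +-cancelʳ-≤ k j m le
    -- Since p ∤ C(n+s, s), the valuation of the constant coefficient is that of n! alone.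
    exact-0 : Exact p E₀ (F 0)
    exact-0 = exact-unit pp z≤n B-bottom (split-exact (bin (m + k) s * w)
      (trans (lcoef-bottom (m + k) s) (trans (cong (bin (m + k) s *_) eq) (*-exchange (bin (m + k) s) (p ^ E₀) w)))
      λ h → [ ¬h , nw ]′ (euclidsLemma (bin (m + k) s) w pp h))
    above : ∀ j e → 1 ≤ j → Exact p e (F j) → k * E₀ < k * e + j
    -- v and u are the valuations of j! and n!/j!. They satisfy E₀ ≤ u + v and u ≤ e, and p > k
    -- enters as k v ≤ (p-1) v < j.
    above j e 1≤j h with val-split pp (j !) (n≢0⇒n>0 (≢-nonZero⁻¹ _ {{j !≢0}}))
                      | val-split pp (∏ (m + k ∸ j) (j +_)) (∏-≥1 (m + k ∸ j) (j +_) (λ d _ _ → ≤-trans 1≤j (m≤m+n j d)))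
    ... | v , x , ev , nx | u , y , eu , ny = begin-strict
        k * E₀              ≤⟨ *-monoʳ-≤ k E₀≤ ⟩
        k * (u + v)         ≡⟨ *-distribˡ-+ k u v ⟩
        k * u + k * v       ≤⟨ +-mono-≤ (*-monoʳ-≤ k u≤e) (*-monoˡ-≤ v (s≤s⁻¹ k<p)) ⟩
        k * e + q * v       <⟨ +-monoʳ-< (k * e) (legendre-bound pp j 1≤j v (subst (p ^ v ∣_) (sym ev) (m∣m*n x))) ⟩
        k * e + j           ∎
      where
      open ≤-Reasoning
      u≤e : u ≤ e
      u≤e = exact-≥ u h (∣-F (within h) (∣n⇒∣m*n (aCoef (m + k) s j) (subst (p ^ u ∣_) (sym eu) (m∣m*n y))))
      E₀≤ : E₀ ≤ u + v
      E₀≤ = ^∣^*⇒≤ pp E₀ (u + v) (x * y) (λ h′ → [ nx , ny ]′ (euclidsLemma x y pp h′))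
        (subst (p ^ E₀ ∣_) (trans (sym eq) (trans (sym (trans (∏-rising j (m + k ∸ j)) (cong _! (m+[n∸m]≡n (within h)))))
          (trans (cong₂ _*_ ev eu) (trans (s₂ (p ^ v) x (p ^ u) y) (cong (_* (x * y)) (sym (^-distribˡ-+-* p u v))))))) (m∣m*n w))
        where
        s₂ : ∀ a x b y → a * x * (b * y) ≡ b * a * (x * y)
        s₂ = solve-∀

-- Newton polygons of the exceptional triples

does-sound : {P : Set} (d : Dec P) → T (does d) → P
does-sound (yes p) _ = p

does-refutes : {P : Set} (d : Dec P) → does d ≡ false → ¬ P
does-refutes (no ¬p) _ = ¬p

smallPrime : ∀ p {_ : True (prime? p)} → Prime p
smallPrime p {w} = toWitness w

-- Eisenstein's criterion for the coefficients up to n - k, which is `no-factor` with E₀ = 1. It is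
-- applied to primes r with n < r ≤ s + k: they divide a_j itself for j ≤ n - k and are invisible to
-- `Stuck`.
eisensteinᵇ : ℕ → ℕ → ℕ → ℕ → Bool
eisensteinᵇ r n k s = all< (suc (n ∸ k)) (λ j → does (r ∣? lcoef n s j)) ∧ not (does (r ^ 2 ∣? lcoef n s 0))

exactᵇ : ℕ → ℕ → ℕ → Bool
exactᵇ r e c = does (r ^ e ∣? c) ∧ not (does (r ^ suc e ∣? c))

exactᵇ-sound : ∀ r e c → exactᵇ r e c ≡ true → Exact r e (pos c)
exactᵇ-sound r e c h with r ^ e ∣? c | r ^ suc e ∣? c
... | yes d | no n = exactly d n

-- Whether b v(F_j) + a j ≥ w for all j ≤ n, given that r ^ x j divides b_j.
aboveᵇ : (ℕ → ℕ) → ℕ → ℕ → ℕ → ℕ → ℕ → ℕ → Bool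
aboveᵇ x b a w r n s = all< (suc n) λ j →
  does (r ^ ((w ∸ a * j + b ∸ 1) ÷ b ∸ x j) ∣? lcoef n s j) ∧ (w ≤ᵇ b * ((w ∸ a * j + b ∸ 1) ÷ b) + a * j)

module _ {n k s : ℕ} {B F : ℕ → ℤ} (tw : Twist n s B F) (1≤k : 1 ≤ k) (2k≤n : 2 * k ≤ n) (fac : Factored n k F) where
  open Twist tw

  k≤n∸k : k ≤ n ∸ k
  k≤n∸k = m+n≤o⇒m≤o∸n k (subst (_≤ n) (cong (k +_) (+-identityʳ k)) 2k≤n)

  k≤n : k ≤ n
  k≤n = ≤-trans k≤n∸k (m∸n≤m n k)

  eisenstein : ∀ r → Prime r → eisensteinᵇ r n k s ≡ true → ⊥
  eisenstein r pr h = no-factor (exact-top pr) (λ j le → ∣-F (m+n≤o⇒m≤o j le) (low j (m+n≤o⇒m≤o∸n j le)))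
    (exact-unit pr z≤n B-bottom (exactly (subst (_∣ lcoef n s 0) (sym (*-identityʳ r)) (low 0 z≤n)) (does-refutes (r ^ 2 ∣? lcoef n s 0) square))) above
    where
    open Newton pr 1≤k k≤n fac top≢0
    open Valuation pr
    low : ∀ j → j ≤ n ∸ k → r ∣ lcoef n s j
    low j le = does-sound (r ∣? lcoef n s j) (all<-sound (suc (n ∸ k)) (λ j → does (r ∣? lcoef n s j))
      (proj₁ (Equivalence.to T-∧ (≡true⇒T h))) (s≤s le))
    square : does (r ^ 2 ∣? lcoef n s 0) ≡ false
    square = go (does (r ^ 2 ∣? lcoef n s 0)) (proj₂ (Equivalence.to (T-∧ {all< (suc (n ∸ k)) (λ j → does (r ∣? lcoef n s j))}) (≡true⇒T h)))
      where
      go : ∀ x → T (not x) → x ≡ false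
      go false _ = refl
    above : ∀ j e → 1 ≤ j → Exact r e (F j) → k * 1 < k * e + j
    above j e 1≤j ex with j ≤? n ∸ k
    ... | yes le = ≤-<-trans (*-monoʳ-≤ k (exact-≥ 1 ex (∣-F (within ex) (subst (_∣ lcoef n s j) (sym (*-identityʳ r)) (low j le)))))
                     (subst (_< k * e + j) (+-identityʳ _) (+-monoʳ-< (k * e) 1≤j))
    ... | no gt  = subst (_< k * e + j) (sym (*-identityʳ k)) (<-≤-trans (≤-<-trans k≤n∸k (≰⇒> gt)) (m≤n+m j (k * e)))

  edge : ∀ x b a w r L E → Prime r → 1 ≤ b → (∀ j → r ^ x j ∣ abs (B j)) → aboveᵇ x b a w r n s ≡ true →
    Exact r E (F L) → b * E + a * L ≤ w → a * n ≤ w → ∃ λ i → i ≤ L × b ∣ a * (k ∸ i)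
  edge x b a w r L E pr 1≤b bd h eL leL len = edge-denominator {b = b} {a = a} {w = w} 1≤b low eL leL (exact-top pr)
      (≤-trans (≤-reflexive (cong (_+ a * n) (*-zeroʳ b))) len)
    where
    open Newton pr 1≤k k≤n fac top≢0
    open Valuation pr
    V : ℕ → ℕ
    V j = (w ∸ a * j + b ∸ 1) ÷ b
    low : ∀ j e → Exact r e (F j) → w ≤ b * e + a * j
    low j e ex with Equivalence.to (T-∧ {does (r ^ (V j ∸ x j) ∣? lcoef n s j)}) (all<-sound (suc n)
        (λ j → does (r ^ (V j ∸ x j) ∣? lcoef n s j) ∧ (w ≤ᵇ b * V j + a * j)) (≡true⇒T h) (s≤s (within ex)))
    ... | d , le = ≤-trans (≤ᵇ⇒≤ w _ le) (+-monoˡ-≤ (a * j) (*-monoʳ-≤ b (exact-≥ (V j) ex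
          (∣-trans (m≤n⇒^∣^ (m≤n+m∸n (V j) (x j)))
            (subst₂ _∣_ (sym (^-distribˡ-+-* r (x j) (V j ∸ x j))) (sym (abs-F (within ex)))
              (*-pres-∣ (bd j) (does-sound (r ^ (V j ∸ x j) ∣? lcoef n s j) d)))))))
      where
      m≤n⇒^∣^ : ∀ {c v} → c ≤ v → r ^ c ∣ r ^ v
      m≤n⇒^∣^ {c} {v} le = subst (r ^ c ∣_) (*-identityʳ (r ^ v)) (≤⇒^∣^* r 1 le)

  edge-0 : ∀ b a w r E → Prime r → 1 ≤ b → aboveᵇ (λ _ → 0) b a w r n s ≡ true →
    exactᵇ r E (lcoef n s 0) ≡ true → b * E + a * 0 ≤ w → a * n ≤ w → b ∣ a * k
  edge-0 b a w r E pr 1≤b h ex le len = at-0 (edge (λ _ → 0) b a w r 0 E pr 1≤b (λ j → 1∣ _) h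
    (exact-unit pr z≤n B-bottom (exactᵇ-sound r E _ ex)) le len)
    where
    at-0 : (∃ λ i → i ≤ 0 × b ∣ a * (k ∸ i)) → b ∣ a * k
    at-0 (zero , _ , d) = d

exceptional⇒10,5,4 : ∀ {n k s B F} → (n , k , s) ∈ Exceptional → Twist n s B F → Factored n k F → n ≡ 10 × k ≡ 5 × s ≡ 4
exceptional⇒10,5,4 (here refl) tw fac =
  -- At 2 the polygon is the single edge from (0, 3) to (4, 0), so 4 would divide 3 · 2.
  ⊥-elim (does-refutes (4 ∣? 6) refl (edge-0 tw (≤! 1 2 refl) (≤! 4 4 refl) fac 4 3 12 2 3 (smallPrime 2) (≤! 1 4 refl) refl refl (≤! 12 12 refl) (≤! 12 12 refl)))
exceptional⇒10,5,4 (there (here refl)) tw fac = ⊥-elim (eisenstein tw (≤! 1 3 refl) (≤! 6 6 refl) fac 7 (smallPrime 7) refl)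
exceptional⇒10,5,4 (there (there (here refl))) tw fac =
  -- At 3 the polygon is the single edge from (0, 4) to (9, 0), and 9 divides neither 4 · 3 nor, in
  -- the next two cases, 4 · 4.
  ⊥-elim (does-refutes (9 ∣? 12) refl (edge-0 tw (≤! 1 3 refl) (≤! 6 9 refl) fac 9 4 36 3 4 (smallPrime 3) (≤! 1 9 refl) refl refl (≤! 36 36 refl) (≤! 36 36 refl)))
exceptional⇒10,5,4 (there (there (there (here refl)))) tw fac =
  ⊥-elim (does-refutes (9 ∣? 16) refl (edge-0 tw (≤! 1 4 refl) (≤! 8 9 refl) fac 9 4 36 3 4 (smallPrime 3) (≤! 1 9 refl) refl refl (≤! 36 36 refl) (≤! 36 36 refl)))
exceptional⇒10,5,4 (there (there (there (there (here refl))))) tw fac =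
  ⊥-elim (does-refutes (9 ∣? 16) refl (edge-0 tw (≤! 1 4 refl) (≤! 8 9 refl) fac 9 4 36 3 4 (smallPrime 3) (≤! 1 9 refl) refl refl (≤! 36 36 refl) (≤! 36 36 refl)))
exceptional⇒10,5,4 (there (there (there (there (there (here refl)))))) tw fac = refl , refl , refl
-- For (10, 5, 5) the polygon at 3 depends on b_1. If 3 ∣ b_1 it is one edge from (0, 5) to (10, 0)
-- of slope -1/2. Otherwise (1, 4) lies below that line and an edge of slope -4/9 joins it to (10,
-- 0). Neither slope admits degree 5.
exceptional⇒10,5,4 {B = B} {F} (there (there (there (there (there (there (here refl))))))) tw fac with 3 ∣? abs (B 1)
... | yes d = ⊥-elim (not-L0 (edge tw (≤! 1 5 refl) (≤! 10 10 refl) fac (λ j → if j ≡ᵇ 1 then 1 else 0) 2 1 10 3 0 5 (smallPrime 3) (≤! 1 2 refl)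
        (λ { zero → 1∣ _ ; (suc zero) → d ; (suc (suc j)) → 1∣ _ }) refl
        (Twist.exact-unit tw (smallPrime 3) z≤n (Twist.B-bottom tw) (exactᵇ-sound 3 5 (lcoef 10 5 0) refl)) (≤! 10 10 refl) (≤! 10 10 refl)))
  where
  not-L0 : ¬ (∃ λ i → i ≤ 0 × 2 ∣ 1 * (5 ∸ i))
  not-L0 (zero , _ , h) = does-refutes (2 ∣? 5) refl h
... | no n = ⊥-elim (not-L1 (edge tw (≤! 1 5 refl) (≤! 10 10 refl) fac (λ _ → 0) 9 4 40 3 1 4 (smallPrime 3) (≤! 1 9 refl)
        (λ _ → 1∣ _) refl exact-1 (≤! 40 40 refl) (≤! 40 40 refl)))
  where
  exact-1 : Exact 3 4 (F 1)
  exact-1 = Twist.exact-coprime tw (smallPrime 3) (≤! 1 10 refl) n (exactᵇ-sound 3 4 (lcoef 10 5 1) refl)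
  not-L1 : ¬ (∃ λ i → i ≤ 1 × 9 ∣ 4 * (5 ∸ i))
  not-L1 (zero , _ , h)     = does-refutes (9 ∣? 20) refl h
  not-L1 (suc zero , _ , h) = does-refutes (9 ∣? 16) refl h
  not-L1 (suc (suc _) , s≤s () , _)
exceptional⇒10,5,4 (there (there (there (there (there (there (there (here refl)))))))) tw fac = ⊥-elim (eisenstein tw (≤! 1 5 refl) (≤! 10 10 refl) fac 11 (smallPrime 11) refl)
exceptional⇒10,5,4 (there (there (there (there (there (there (there (there (here refl))))))))) tw fac = ⊥-elim (eisenstein tw (≤! 1 6 refl) (≤! 12 12 refl) fac 13 (smallPrime 13) refl)
exceptional⇒10,5,4 (there (there (there (there (there (there (there (there (there (here refl)))))))))) tw fac = ⊥-elim (eisenstein tw (≤! 1 7 refl) (≤! 14 16 refl) fac 17 (smallPrime 17) refl)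
exceptional⇒10,5,4 (there (there (there (there (there (there (there (there (there (there (here refl))))))))))) tw fac = ⊥-elim (eisenstein tw (≤! 1 8 refl) (≤! 16 16 refl) fac 17 (smallPrime 17) refl)

-- Clearing denominators

conv-scale : ∀ c f g m → conv (λ i → c ℤ.* f i) g m ≡ c ℤ.* conv f g m
conv-scale c f g zero    = ℤ.*-assoc c (f 0) (g 0)
conv-scale c f g (suc m) = trans (cong₂ ℤ._+_ (ℤ.*-assoc c (f 0) (g (suc m))) (conv-scale c (f ∘ suc) g m))
  (sym (ℤ.*-distribˡ-+ c (f 0 ℤ.* g (suc m)) (conv (f ∘ suc) g m)))

-- 2 is an arbitrary prime: the product of the leading coefficients is the only nonzero term of the
-- sum, and a finite valuation excludes 0.
conv-top≢0 : ∀ M N f g → Support M f → Support N g → f M ≢ pos 0 → g N ≢ pos 0 → conv f g (M + N) ≢ pos 0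
conv-top≢0 M N f g sf sg fM gN = exact-≢0 (conv-exact f g M N (proj₂ E) λ i j eq ne → subst (λ z → 2 ^ suc (proj₁ E) ∣ abs z) (sym (vanish i j eq ne)) (_ ∣0))
  where
  open Valuation (smallPrime 2)
  E : ∃ λ e → Exact 2 e (f M ℤ.* g N)
  E = exact-exists (*≢0 fM gN)
  vanish : ∀ i j → i + j ≡ M + N → i ≢ M → f i ℤ.* g j ≡ pos 0
  vanish i j eq ne with <-cmp i M
  ... | tri< l _ _ = trans (cong (f i ℤ.*_) (sg j (sum-reverse {M} {N} {i} {j} (sym eq) l))) (ℤ.*-zeroʳ (f i))
  ... | tri≈ _ e _ = ⊥-elim (ne e)
  ... | tri> _ _ g> = cong (ℤ._* g j) (sf i g>)

-- Only a crude bound N for the degree of the cofactor is at hand, such as the length of a list. It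
-- is lowered step by step, because a nonzero leading coefficient above n - k would give F a nonzero
-- one above n.
factored : ∀ {n k N p q D F} → k ≤ n → D ≢ pos 0 → Support k p → p k ≢ pos 0 → Support N q → Support n F →
  (∀ j → conv p q j ≡ D ℤ.* F j) → Factored n k F
factored {n} {k} {N} {p} {q} {D} {F} k≤n D≢0 sp pk sq sF eq =
  record { P = p ; Q = q ; D = D ; D≢0 = D≢0 ; supP = sp ; lead = pk ; supQ = shrink N sq ; prod = eq }
  where
  shrink : ∀ N → Support N q → Support (n ∸ k) q
  shrink N s with N ≤? n ∸ k
  ... | yes le = λ i l → s i (≤-<-trans le l)
  shrink zero    s | no gt = ⊥-elim (gt z≤n)
  shrink (suc N) s | no gt = shrink N λ i l → [ (λ l′ → s i l′) , (λ { refl → q-top }) ]′ (m≤n⇒m<n∨m≡n l)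
    where
    q-top : q (suc N) ≡ pos 0
    q-top with q (suc N) ℤ.≟ pos 0
    ... | yes z = z
    ... | no nz = ⊥-elim (conv-top≢0 k (suc N) p q sp s pk nz (trans (eq (k + suc N))
          (trans (cong (D ℤ.*_) (sF (k + suc N) (subst (_< k + suc N) (m+[n∸m]≡n k≤n) (+-monoʳ-< k (≰⇒> gt))))) (ℤ.*-zeroʳ D))))

fromℚᵘ-+ : ∀ p q → ℚ.fromℚᵘ (p ℚᵘ.+ q) ≡ ℚ.fromℚᵘ p ℚ.+ ℚ.fromℚᵘ q
fromℚᵘ-+ p q = ℚ.toℚᵘ-injective (ℚᵘ.≃-trans (ℚ.toℚᵘ-fromℚᵘ (p ℚᵘ.+ q)) (ℚᵘ.≃-sym
  (ℚᵘ.≃-trans (ℚ.toℚᵘ-homo-+ (ℚ.fromℚᵘ p) (ℚ.fromℚᵘ q)) (ℚᵘ.+-cong (ℚ.toℚᵘ-fromℚᵘ p) (ℚ.toℚᵘ-fromℚᵘ q)))))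

fromℚᵘ-* : ∀ p q → ℚ.fromℚᵘ (p ℚᵘ.* q) ≡ ℚ.fromℚᵘ p ℚ.* ℚ.fromℚᵘ q
fromℚᵘ-* p q = ℚ.toℚᵘ-injective (ℚᵘ.≃-trans (ℚ.toℚᵘ-fromℚᵘ (p ℚᵘ.* q)) (ℚᵘ.≃-sym
  (ℚᵘ.≃-trans (ℚ.toℚᵘ-homo-* (ℚ.fromℚᵘ p) (ℚ.fromℚᵘ q)) (ℚᵘ.*-cong (ℚ.toℚᵘ-fromℚᵘ p) (ℚ.toℚᵘ-fromℚᵘ q)))))

ι : ℤ → ℚ
ι z = z ℚ./ 1

ι-+ : ∀ a b → ι (a ℤ.+ b) ≡ ι a ℚ.+ ι b
ι-+ a b = trans (ℚ.fromℚᵘ-cong {mkℚᵘ (a ℤ.+ b) 0} {mkℚᵘ a 0 ℚᵘ.+ mkℚᵘ b 0} (*≡* (eq a b))) (fromℚᵘ-+ (mkℚᵘ a 0) (mkℚᵘ b 0))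
  where
  eq : ∀ a b → (a ℤ.+ b) ℤ.* (pos 1 ℤ.* pos 1) ≡ (a ℤ.* pos 1 ℤ.+ b ℤ.* pos 1) ℤ.* pos 1
  eq = ℤ-Ring.solve-∀

ι-* : ∀ a b → ι (a ℤ.* b) ≡ ι a ℚ.* ι b
ι-* a b = trans (ℚ.fromℚᵘ-cong {mkℚᵘ (a ℤ.* b) 0} {mkℚᵘ a 0 ℚᵘ.* mkℚᵘ b 0} (*≡* (eq a b))) (fromℚᵘ-* (mkℚᵘ a 0) (mkℚᵘ b 0))
  where
  eq : ∀ a b → a ℤ.* b ℤ.* (pos 1 ℤ.* pos 1) ≡ a ℤ.* b ℤ.* pos 1
  eq = ℤ-Ring.solve-∀

ι-injective : ∀ {a b} → ι a ≡ ι b → a ≡ b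
ι-injective {a} {b} e with ℚ.fromℚᵘ-injective {mkℚᵘ a 0} {mkℚᵘ b 0} e
... | *≡* eq = trans (sym (ℤ.*-identityʳ a)) (trans eq (ℤ.*-identityʳ b))

/-clear : ∀ a d .{{_ : NonZero d}} → (a ℚ./ d) ℚ.* ι (pos d) ≡ ι a
/-clear a (suc d) = trans (sym (fromℚᵘ-* (mkℚᵘ a d) (mkℚᵘ (pos (suc d)) 0)))
  (ℚ.fromℚᵘ-cong {mkℚᵘ a d ℚᵘ.* mkℚᵘ (pos (suc d)) 0} {mkℚᵘ a 0} (*≡* (eq a (pos (suc d)))))
  where
  eq : ∀ a d → a ℤ.* d ℤ.* pos 1 ≡ a ℤ.* (d ℤ.* pos 1)
  eq = ℤ-Ring.solve-∀

↥↧-clear : ∀ x → x ℚ.* ι (ℚ.↧ x) ≡ ι (ℚ.↥ x)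
↥↧-clear x = trans (cong (ℚ._* ι (ℚ.↧ x)) (sym (ℚ.↥p/↧p≡p x))) (/-clear (ℚ.↥ x) (ℚ.↧ₙ x))

cleared-0 : ∀ {D} x → D ≢ pos 0 → x ℚ.* ι D ≡ 0ℚ → x ≡ 0ℚ
cleared-0 {D} x D≢0 h = ℚ.↥p≡0⇒p≡0 x ([ id , ⊥-elim ∘ D≢0 ]′ (ℤ.i*j≡0⇒i≡0∨j≡0 (ℚ.↥ x) (ι-injective (begin
  ι (ℚ.↥ x ℤ.* D)                ≡⟨ ι-* (ℚ.↥ x) D ⟩
  ι (ℚ.↥ x) ℚ.* ι D              ≡⟨ cong (ℚ._* ι D) (sym (↥↧-clear x)) ⟩
  x ℚ.* ι (ℚ.↧ x) ℚ.* ι D        ≡⟨ cong (ℚ._* ι D) (ℚ.*-comm x (ι (ℚ.↧ x))) ⟩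
  ι (ℚ.↧ x) ℚ.* x ℚ.* ι D        ≡⟨ ℚ.*-assoc (ι (ℚ.↧ x)) x (ι D) ⟩
  ι (ℚ.↧ x) ℚ.* (x ℚ.* ι D)      ≡⟨ cong (ι (ℚ.↧ x) ℚ.*_) h ⟩
  ι (ℚ.↧ x) ℚ.* 0ℚ               ≡⟨ ℚ.*-zeroʳ (ι (ℚ.↧ x)) ⟩
  ι (pos 0)                      ∎))))
  where open ≡-Reasoning

*ℚ-interchange : ∀ a b c d → a ℚ.* b ℚ.* (c ℚ.* d) ≡ a ℚ.* c ℚ.* (b ℚ.* d)
*ℚ-interchange a b c d = begin
  a ℚ.* b ℚ.* (c ℚ.* d)   ≡⟨ ℚ.*-assoc a b (c ℚ.* d) ⟩
  a ℚ.* (b ℚ.* (c ℚ.* d)) ≡⟨ cong (a ℚ.*_) (sym (ℚ.*-assoc b c d)) ⟩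
  a ℚ.* (b ℚ.* c ℚ.* d)   ≡⟨ cong (λ z → a ℚ.* (z ℚ.* d)) (ℚ.*-comm b c) ⟩
  a ℚ.* (c ℚ.* b ℚ.* d)   ≡⟨ cong (a ℚ.*_) (ℚ.*-assoc c b d) ⟩
  a ℚ.* (c ℚ.* (b ℚ.* d)) ≡⟨ sym (ℚ.*-assoc a c (b ℚ.* d)) ⟩
  a ℚ.* c ℚ.* (b ℚ.* d)   ∎
  where open ≡-Reasoning

record Cleared (P : Poly) : Set where
  field
    D       : ℤ
    D≢0     : D ≢ pos 0
    p       : ℕ → ℤ
    cleared : ∀ m → coeff P m ℚ.* ι D ≡ ι (p m)

  vanishes : ∀ {m} → coeff P m ≡ 0ℚ → p m ≡ pos 0
  vanishes {m} h = ι-injective (trans (sym (cleared m)) (trans (cong (ℚ._* ι D) h) (ℚ.*-zeroˡ (ι D))))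

  survives : ∀ {m} → coeff P m ≢ 0ℚ → p m ≢ pos 0
  survives {m} h e = h (cleared-0 (coeff P m) D≢0 (trans (cleared m) (cong ι e)))

clear : ∀ P → Cleared P
clear []      = record { D = pos 1 ; D≢0 = λ () ; p = λ _ → pos 0 ; cleared = λ _ → ℚ.*-zeroˡ (ι (pos 1)) }
clear (a ∷ P) = record { D = ℚ.↧ a ℤ.* D ; D≢0 = λ h → [ (λ ()) , D≢0 ]′ (ℤ.i*j≡0⇒i≡0∨j≡0 (ℚ.↧ a) h)
                       ; p = λ { zero → ℚ.↥ a ℤ.* D ; (suc m) → ℚ.↧ a ℤ.* p m } ; cleared = λ { zero → head ; (suc m) → tail m } }
  where
  open Cleared (clear P)
  head : a ℚ.* ι (ℚ.↧ a ℤ.* D) ≡ ι (ℚ.↥ a ℤ.* D)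
  head = trans (cong (a ℚ.*_) (ι-* (ℚ.↧ a) D)) (trans (sym (ℚ.*-assoc a (ι (ℚ.↧ a)) (ι D)))
    (trans (cong (ℚ._* ι D) (↥↧-clear a)) (sym (ι-* (ℚ.↥ a) D))))
  tail : ∀ m → coeff P m ℚ.* ι (ℚ.↧ a ℤ.* D) ≡ ι (ℚ.↧ a ℤ.* p m)
  tail m = trans (cong (λ z → coeff P m ℚ.* ι z) (ℤ.*-comm (ℚ.↧ a) D)) (trans (cong (coeff P m ℚ.*_) (ι-* D (ℚ.↧ a)))
    (trans (sym (ℚ.*-assoc (coeff P m) (ι D) (ι (ℚ.↧ a)))) (trans (cong (ℚ._* ι (ℚ.↧ a)) (cleared m))
      (trans (sym (ι-* (p m) (ℚ.↧ a))) (cong ι (ℤ.*-comm (p m) (ℚ.↧ a)))))))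

coeff-≥length : ∀ P {m} → length P ≤ m → coeff P m ≡ 0ℚ
coeff-≥length []      h       = refl
coeff-≥length (a ∷ P) (s≤s h) = coeff-≥length P h

convℚ : (ℕ → ℚ) → (ℕ → ℚ) → ℕ → ℚ
convℚ f g zero    = f 0 ℚ.* g 0
convℚ f g (suc m) = f 0 ℚ.* g (suc m) ℚ.+ convℚ (f ∘ suc) g m

coeff-+ₚ : ∀ P Q m → coeff (P +ₚ Q) m ≡ coeff P m ℚ.+ coeff Q m
coeff-+ₚ []      Q       m       = sym (ℚ.+-identityˡ (coeff Q m))
coeff-+ₚ (a ∷ P) []      m       = sym (ℚ.+-identityʳ (coeff (a ∷ P) m))
coeff-+ₚ (a ∷ P) (b ∷ Q) zero    = refl
coeff-+ₚ (a ∷ P) (b ∷ Q) (suc m) = coeff-+ₚ P Q m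

coeff-map : ∀ a Q m → coeff (map (a ℚ.*_) Q) m ≡ a ℚ.* coeff Q m
coeff-map a []      m       = sym (ℚ.*-zeroʳ a)
coeff-map a (b ∷ Q) zero    = refl
coeff-map a (b ∷ Q) (suc m) = coeff-map a Q m

convℚ-0 : ∀ g m → convℚ (λ _ → 0ℚ) g m ≡ 0ℚ
convℚ-0 g zero    = ℚ.*-zeroˡ (g 0)
convℚ-0 g (suc m) = cong₂ ℚ._+_ (ℚ.*-zeroˡ (g (suc m))) (convℚ-0 g m)

coeff-*ₚ : ∀ P Q m → coeff (P *ₚ Q) m ≡ convℚ (coeff P) (coeff Q) m
coeff-*ₚ []      Q m       = sym (convℚ-0 (coeff Q) m)
coeff-*ₚ (a ∷ P) Q zero    = trans (coeff-+ₚ (map (a ℚ.*_) Q) (0ℚ ∷ P *ₚ Q) 0)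
  (trans (ℚ.+-identityʳ (coeff (map (a ℚ.*_) Q) 0)) (coeff-map a Q 0))
coeff-*ₚ (a ∷ P) Q (suc m) = trans (coeff-+ₚ (map (a ℚ.*_) Q) (0ℚ ∷ P *ₚ Q) (suc m))
  (cong₂ ℚ._+_ (coeff-map a Q (suc m)) (coeff-*ₚ P Q m))

convℚ-cleared : ∀ f g p q D E → (∀ i → f i ℚ.* ι D ≡ ι (p i)) → (∀ j → g j ℚ.* ι E ≡ ι (q j)) →
  ∀ m → convℚ f g m ℚ.* (ι D ℚ.* ι E) ≡ ι (conv p q m)
convℚ-cleared f g p q D E hf hg m = go f p hf m
  where
  term : ∀ f p → (∀ i → f i ℚ.* ι D ≡ ι (p i)) → ∀ j → f 0 ℚ.* g j ℚ.* (ι D ℚ.* ι E) ≡ ι (p 0 ℤ.* q j)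
  term f p hf j = trans (*ℚ-interchange (f 0) (g j) (ι D) (ι E)) (trans (cong₂ ℚ._*_ (hf 0) (hg j)) (sym (ι-* (p 0) (q j))))
  go : ∀ f p → (∀ i → f i ℚ.* ι D ≡ ι (p i)) → ∀ m → convℚ f g m ℚ.* (ι D ℚ.* ι E) ≡ ι (conv p q m)
  go f p hf zero    = term f p hf 0
  go f p hf (suc m) = trans (ℚ.*-distribʳ-+ (ι D ℚ.* ι E) (f 0 ℚ.* g (suc m)) (convℚ (f ∘ suc) g m))
    (trans (cong₂ ℚ._+_ (term f p hf (suc m)) (go (f ∘ suc) (p ∘ suc) (hf ∘ suc) m)) (sym (ι-+ (p 0 ℤ.* q (suc m)) (conv (p ∘ suc) q m))))

extend : ∀ {n} → (Fin n → ℤ) → ℕ → ℤ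
extend {zero}  b _       = pos 0
extend {suc n} b zero    = b Fin.zero
extend {suc n} b (suc j) = extend (b ∘ Fin.suc) j

extend-above : ∀ {n} (b : Fin n → ℤ) {j} → n ≤ j → extend b j ≡ pos 0
extend-above {zero}  b _       = refl
extend-above {suc n} b (s≤s h) = extend-above (b ∘ Fin.suc) h

extend-last : ∀ n (b : Fin (suc n) → ℤ) → extend b n ≡ b (Fin.fromℕ n)
extend-last zero    b = refl
extend-last (suc n) b = extend-last n (b ∘ Fin.suc)

-- Denominators and numerators are functions on ℕ so that the induction can shift them together with
-- the tail.
coeff-tabulate : ∀ {n} (g : Fin n → ℚ) (b : Fin n → ℤ) (M A : ℕ → ℕ) →
  (∀ i → g i ℚ.* ι (pos (M (Fin.toℕ i))) ≡ ι (b i ℤ.* pos (A (Fin.toℕ i)))) →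
  ∀ m → coeff (tabulate g) m ℚ.* ι (pos (M m)) ≡ ι (extend b m ℤ.* pos (A m))
coeff-tabulate {zero}  g b M A h m       = ℚ.*-zeroˡ (ι (pos (M m)))
coeff-tabulate {suc n} g b M A h zero    = h Fin.zero
coeff-tabulate {suc n} g b M A h (suc m) = coeff-tabulate (g ∘ Fin.suc) (b ∘ Fin.suc) (M ∘ suc) (A ∘ suc) (h ∘ Fin.suc) m

module _ {n s : ℕ} (b : Fin (suc n) → ℤ) where

  twisted : ℕ → ℤ
  twisted j = extend b j ℤ.* pos (lcoef n s j)

  twist : abs (b Fin.zero) ≡ 1 → abs (b (Fin.fromℕ n)) ≡ 1 → Twist n s (extend b) twisted
  twist h h′ = record { B-bottom = h ; B-top = trans (cong abs (extend-last n b)) h′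
                      ; F-above = λ j l → cong (ℤ._* pos (lcoef n s j)) (extend-above b l) ; F-below = λ _ → refl }

  hasFactor⇒factored : ∀ {k} → k ≤ n → HasFactorOfDegree (Gpoly n s b) k → Factored n k twisted
  hasFactor⇒factored {k} k≤n (P , Q , (lead , above) , eq) =
    factored {N = length Q} k≤n (λ h → [ P.D≢0 , Q.D≢0 ]′ (ℤ.i*j≡0⇒i≡0∨j≡0 P.D h))
      (λ i l → trans (cong (pos (n !) ℤ.*_) (P.vanishes (above i l))) (ℤ.*-zeroʳ (pos (n !))))
      (λ h → [ n!≢0 n , P.survives lead ]′ (ℤ.i*j≡0⇒i≡0∨j≡0 (pos (n !)) h))
      (λ i l → Q.vanishes (coeff-≥length Q (<⇒≤ l)))
      (λ j l → cong (ℤ._* pos (lcoef n s j)) (extend-above b l)) product-formula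
    where
    module P = Cleared (clear P)
    module Q = Cleared (clear Q)
    n!≢0 : ∀ n → pos (n !) ≢ pos 0
    n!≢0 n h = ≢-nonZero⁻¹ (n !) {{n !≢0}} (ℤ.+-injective h)
    G-cleared : ∀ m → coeff (Gpoly n s b) m ℚ.* ι (pos (m !)) ≡ ι (extend b m ℤ.* pos (aCoef n s m))
    G-cleared = coeff-tabulate (λ j → ((b j ℤ.* pos (aCoef n s (Fin.toℕ j))) ℚ./ (Fin.toℕ j !)) {{Fin.toℕ j !≢0}}) b _! (aCoef n s) λ i → /-clear (b i ℤ.* pos (aCoef n s (Fin.toℕ i))) (Fin.toℕ i !) {{Fin.toℕ i !≢0}}
    cleared-product : ∀ m → conv P.p Q.p m ℤ.* pos (m !) ≡ extend b m ℤ.* pos (aCoef n s m) ℤ.* (P.D ℤ.* Q.D)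
    cleared-product m = ι-injective (begin
      ι (conv P.p Q.p m ℤ.* pos (m !))                                       ≡⟨ ι-* (conv P.p Q.p m) (pos (m !)) ⟩
      ι (conv P.p Q.p m) ℚ.* ι (pos (m !))                                   ≡⟨ cong (ℚ._* ι (pos (m !))) (sym (convℚ-cleared (coeff P) (coeff Q) P.p Q.p P.D Q.D P.cleared Q.cleared m)) ⟩
      convℚ (coeff P) (coeff Q) m ℚ.* (ι P.D ℚ.* ι Q.D) ℚ.* ι (pos (m !))    ≡⟨ cong (λ z → z ℚ.* (ι P.D ℚ.* ι Q.D) ℚ.* ι (pos (m !))) (trans (sym (coeff-*ₚ P Q m)) (eq m)) ⟩
      coeff (Gpoly n s b) m ℚ.* (ι P.D ℚ.* ι Q.D) ℚ.* ι (pos (m !))          ≡⟨ *ℚ-swap (coeff (Gpoly n s b) m) (ι P.D ℚ.* ι Q.D) (ι (pos (m !))) ⟩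
      coeff (Gpoly n s b) m ℚ.* ι (pos (m !)) ℚ.* (ι P.D ℚ.* ι Q.D)          ≡⟨ cong₂ ℚ._*_ (G-cleared m) (sym (ι-* P.D Q.D)) ⟩
      ι (extend b m ℤ.* pos (aCoef n s m)) ℚ.* ι (P.D ℤ.* Q.D)               ≡⟨ sym (ι-* (extend b m ℤ.* pos (aCoef n s m)) (P.D ℤ.* Q.D)) ⟩
      ι (extend b m ℤ.* pos (aCoef n s m) ℤ.* (P.D ℤ.* Q.D))                 ∎)
      where
      open ≡-Reasoning
      *ℚ-swap : ∀ x y z → x ℚ.* y ℚ.* z ≡ x ℚ.* z ℚ.* y
      *ℚ-swap x y z = trans (ℚ.*-assoc x y z) (trans (cong (x ℚ.*_) (ℚ.*-comm y z)) (sym (ℚ.*-assoc x z y)))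
    factorials : ∀ m → extend b m ℤ.* pos (aCoef n s m) ℤ.* pos (n !) ≡ extend b m ℤ.* pos (lcoef n s m) ℤ.* pos (m !)
    factorials m with m ≤? n
    ... | no gt  rewrite extend-above b (≰⇒> gt) = refl
    ... | yes le = trans (ℤ.*-assoc (extend b m) (pos (aCoef n s m)) (pos (n !))) (trans (cong (extend b m ℤ.*_)
          (trans (sym (ℤ.pos-* (aCoef n s m) (n !))) (trans (cong pos (trans (sym (lcoef-! n s le)) (*-comm (m !) (lcoef n s m))))
            (ℤ.pos-* (lcoef n s m) (m !))))) (sym (ℤ.*-assoc (extend b m) (pos (lcoef n s m)) (pos (m !)))))
    -- The factor n! is absorbed by P. As the m-th coefficient of G has denominator m!, the identity
    -- is proved after multiplication by m!, where a_m n! = `lcoef` · m!.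
    product-formula : ∀ m → conv (λ i → pos (n !) ℤ.* P.p i) Q.p m ≡ P.D ℤ.* Q.D ℤ.* twisted m
    product-formula m = ℤ.*-cancelʳ-≡ _ _ (pos (m !)) {{m !≢0}} (begin
      conv (λ i → pos (n !) ℤ.* P.p i) Q.p m ℤ.* pos (m !)                     ≡⟨ cong (ℤ._* pos (m !)) (conv-scale (pos (n !)) P.p Q.p m) ⟩
      pos (n !) ℤ.* conv P.p Q.p m ℤ.* pos (m !)                               ≡⟨ ℤ.*-assoc (pos (n !)) (conv P.p Q.p m) (pos (m !)) ⟩
      pos (n !) ℤ.* (conv P.p Q.p m ℤ.* pos (m !))                             ≡⟨ cong (pos (n !) ℤ.*_) (cleared-product m) ⟩
      pos (n !) ℤ.* (extend b m ℤ.* pos (aCoef n s m) ℤ.* (P.D ℤ.* Q.D))       ≡⟨ rearrange (pos (n !)) (extend b m ℤ.* pos (aCoef n s m)) (P.D ℤ.* Q.D) ⟩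
      P.D ℤ.* Q.D ℤ.* (extend b m ℤ.* pos (aCoef n s m) ℤ.* pos (n !))         ≡⟨ cong (P.D ℤ.* Q.D ℤ.*_) (factorials m) ⟩
      P.D ℤ.* Q.D ℤ.* (twisted m ℤ.* pos (m !))                                ≡⟨ sym (ℤ.*-assoc (P.D ℤ.* Q.D) (twisted m) (pos (m !))) ⟩
      P.D ℤ.* Q.D ℤ.* twisted m ℤ.* pos (m !)                                  ∎)
      where
      open ≡-Reasoning
      rearrange : ∀ x y z → x ℤ.* (y ℤ.* z) ≡ z ℤ.* (y ℤ.* x)
      rearrange = ℤ-Ring.solve-∀

-- The bound s ≥ 2k and its consequences

factor⇒s≥2k : ∀ n s k (b : Fin (suc n) → ℤ) → Hyp n s k b → ¬ (n ≡ 10 × k ≡ 5 × s ≡ 4) → 2 * k ≤ s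
factor⇒s≥2k n s k b (_ , 2≤k , 2k≤n , b-bottom , b-top , hasFactor) ne = ≮⇒≥ λ s<2k →
  go (n ∸ k) (m∸n+n≡m deg≤n) (twist b b-bottom b-top) (hasFactor⇒factored b deg≤n hasFactor) s<2k
  where
  k+deg≤n : k + k ≤ n
  k+deg≤n = subst (_≤ n) (cong (k +_) (+-identityʳ k)) 2k≤n
  deg≤n : k ≤ n
  deg≤n = m+n≤o⇒m≤o k k+deg≤n
  go : ∀ m {F} → m + k ≡ n → Twist n s (extend b) F → Factored n k F → ¬ s < 2 * k
  go m refl tw fac s<2k = ne (exceptional⇒10,5,4
    (stuck⇒exceptional (factor⇒stuck tw (≤-trans (≤! 1 2 refl) 2≤k) fac) 2≤k (+-cancelʳ-≤ k k m k+deg≤n) s<2k) tw fac)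

scale-< : ∀ c e {k s} → suc c ≡ e * 2 → 1 ≤ k → 2 * k ≤ s → c * k < e * s
scale-< c e {k} {s} eq 1≤k 2k≤s = begin-strict
  c * k          <⟨ m<n+m (c * k) 1≤k ⟩
  suc c * k      ≡⟨ cong (_* k) eq ⟩
  e * 2 * k      ≡⟨ *-assoc e 2 k ⟩
  e * (2 * k)    ≤⟨ *-monoʳ-≤ e 2k≤s ⟩
  e * s          ∎
  where open ≤-Reasoning

ι-mono-≤ : ∀ {a b} → a ≤ b → ι (pos a) ℚ.≤ ι (pos b)
ι-mono-≤ {a} {b} h = ℚ.toℚᵘ-cancel-≤ (ℚᵘ.≤-respʳ-≃ (ℚᵘ.≃-sym (ℚ.toℚᵘ-fromℚᵘ (mkℚᵘ (pos b) 0)))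
  (ℚᵘ.≤-respˡ-≃ (ℚᵘ.≃-sym (ℚ.toℚᵘ-fromℚᵘ (mkℚᵘ (pos a) 0))) (*≤* (ℤ.*-monoʳ-≤-nonNeg (pos 1) (ℤ.+≤+ h)))))

φ-bound : ∀ {φ k s} → 0ℚ ℚ.< φ → 1 ≤ k → 2 * k ≤ s → ι (pos 2) ℚ.* (1ℚ ℚ.- ι (pos 2) ℚ.* φ) ℚ.* ι (pos k) ℚ.< ι (pos s)
φ-bound {φ} {k} {s} 0<φ 1≤k 2k≤s = ℚ.<-≤-trans
  (ℚ.*-monoˡ-<-pos (ι (pos k)) {{ℚ.normalize-pos k 1 {{_}} {{>-nonZero 1≤k}}}} (ℚ.*-monoʳ-<-pos (ι (pos 2))
    (ℚ.+-monoʳ-< 1ℚ (ℚ.neg-antimono-< (ℚ.*-monoʳ-<-pos (ι (pos 2)) 0<φ)))))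
  (subst (ℚ._≤ ι (pos s)) (trans (cong ι (ℤ.pos-* 2 k)) (ι-* (pos 2) (pos k))) (ι-mono-≤ 2k≤s))

open import Data.Integer using (+_)
open import Data.Rational using (_-_; _/_)
import Data.Rational as Q

theorem1p2 : ((n s k : ℕ) → (b : Fin (suc n) → ℤ) → Hyp n s k b →
    (¬ ((n ≡ 10) × (k ≡ 5) × (s ≡ 4)) → 19 * k < 10 * s)
    × (48732 ≤ n → 199 * k < 100 * s))
    × ((φ : ℚ) → 0ℚ Q.< φ → φ Q.< (+ 1 / 9) →
    ∃ λ (N : ℕ) → (n s k : ℕ) → (b : Fin (suc n) → ℤ) → Hyp n s k b →
    N ≤ n → (+ 2 / 1) Q.* (1ℚ - (+ 2 / 1) Q.* φ) Q.* (+ k / 1) Q.< (+ s / 1))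
theorem1p2 =
  (λ n s k b hyp → (λ ne → scale-< 19 10 {k} {s} refl (1≤k n s k b hyp) (factor⇒s≥2k n s k b hyp ne))
                 , (λ large → scale-< 199 100 {k} {s} refl (1≤k n s k b hyp) (factor⇒s≥2k n s k b hyp (not-10 (≤-trans (≤! 11 48732 refl) large)))))
  -- One N serves every φ, because 2(1 - 2φ)k < 2k ≤ s; 11 merely keeps n away from 10.
  , λ φ 0<φ _ → 11 , λ n s k b hyp 11≤n → φ-bound 0<φ (1≤k n s k b hyp) (factor⇒s≥2k n s k b hyp (not-10 11≤n))
  where
  1≤k : ∀ n s k (b : Fin (suc n) → ℤ) → Hyp n s k b → 1 ≤ k
  1≤k _ _ _ _ (_ , 2≤k , _) = ≤-trans (≤! 1 2 refl) 2≤k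
  not-10 : ∀ {n k s} → 11 ≤ n → ¬ ((n ≡ 10) × (k ≡ 5) × (s ≡ 4))
  not-10 11≤n (refl , _) = <-irrefl refl 11≤n
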